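{- Let $n\ge 0$ be an integer and let $b_n$ denote the number of plane bipolar posets with $n+2$ vertices. Then $b_n$ is equal to the number of plane permutations on $n$ elements.
   Context: A planar map is a connected multigraph embedded on the oriented sphere, up to orientation-preserving homeomorphism; it is rooted if a corner is marked; the vertex and face at this corner are the root vertex and the root (outer) face. A plane bipolar orientation is a rooted planar map (with at least one edge) endowed with an acyclic orientation having a unique source, which is the root vertex, and a unique sink, which is incident to the outer face. An edge $e=(u,v)$ is transitive if there is a directed path from $u$ to $v$ avoiding $e$. A plane bipolar poset is a plane bipolar orientation with no transitive edge. A permutation $\pi$ of $\{1,\dots,n\}$ is a plane permutation if it avoids the vincular pattern $2\,\underline{14}\,3$, i.e., there are no indices $i<j<j+1<k$ such that $\pi(j)<\pi(i)<\pi(k)<\pi(j+1)$. -}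

module Defs where

open import Data.Bool.Base using (Bool; true; false; not)
open import Data.Fin.Base using (Fin; toℕ) renaming (_<_ to _<ᶠ_)
open import Data.Fin.Permutation using (Permutation′; _⟨$⟩ʳ_)
open import Data.Nat.Base using (ℕ; suc; _+_)
open import Data.Product.Base using (Σ; ∃; _×_; _,_; proj₁)
open import Data.Sum.Base using (_⊎_)
open import Function.Base using (_∘_)
open import Function.Bundles using (Inverse; _↔_)
import Function.Construct.Composition as Composition
import Function.Construct.Identity as Identity
import Function.Construct.Symmetry as Symmetry
open import Level using (0ℓ)
open import Relation.Binary.Bundles using (Setoid)
open import Relation.Binary.Core using (Rel)
open import Relation.Binary.Structures using (IsEquivalence)
import Relation.Binary.Construct.Closure.Equivalence as EqClosure
open EqClosure using (EqClosure)
open import Relation.Binary.Construct.Closure.Transitive using (TransClosure)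
import Relation.Binary.Construct.On as On
open import Relation.Binary.PropositionalEquality
  using (_≡_; _≢_; refl; sym; trans; cong; setoid; _→-setoid_)
open import Relation.Nullary using (¬_)

-- The setoid S has exactly k equivalence classes.
HasCardinality : Setoid 0ℓ 0ℓ → ℕ → Set
HasCardinality S k = Inverse S (setoid (Fin k))

-- The classes are the cycles of f when f is a bijection.
Orbits : {A : Set} → (A → A) → Setoid 0ℓ 0ℓ
Orbits f = EqClosure.setoid (λ x y → f x ≡ y)

-- Rooted planar maps with at least one edge, as combinatorial maps on a set
-- of darts (half-edges).  σ sends a dart to the next one counterclockwise
-- around its vertex, and α to the other half of its edge; thus σ ∘ α walks
-- along a face, keeping it on the right.  The corner of a dart h is the sector
-- between σ⁻¹ h and h; it belongs to the vertex (σ-orbit) and to the face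
-- (σ ∘ α-orbit) of h, so marking a corner amounts to marking a dart.  The
-- only rooted map left out is the one with a single vertex and no edge.
record RootedPlanarMap : Set where
  field
    #darts : ℕ

  Dart : Set
  Dart = Fin #darts

  field
    σ            : Permutation′ #darts
    α            : Dart → Dart
    α-involutive : ∀ h → α (α h) ≡ h
    α-fixfree    : ∀ h → α h ≢ h
    root         : Dart

  φ : Dart → Dart
  φ h = σ ⟨$⟩ʳ (α h)

  Vertices : Setoid 0ℓ 0ℓ
  Vertices = Orbits (σ ⟨$⟩ʳ_)

  Edges : Setoid 0ℓ 0ℓ
  Edges = Orbits α

  Faces : Setoid 0ℓ 0ℓ
  Faces = Orbits φ

  _∼ᵛ_ : Rel Dart 0ℓ
  _∼ᵛ_ = Setoid._≈_ Vertices

  _∼ᶠ_ : Rel Dart 0ℓ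
  _∼ᶠ_ = Setoid._≈_ Faces

  field
    connected : ∀ x y → EqClosure (λ g h → σ ⟨$⟩ʳ g ≡ h ⊎ α g ≡ h) x y
    #vertices #edges #faces : ℕ
    vertex-count : HasCardinality Vertices #vertices
    edge-count   : HasCardinality Edges #edges
    face-count   : HasCardinality Faces #faces
    -- Euler's formula: the underlying surface is the sphere.
    genus-zero   : #vertices + #faces ≡ #edges + 2

-- Vertices are represented by any dart at them, and an oriented edge by its
-- outgoing dart h: it goes from the vertex of h to the vertex of α h.
module Oriented (M : RootedPlanarMap)
                (outgoing : RootedPlanarMap.Dart M → Bool) where
  open RootedPlanarMap M

  Edge : Dart → Set
  Edge h = outgoing h ≡ true

  Arc : Rel Dart 0ℓ
  Arc x y = ∃ λ h → Edge h × h ∼ᵛ x × α h ∼ᵛ y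

  ArcAvoiding : Dart → Rel Dart 0ℓ
  ArcAvoiding e x y = ∃ λ h → Edge h × h ≢ e × h ∼ᵛ x × α h ∼ᵛ y

  Acyclic : Set
  Acyclic = ∀ x → ¬ TransClosure Arc x x

  IsSource IsSink : Dart → Set
  IsSource x = ∀ h → h ∼ᵛ x → outgoing h ≡ true
  IsSink   x = ∀ h → h ∼ᵛ x → outgoing h ≡ false

  -- Only nonempty paths are considered; this is harmless, as the two ends of
  -- an edge of an acyclic orientation are distinct.
  IsTransitive : Dart → Set
  IsTransitive e = TransClosure (ArcAvoiding e) e (α e)

record PlaneBipolarOrientation : Set where
  field
    rootedMap : RootedPlanarMap

  open RootedPlanarMap rootedMap public

  field
    outgoing   : Dart → Bool
    outgoing-α : ∀ h → outgoing (α h) ≡ not (outgoing h)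

  open Oriented rootedMap outgoing public

  field
    acyclic       : Acyclic
    root-source   : IsSource root
    source-unique : ∀ x → IsSource x → x ∼ᵛ root
    -- The sink, given by one of its corners lying in the outer face.
    sink          : Dart
    sink-outer    : sink ∼ᶠ root
    sink-sink     : IsSink sink
    sink-unique   : ∀ x → IsSink x → x ∼ᵛ sink

record PlaneBipolarPoset : Set where
  field
    orientation : PlaneBipolarOrientation

  open PlaneBipolarOrientation orientation public

  field
    no-transitive : ∀ e → Edge e → ¬ IsTransitive e

-- Orientation-preserving homeomorphisms of the sphere that respect the root
-- corner and the orientations of the edges.
record _≅_ (P Q : PlaneBipolarOrientation) : Set where
  private
    module P = PlaneBipolarOrientation P
    module Q = PlaneBipolarOrientation Q
  field
    bijection : P.Dart ↔ Q.Dart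

  open Inverse bijection public using (to; from)

  field
    to-σ        : ∀ h → to (P.σ ⟨$⟩ʳ h) ≡ Q.σ ⟨$⟩ʳ to h
    to-α        : ∀ h → to (P.α h) ≡ Q.α (to h)
    to-root     : to P.root ≡ Q.root
    to-outgoing : ∀ h → Q.outgoing (to h) ≡ P.outgoing h

≅-refl : ∀ {P} → P ≅ P
≅-refl {P} = record
  { bijection   = Identity.↔-id _
  ; to-σ        = λ _ → refl
  ; to-α        = λ _ → refl
  ; to-root     = refl
  ; to-outgoing = λ _ → refl
  }

≅-sym : ∀ {P Q} → P ≅ Q → Q ≅ P
≅-sym {P} {Q} i = record
  { bijection   = Symmetry.↔-sym bijection
  ; to-σ        = λ h → flipped (trans (to-σ (from h)) (cong (Q.σ ⟨$⟩ʳ_) (to-from h)))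
  ; to-α        = λ h → flipped (trans (to-α (from h)) (cong Q.α (to-from h)))
  ; to-root     = flipped to-root
  ; to-outgoing = λ h → trans (sym (to-outgoing (from h))) (cong Q.outgoing (to-from h))
  }
  where
  module Q = PlaneBipolarOrientation Q
  open _≅_ i

  to-from : ∀ h → to (from h) ≡ h
  to-from = Inverse.strictlyInverseˡ bijection

  flipped : ∀ {g h} → to g ≡ h → from h ≡ g
  flipped eq = Inverse.inverseʳ bijection (sym eq)

≅-trans : ∀ {P Q R} → P ≅ Q → Q ≅ R → P ≅ R
≅-trans i j = record
  { bijection   = j.bijection Composition.↔-∘ i.bijection
  ; to-σ        = λ h → trans (cong j.to (i.to-σ h)) (j.to-σ (i.to h))
  ; to-α        = λ h → trans (cong j.to (i.to-α h)) (j.to-α (i.to h))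
  ; to-root     = trans (cong j.to i.to-root) j.to-root
  ; to-outgoing = λ h → trans (j.to-outgoing (i.to h)) (i.to-outgoing h)
  }
  where
  module i = _≅_ i
  module j = _≅_ j

≅-isEquivalence : IsEquivalence _≅_
≅-isEquivalence = record { refl = ≅-refl ; sym = ≅-sym ; trans = ≅-trans }

PlaneBipolarPosets : (v : ℕ) → Setoid 0ℓ 0ℓ
PlaneBipolarPosets v = record
  { Carrier       = Σ PlaneBipolarPoset (λ P → PlaneBipolarPoset.#vertices P ≡ v)
  ; isEquivalence =
      On.isEquivalence (PlaneBipolarPoset.orientation ∘ proj₁) ≅-isEquivalence
  }

-- The pattern 2 14 3, with the entries for 1 and 4 in adjacent positions j, j′.
IsPlane : ∀ {n} → Permutation′ n → Set
IsPlane {n} π = ¬ (∃ λ (i : Fin n) → ∃ λ (j : Fin n) → ∃ λ (j′ : Fin n) → ∃ λ (k : Fin n) →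
  i <ᶠ j × toℕ j′ ≡ suc (toℕ j) × j′ <ᶠ k ×
  π ⟨$⟩ʳ j <ᶠ π ⟨$⟩ʳ i × π ⟨$⟩ʳ i <ᶠ π ⟨$⟩ʳ k × π ⟨$⟩ʳ k <ᶠ π ⟨$⟩ʳ j′)

PlanePermutations : (n : ℕ) → Setoid 0ℓ 0ℓ
PlanePermutations n = record
  { Carrier       = Σ (Permutation′ n) IsPlane
  ; isEquivalence =
      On.isEquivalence ((_⟨$⟩ʳ_) ∘ proj₁) (Setoid.isEquivalence (Fin n →-setoid Fin n))
  }

{-# OPTIONS --safe #-}
module Submission where

-- A plane permutation, seen as the set of points (i , π i) together with a new
-- lowest and a new highest point, corresponds to the Hasse diagram of its
-- dominance order, drawn with its points where they are; the forbidden pattern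
-- says that no two edges cross.  Conversely, Euler's formula forces every inner
-- vertex of a plane bipolar orientation to have consecutive outgoing edges, and
-- every face to be bounded by two directed paths.  Then the vertices of a plane
-- bipolar poset are ordered from left to right by the lexicographic order of
-- their rightmost paths from the source; this order and the conjugate one
-- (lying above, or further to the left) are the two coordinates of a point set
-- whose dominance order has the given poset as its Hasse diagram.

open import Defs
open import Data.Bool.Base using (Bool; true; false; not)
open import Data.Bool.Properties using () renaming (_≟_ to _≟ᵇ_)
open import Data.Empty using (⊥; ⊥-elim)
open import Data.Fin.Base
  using (Fin; zero; suc; toℕ; fromℕ; fromℕ<; inject₁; cast; _↑ˡ_; _↑ʳ_; join; splitAt; finToFun; funToFin)
  renaming (_<_ to _<ᶠ_)
import Data.Fin.Induction as FinI
open import Data.Fin.Permutation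
  using (Permutation′; permutation; _⟨$⟩ʳ_; _⟨$⟩ˡ_; inverseˡ; inverseʳ)
import Data.Fin.Properties as Fin
open import Data.Fin.Relation.Unary.Top using (view; view-fromℕ; view-inject₁; ‵fromℕ; ‵inject₁)
open import Data.Fin.Subset using (Subset; ∣_∣; _∈_)
open import Data.Fin.Subset.Properties using (p⊂q⇒∣p∣<∣q∣; ∣⊤∣≡n; ∈⊤; ⊆⊤)
open import Data.List.Base using (List; []; _∷_; length; map; allFin; cartesianProduct)
open import Data.List.Membership.Propositional.Properties using (∈-allFin; ∈-cartesianProduct⁺)
open import Data.List.Relation.Unary.Any as Any using (Any; here; there)
import Data.List.Relation.Unary.Any.Properties as Any
open import Data.Nat.Base as ℕ using (ℕ; zero; suc; _+_; _^_; _≤_; _<_; z≤n; s≤s)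
open import Data.Nat.Induction as ℕI using ()
import Data.Nat.Properties as ℕ
open import Data.Product.Base using (Σ; ∃; _×_; _,_; proj₁; proj₂; swap)
open import Data.Product.Properties using (≡-dec)
open import Data.Sum.Base using (_⊎_; inj₁; inj₂; [_,_]′)
open import Data.Vec.Base using (tabulate)
open import Data.Vec.Properties using (lookup∘tabulate; lookup⇒[]=; []=⇒lookup)
open import Function.Base using (_∘_; id; flip; case_of_)
open import Function.Bundles using (Inverse; mk↔ₛ′)
import Function.Construct.Composition as Composition
open import Induction.WellFounded using (WellFounded; Acc; acc)
open import Level using (0ℓ)
open import Relation.Binary.Bundles using (Setoid)
import Relation.Binary.Construct.Closure.Equivalence as EqClosure
open EqClosure using (EqClosure)
open import Relation.Binary.Construct.Closure.ReflexiveTransitive using (Star; ε; _◅_; _◅◅_)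
open import Relation.Binary.Construct.Closure.Symmetric using (fwd; bwd)
open import Relation.Binary.Construct.Closure.Transitive using (TransClosure; [_]; _∷_; _++_)
import Relation.Binary.Construct.On as On
open import Relation.Binary.Core using (Rel)
open import Relation.Binary.Definitions using (Tri; tri<; tri≈; tri>; Transitive)
open import Relation.Binary.PropositionalEquality
  using (_≡_; _≢_; refl; sym; trans; cong; cong₂; subst; subst₂; isEquivalence)
open import Relation.Nullary using (¬_; Dec; yes; no; does; ¬?)
open import Relation.Nullary.Decidable using (_×-dec_; _→-dec_; dec-true)
open import Relation.Unary using (Decidable)

-- Finite sets and orbits

-- A combinatorial map comes without a Jordan curve theorem: planarity is available only as the
-- count `genus-zero`. For a given orientation the count is used once, to turn an injection into a
-- bijection and thereby make the admissible corners of vertices and faces unique; every later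
-- argument about regions is a comparison of paths. For a given permutation the count has to be
-- proved, which amounts to showing that every face of the Hasse diagram has exactly one bottom
-- edge. The two constructions are never composed. The relation `Drawing y O` plays the part of the
-- graph of the bijection: it is shown to be total and single-valued in both directions, up to
-- pointwise equality on one side and `≅` on the other, and the inverse laws are instances of
-- uniqueness. The second coordinate is a linear order thanks to a property of the first: a vertex
-- placed between the two ends of a directed path is reachable from the lower end or reaches the
-- upper one. The shift from n to n + 2 comes from the source and the sink, which are the two added
-- extreme points.

injective⇒surjective : ∀ {n} (f : Fin n → Fin n) → (∀ {x y} → f x ≡ f y → x ≡ y) →
                       ∀ y → ∃ λ x → f x ≡ y
injective⇒surjective {n} f inj y with Fin.any? (λ x → f x Fin.≟ y)
... | yes hit = hit
... | no miss = ⊥-elim (ℕ.1+n≰n (Fin.injective⇒≤ {f = g} g-inj))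
  where
  -- The missed value `y` is used as one more value, which makes an injection into a smaller set.
  g : Fin (suc n) → Fin n
  g zero    = y
  g (suc x) = f x
  g-inj : ∀ {a b} → g a ≡ g b → a ≡ b
  g-inj {zero}  {zero}  eq = refl
  g-inj {zero}  {suc b} eq = ⊥-elim (miss (b , sym eq))
  g-inj {suc a} {zero}  eq = ⊥-elim (miss (a , eq))
  g-inj {suc a} {suc b} eq = cong suc (inj eq)

injective⇒permutation : ∀ {n} (f : Fin n → Fin n) → (∀ {x y} → f x ≡ f y → x ≡ y) →
                        Σ (Permutation′ n) λ π → ∀ x → π ⟨$⟩ʳ x ≡ f x
injective⇒permutation f inj =
  permutation f f⁻¹ f-f⁻¹ (λ x → inj (f-f⁻¹ (f x))) , λ _ → refl
  where
  f⁻¹ = λ y → proj₁ (injective⇒surjective f inj y)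
  f-f⁻¹ : ∀ y → f (f⁻¹ y) ≡ y
  f-f⁻¹ y = proj₂ (injective⇒surjective f inj y)

join-injective : ∀ m n {x y : Fin m ⊎ Fin n} → join m n x ≡ join m n y → x ≡ y
join-injective m n {x} {y} eq =
  trans (sym (Fin.splitAt-join m n x)) (trans (cong (splitAt m) eq) (Fin.splitAt-join m n y))

splitAt-injective : ∀ m n {x y : Fin (m + n)} → splitAt m x ≡ splitAt m y → x ≡ y
splitAt-injective m n {x} {y} eq =
  trans (sym (Fin.join-splitAt m n x)) (trans (cong (join m n) eq) (Fin.join-splitAt m n y))

⊎-injective⇒≤ : ∀ {a b c d} (f : Fin a ⊎ Fin b → Fin c ⊎ Fin d) →
                (∀ {x y} → f x ≡ f y → x ≡ y) → a + b ≤ c + d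
⊎-injective⇒≤ {a} {b} {c} {d} f inj =
  Fin.injective⇒≤ {f = join c d ∘ f ∘ splitAt a}
    (splitAt-injective a b ∘ inj ∘ join-injective c d)

⊎-injective⇒surjective : ∀ {a b c d} → a + b ≡ c + d → (f : Fin a ⊎ Fin b → Fin c ⊎ Fin d) →
                         (∀ {x y} → f x ≡ f y → x ≡ y) → ∀ y → ∃ λ x → f x ≡ y
⊎-injective⇒surjective {a} {b} {c} {d} eq f inj y = splitAt a (proj₁ hit) , join-injective c d
  (trans (sym (cast-cast (join c d (f (splitAt a (proj₁ hit))))))
    (trans (cong (cast eq) (proj₂ hit)) (cast-cast (join c d y))))
  where
  cast-cast : ∀ z → cast eq (cast (sym eq) z) ≡ z
  cast-cast z = Fin.toℕ-injective (trans (Fin.toℕ-cast eq _) (Fin.toℕ-cast (sym eq) z))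
  g : Fin (a + b) → Fin (a + b)
  g = cast (sym eq) ∘ join c d ∘ f ∘ splitAt a
  g-inj : ∀ {x y} → g x ≡ g y → x ≡ y
  g-inj = splitAt-injective a b ∘ inj ∘ join-injective c d ∘
    λ e → trans (sym (cast-cast _)) (trans (cong (cast eq) e) (cast-cast _))
  hit = injective⇒surjective g g-inj (cast (sym eq) (join c d y))

maximal : ∀ {k} {_<′_ : Rel (Fin k) 0ℓ} → (∀ a b → Dec (a <′ b)) → (∀ {a} → ¬ a <′ a) →
          Transitive _<′_ → {P : Fin k → Set} → Decidable P → ∃ P →
          ∃ λ m → P m × (∀ d → P d → ¬ m <′ d)
maximal {suc k} _<?_ irr tr {P} P? (w , pw) with Fin.any? (P? ∘ suc)
maximal {suc k} _<?_ irr tr {P} P? (zero , pw) | no none =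
  zero , pw , λ { zero _ → irr ; (suc d) p → ⊥-elim (none (d , p)) }
maximal {suc k} _<?_ irr tr {P} P? (suc w , pw) | no none = ⊥-elim (none (w , pw))
... | yes some with maximal (λ a b → suc a <? suc b) irr tr (P? ∘ suc) some
... | m , pm , max with P? zero | suc m <? zero
... | yes p0 | yes m<0 = zero , p0 , λ { zero _ → irr ; (suc d) p 0<d → max d p (tr m<0 0<d) }
... | yes p0 | no m≮0  = suc m , pm , λ { zero _ → m≮0 ; (suc d) p → max d p }
... | no ¬p0 | _       = suc m , pm , λ { zero p → ⊥-elim (¬p0 p) ; (suc d) p → max d p }

wellFounded : ∀ {k} {_<′_ : Rel (Fin k) 0ℓ} → (∀ {a} → ¬ a <′ a) → Transitive _<′_ → WellFounded _<′_
wellFounded {_<′_ = _<′_} irr tr = FinI.spo-wellFounded (record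
  { isEquivalence = isEquivalence
  ; irrefl        = λ { refl → irr }
  ; trans         = tr
  ; <-resp-≈      = (λ { refl → id }) , (λ { refl → id })
  })

trichotomy : ∀ {A : Set} {_<′_ : Rel A 0ℓ} → (∀ {a} → ¬ a <′ a) → Transitive _<′_ →
             ∀ {a b} → a <′ b ⊎ a ≡ b ⊎ b <′ a → Tri (a <′ b) (a ≡ b) (b <′ a)
trichotomy irr tr (inj₁ lt)          = tri< lt (λ { refl → irr lt }) (λ gt → irr (tr lt gt))
trichotomy irr tr (inj₂ (inj₁ refl)) = tri≈ irr refl irr
trichotomy irr tr (inj₂ (inj₂ gt))   = tri> (λ lt → irr (tr lt gt)) (λ { refl → irr gt }) gt

module Rank {m : ℕ} (_<′_ : Rel (Fin m) 0ℓ) (irr : ∀ {a} → ¬ a <′ a) (tr : Transitive _<′_)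
            (cmp : ∀ a b → Tri (a <′ b) (a ≡ b) (b <′ a)) where

  below? : ∀ a b → Dec (a <′ b)
  below? a b with cmp a b
  ... | tri< p _ _ = yes p
  ... | tri≈ p _ _ = no p
  ... | tri> p _ _ = no p

  Below : Fin m → Subset m
  Below u = tabulate (λ w → does (below? w u))


  ∈⇒< : ∀ {w u} → w ∈ Below u → w <′ u
  ∈⇒< {w} {u} w∈ with below? w u | trans (sym (lookup∘tabulate _ w)) ([]=⇒lookup w∈)
  ... | yes p | _ = p

  <⇒∈ : ∀ {w u} → w <′ u → w ∈ Below u
  <⇒∈ {w} {u} p = lookup⇒[]= w _ (trans (lookup∘tabulate _ w) (dec-true (below? w u) p))

  rankℕ-mono : ∀ {u v} → u <′ v → ∣ Below u ∣ < ∣ Below v ∣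
  rankℕ-mono {u} u<v =
    p⊂q⇒∣p∣<∣q∣ ((λ w∈ → <⇒∈ (tr (∈⇒< w∈) u<v)) , u , <⇒∈ u<v , λ u∈ → irr (∈⇒< u∈))

  opaque
    rank : Fin m → Fin m
    rank u = fromℕ< (subst (∣ Below u ∣ <_) (∣⊤∣≡n m)
      (p⊂q⇒∣p∣<∣q∣ (⊆⊤ , u , ∈⊤ , λ u∈ → irr (∈⇒< u∈))))

    rank-mono : ∀ {u v} → u <′ v → rank u <ᶠ rank v
    rank-mono u<v = subst₂ _<_ (sym (Fin.toℕ-fromℕ< _)) (sym (Fin.toℕ-fromℕ< _)) (rankℕ-mono u<v)

  rank-cancel : ∀ {u v} → rank u <ᶠ rank v → u <′ v
  rank-cancel {u} {v} lt with cmp u v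
  ... | tri< p _ _    = p
  ... | tri≈ _ refl _ = ⊥-elim (ℕ.<-irrefl refl lt)
  ... | tri> _ _ q    = ⊥-elim (ℕ.<-asym lt (rank-mono q))

  rank-injective : ∀ {u v} → rank u ≡ rank v → u ≡ v
  rank-injective {u} {v} eq with cmp u v
  ... | tri< p _ _ = ⊥-elim (ℕ.<-irrefl (cong toℕ eq) (rank-mono p))
  ... | tri≈ _ p _ = p
  ... | tri> _ _ q = ⊥-elim (ℕ.<-irrefl (cong toℕ (sym eq)) (rank-mono q))

  rank-surjective : ∀ i → ∃ λ u → rank u ≡ i
  rank-surjective = injective⇒surjective rank rank-injective

-- A least `i` sent below itself would have `f i` as a smaller such element; `up` is the mirror
-- image. It serves to turn agreement of two orders into equality of coordinates.
monotone⇒id : ∀ {n} (f : Fin n → Fin n) → (∀ {i j} → i <ᶠ j → f i <ᶠ f j) → ∀ i → f i ≡ i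
monotone⇒id f mono i = Fin.≤-antisym (up i (FinI.>-wellFounded i)) (down i (FinI.<-wellFounded i))
  where
  inj : ∀ {x y} → f x ≡ f y → x ≡ y
  inj {x} {y} eq with Fin.<-cmp x y
  ... | tri< p _ _ = ⊥-elim (ℕ.<-irrefl (cong toℕ eq) (mono p))
  ... | tri≈ _ p _ = p
  ... | tri> _ _ q = ⊥-elim (ℕ.<-irrefl (cong toℕ (sym eq)) (mono q))
  down : ∀ i → Acc _<ᶠ_ i → toℕ i ≤ toℕ (f i)
  down i (acc rs) with ℕ.≤-<-connex (toℕ i) (toℕ (f i))
  ... | inj₁ le = le
  ... | inj₂ lt = ⊥-elim (ℕ.<⇒≱ (mono lt) (down (f i) (rs lt)))
  up : ∀ i → Acc (flip _<ᶠ_) i → toℕ (f i) ≤ toℕ i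
  up i (acc rs) with ℕ.≤-<-connex (toℕ (f i)) (toℕ i)
  ... | inj₁ le = le
  ... | inj₂ lt = ⊥-elim (ℕ.<⇒≱ (mono lt) (up (f i) (rs lt)))

module _ (S : Setoid 0ℓ 0ℓ) (_≈?_ : ∀ x y → Dec (Setoid._≈_ S x y)) where
  open Setoid S using (Carrier; _≈_)
  private module S = Setoid S

  representatives : ∀ xs → ∃ λ k → Σ (Fin k → Carrier) λ r →
    (∀ {i j} → r i ≈ r j → i ≡ j) × (∀ {x} → Any (x ≈_) xs → ∃ λ i → x ≈ r i)
  representatives [] = 0 , (λ ()) , (λ { {()} }) , λ ()
  representatives (x ∷ xs) with representatives xs
  ... | k , r , inj , cover with Fin.any? (λ i → x ≈? r i)
  ... | yes (i , x≈) = k , r , inj , λ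
    { (here y≈)  → i , S.trans y≈ x≈
    ; (there y∈) → cover y∈ }
  ... | no ¬x≈ = suc k , r′ , inj′ , λ
    { (here y≈)  → zero , y≈
    ; (there y∈) → suc (proj₁ (cover y∈)) , proj₂ (cover y∈) }
    where
    r′ : Fin (suc k) → Carrier
    r′ zero    = x
    r′ (suc i) = r i
    inj′ : ∀ {i j} → r′ i ≈ r′ j → i ≡ j
    inj′ {zero}  {zero}  _  = refl
    inj′ {zero}  {suc j} eq = ⊥-elim (¬x≈ (j , eq))
    inj′ {suc i} {zero}  eq = ⊥-elim (¬x≈ (i , S.sym eq))
    inj′ {suc i} {suc j} eq = cong suc (inj eq)

  enumerated⇒cardinality : ∀ xs → (∀ x → Any (x ≈_) xs) → ∃ (HasCardinality S)
  enumerated⇒cardinality xs all with representatives xs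
  ... | k , r , inj , cover = k , record
    { to        = index
    ; from      = r
    ; to-cong   = λ {x} {y} x≈y →
        inj (S.trans (S.sym (index-≈ x)) (S.trans x≈y (index-≈ y)))
    ; from-cong = λ { refl → S.refl }
    ; inverse   = (λ {i} {x} x≈ → inj (S.trans (S.sym (index-≈ x)) x≈))
                , (λ { {x} refl → S.sym (index-≈ x) })
    }
    where
    index : Carrier → Fin k
    index x = proj₁ (cover (all x))
    index-≈ : ∀ x → x ≈ r (index x)
    index-≈ x = proj₂ (cover (all x))

module Iterates {n : ℕ} (f : Fin n → Fin n) (inj : ∀ {x y} → f x ≡ f y → x ≡ y) where

  iterate : ℕ → Fin n → Fin n
  iterate zero    x = x
  iterate (suc k) x = f (iterate k x)

  iterate-+ : ∀ j k x → iterate (j + k) x ≡ iterate j (iterate k x)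
  iterate-+ zero    k x = refl
  iterate-+ (suc j) k x = cong f (iterate-+ j k x)

  iterate-cancel : ∀ j k x → iterate j x ≡ iterate (j + k) x → x ≡ iterate k x
  iterate-cancel zero    k x eq = eq
  iterate-cancel (suc j) k x eq = iterate-cancel j k x (inj eq)

  periodic : ∀ x → ∃ λ k → iterate (suc k) x ≡ x
  periodic x with Fin.pigeonhole {n = suc n} (ℕ.n<1+n n) (λ i → iterate (toℕ i) x)
  ... | i , j , i<j , eq with ℕ.m≤n⇒∃[o]m+o≡n i<j
  ... | k , i+k = k , sym (iterate-cancel (toℕ i) (suc k) x
    (trans eq (cong (λ m → iterate m x) (trans (sym i+k) (sym (ℕ.+-suc (toℕ i) k))))))

  -- On a finite set the inverse of an injective map acts at each point as a natural power of it, so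
  -- orbits, which allow steps in both directions, are swept by forward steps alone.
  step-back : ∀ x → ∃ λ k → iterate k (f x) ≡ x
  step-back x with periodic x
  ... | k , eq = k , trans (commute k) eq
    where
    commute : ∀ k → iterate k (f x) ≡ f (iterate k x)
    commute zero    = refl
    commute (suc k) = cong f (commute k)

  orbit⇒iterate : ∀ {x y} → EqClosure (λ a b → f a ≡ b) x y → ∃ λ k → iterate k x ≡ y
  orbit⇒iterate ε = 0 , refl
  orbit⇒iterate {x} (fwd refl ◅ rest) with orbit⇒iterate rest
  ... | k , eq = k + 1 , trans (iterate-+ k 1 x) eq
  orbit⇒iterate {x} (bwd refl ◅ rest) with orbit⇒iterate rest | step-back _
  ... | k , eq | j , back = k + j , trans (iterate-+ k j _) (trans (cong (iterate k) back) eq)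

orbit-invariant : ∀ {A B : Set} {f : A → A} (g : A → B) → (∀ x → g (f x) ≡ g x) →
                  ∀ {x y} → EqClosure (λ a b → f a ≡ b) x y → g x ≡ g y
orbit-invariant g inv ε = refl
orbit-invariant g inv (fwd refl ◅ p) = trans (sym (inv _)) (orbit-invariant g inv p)
orbit-invariant g inv (bwd refl ◅ p) = trans (inv _) (orbit-invariant g inv p)

module _ {A : Set} {P : A → Set} (P? : Decidable P) where

  satisfying : List A → List (Σ A P)
  satisfying [] = []
  satisfying (x ∷ xs) with P? x
  ... | yes p = (x , p) ∷ satisfying xs
  ... | no _  = satisfying xs

  satisfying-complete : ∀ {x xs} → P x → Any (x ≡_) xs → Any (λ z → x ≡ proj₁ z) (satisfying xs)
  satisfying-complete {xs = x ∷ xs} px x∈ with P? x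
  satisfying-complete px (here refl) | yes _ = here refl
  satisfying-complete px (there x∈)  | yes _ = there (satisfying-complete px x∈)
  satisfying-complete px (here refl) | no ¬p = ⊥-elim (¬p px)
  satisfying-complete px (there x∈)  | no _  = satisfying-complete px x∈

-- Corners of plane bipolar orientations

to-reflects : ∀ {S : Setoid 0ℓ 0ℓ} {k} (c : HasCardinality S k) {x y} →
              Inverse.to c x ≡ Inverse.to c y → Setoid._≈_ S x y
to-reflects {S} c {x} {y} eq =
  S.trans (S.sym (Inverse.strictlyInverseʳ c x))
    (S.trans (Inverse.from-cong c eq) (Inverse.strictlyInverseʳ c y))
  where module S = Setoid S

TransClosure-snoc : ∀ {A : Set} {R : Rel A 0ℓ} {x y z} → TransClosure R x y → R y z → TransClosure R x z
TransClosure-snoc p r = p ++ [ r ]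

TransClosure-flip : ∀ {A : Set} {R R′ : Rel A 0ℓ} → (∀ {x y} → R x y → R′ y x) →
                    ∀ {x y} → TransClosure R x y → TransClosure R′ y x
TransClosure-flip f [ r ]   = [ f r ]
TransClosure-flip f (r ∷ p) = TransClosure-snoc (TransClosure-flip f p) (f r)

true≢false : true ≢ false
true≢false ()

-- The rotation is kept, and the outer corner of the sink becomes the root corner. This transfers
-- the uniqueness of the bottom corner of a face to its top corner.
reversed : PlaneBipolarOrientation → PlaneBipolarOrientation
reversed O = record
  { rootedMap     = record
    { #darts = #darts ; σ = σ ; α = α ; α-involutive = α-involutive ; α-fixfree = α-fixfree
    ; root = sink ; connected = connected ; #vertices = #vertices ; #edges = #edges
    ; #faces = #faces ; vertex-count = vertex-count ; edge-count = edge-count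
    ; face-count = face-count ; genus-zero = genus-zero }
  ; outgoing      = not ∘ outgoing
  ; outgoing-α    = λ h → cong not (outgoing-α h)
  ; acyclic       = λ x → acyclic x ∘ TransClosure-flip turn
  ; root-source   = λ h h∼ → cong not (sink-sink h h∼)
  ; source-unique = λ x src → sink-unique x λ h h∼ → unnot (src h h∼)
  ; sink          = root
  ; sink-outer    = Setoid.sym Faces sink-outer
  ; sink-sink     = λ h h∼ → cong not (root-source h h∼)
  ; sink-unique   = λ x snk → source-unique x λ h h∼ → unnot (snk h h∼)
  }
  where
  open PlaneBipolarOrientation O
  unnot : ∀ {a b} → not a ≡ b → a ≡ not b
  unnot {true}  refl = refl
  unnot {false} refl = refl
  turn : ∀ {x y} → (∃ λ h → not (outgoing h) ≡ true × h ∼ᵛ x × α h ∼ᵛ y) → Arc y x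
  turn (h , o , h∼ , αh∼) =
    α h , trans (outgoing-α h) o , αh∼ , subst (_∼ᵛ _) (sym (α-involutive h)) h∼

module OrientationBasics (O : PlaneBipolarOrientation) where
  open PlaneBipolarOrientation O public

  s⁺ s⁻ : Dart → Dart
  s⁺ h = σ ⟨$⟩ʳ h
  s⁻ h = σ ⟨$⟩ˡ h

  s⁻s⁺ : ∀ h → s⁻ (s⁺ h) ≡ h
  s⁻s⁺ h = inverseˡ σ
  s⁺s⁻ : ∀ h → s⁺ (s⁻ h) ≡ h
  s⁺s⁻ h = inverseʳ σ

  s⁺-injective : ∀ {x y} → s⁺ x ≡ s⁺ y → x ≡ y
  s⁺-injective eq = trans (sym (s⁻s⁺ _)) (trans (cong s⁻ eq) (s⁻s⁺ _))

  Out In : Dart → Set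
  Out h = outgoing h ≡ true
  In  h = outgoing h ≡ false

  out-or-in : ∀ h → Out h ⊎ In h
  out-or-in h with outgoing h
  ... | true  = inj₁ refl
  ... | false = inj₂ refl

  out≢in : ∀ {h} → Out h → In h → ⊥
  out≢in o i = true≢false (trans (sym o) i)

  α-out : ∀ {h} → Out h → In (α h)
  α-out {h} o = trans (outgoing-α h) (cong not o)
  α-in : ∀ {h} → In h → Out (α h)
  α-in {h} o = trans (outgoing-α h) (cong not o)

  Vx : Set
  Vx = Fin #vertices

  vertex : Dart → Vx
  vertex = Inverse.to vertex-count
  rep : Vx → Dart
  rep = Inverse.from vertex-count

  vertex-rep : ∀ u → vertex (rep u) ≡ u
  vertex-rep = Inverse.strictlyInverseˡ vertex-count

  ∼⇒≡ : ∀ {x y} → x ∼ᵛ y → vertex x ≡ vertex y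
  ∼⇒≡ = Inverse.to-cong vertex-count
  ≡⇒∼ : ∀ {x y} → vertex x ≡ vertex y → x ∼ᵛ y
  ≡⇒∼ = to-reflects vertex-count

  vertex-s⁺ : ∀ h → vertex (s⁺ h) ≡ vertex h
  vertex-s⁺ h = sym (∼⇒≡ (EqClosure.return refl))
  vertex-s⁻ : ∀ h → vertex (s⁻ h) ≡ vertex h
  vertex-s⁻ h = trans (sym (vertex-s⁺ (s⁻ h))) (cong vertex (s⁺s⁻ h))

  φ∼ : ∀ h → φ h ∼ᶠ h
  φ∼ h = Setoid.sym Faces (EqClosure.return refl)

  vs vt : Vx
  vs = vertex root
  vt = vertex sink

  out-at-vs : ∀ {h} → vertex h ≡ vs → Out h
  out-at-vs eq = root-source _ (≡⇒∼ eq)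
  in-at-vt : ∀ {h} → vertex h ≡ vt → In h
  in-at-vt eq = sink-sink _ (≡⇒∼ eq)

  infix 4 _⟶_ _⟶⁺_
  _⟶_ _⟶⁺_ : Rel Vx 0ℓ
  u ⟶ w = ∃ λ h → Out h × vertex h ≡ u × vertex (α h) ≡ w
  _⟶⁺_ = TransClosure _⟶_

  edge⟶ : ∀ {h} → Out h → vertex h ⟶ vertex (α h)
  edge⟶ o = _ , o , refl , refl

  edge⟶′ : ∀ {h} → In h → vertex (α h) ⟶ vertex h
  edge⟶′ {h} i = α h , α-in i , refl , cong vertex (α-involutive h)

  ⟶⁺-arcs : ∀ {u w} → u ⟶⁺ w → ∀ {x y} → vertex x ≡ u → vertex y ≡ w → TransClosure Arc x y
  ⟶⁺-arcs [ h , o , a , b ] p q = [ h , o , ≡⇒∼ (trans a (sym p)) , ≡⇒∼ (trans b (sym q)) ]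
  ⟶⁺-arcs (_∷_ {y = m} (h , o , a , b) r) p q =
    (h , o , ≡⇒∼ (trans a (sym p)) , ≡⇒∼ (trans b (sym (vertex-rep m)))) ∷ ⟶⁺-arcs r (vertex-rep m) q

  ⟶⁺-irrefl : ∀ {u} → ¬ u ⟶⁺ u
  ⟶⁺-irrefl {u} p = acyclic (rep u) (⟶⁺-arcs p (vertex-rep u) (vertex-rep u))

  opaque
    ⟶⁺-wf : WellFounded _⟶⁺_
    ⟶⁺-wf = wellFounded ⟶⁺-irrefl _++_
    ⟵⁺-wf : WellFounded (flip _⟶⁺_)
    ⟵⁺-wf = wellFounded ⟶⁺-irrefl (λ p q → q ++ p)

  in-dart-at : ∀ u → u ≢ vs → ∃ λ g → vertex g ≡ u × In g
  in-dart-at u u≢ with Fin.any? (λ g → (vertex g Fin.≟ u) ×-dec (outgoing g ≟ᵇ false))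
  ... | yes found = found
  ... | no none = ⊥-elim (u≢ (trans (sym (vertex-rep u)) (∼⇒≡ (source-unique (rep u) all-out))))
    where
    all-out : IsSource (rep u)
    all-out h h∼ with out-or-in h
    ... | inj₁ o = o
    ... | inj₂ i = ⊥-elim (none (h , trans (∼⇒≡ h∼) (vertex-rep u) , i))

  out-dart-at : ∀ u → u ≢ vt → ∃ λ h → vertex h ≡ u × Out h
  out-dart-at u u≢ with Fin.any? (λ g → (vertex g Fin.≟ u) ×-dec (outgoing g ≟ᵇ true))
  ... | yes found = found
  ... | no none = ⊥-elim (u≢ (trans (sym (vertex-rep u)) (∼⇒≡ (sink-unique (rep u) all-in))))
    where
    all-in : IsSink (rep u)
    all-in h h∼ with out-or-in h
    ... | inj₂ i = i
    ... | inj₁ o = ⊥-elim (none (h , trans (∼⇒≡ h∼) (vertex-rep u) , o))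

  open Iterates s⁺ s⁺-injective public

  rotate-to : ∀ {x y} → vertex x ≡ vertex y → ∃ λ k → iterate k x ≡ y
  rotate-to eq = orbit⇒iterate (≡⇒∼ eq)

  vertex-iterate : ∀ k x → vertex (iterate k x) ≡ vertex x
  vertex-iterate zero    x = refl
  vertex-iterate (suc k) x = trans (vertex-s⁺ _) (vertex-iterate k x)

-- By Euler's formula, V + F = E + 2.  Sending each inner vertex to one of its
-- corners from an incoming to an outgoing dart, and each face to one of its
-- corners between two outgoing darts, injects the V + F - 2 inner vertices and
-- faces into the E outgoing darts.  So the choice of corner is forced.
module CornerUniqueness (O : PlaneBipolarOrientation) where
  open OrientationBasics O

  Side Bottom : Dart → Set
  Side   h = Out h × In (s⁻ h)
  Bottom h = Out h × Out (s⁻ h)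

  -- Going down along the face stops by acyclicity. From an outgoing dart `x` the way down is
  -- against `φ`, since `φ (α (s⁻ x))` is `x`; from an incoming dart it is along `φ`.
  bottom-in-face : ∀ x → ∃ λ h → h ∼ᶠ x × Bottom h
  bottom-in-face x with out-or-in x
  ... | inj₁ o = descend o (⟶⁺-wf _)
    where
    descend : ∀ {x} → Out x → Acc _⟶⁺_ (vertex x) → ∃ λ h → h ∼ᶠ x × Bottom h
    descend {x} o (acc rs) with out-or-in (s⁻ x)
    ... | inj₁ o′ = x , Setoid.refl Faces , o , o′
    ... | inj₂ i  with descend {α (s⁻ x)} (α-in i)
                         (rs [ subst (vertex (α (s⁻ x)) ⟶_) (vertex-s⁻ x) (edge⟶′ i) ])
    ... | h , h∼ , b = h , Setoid.trans Faces h∼ (EqClosure.return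
            (trans (cong s⁺ (α-involutive _)) (s⁺s⁻ x))) , b
  ... | inj₂ i = descend i (⟶⁺-wf _)
    where
    descend : ∀ {x} → In x → Acc _⟶⁺_ (vertex x) → ∃ λ h → h ∼ᶠ x × Bottom h
    descend {x} i (acc rs) with out-or-in (φ x)
    ... | inj₁ o = φ x , φ∼ x , o , subst Out (sym (s⁻s⁺ (α x))) (α-in i)
    ... | inj₂ i′ with descend {φ x} i′
                         (rs [ subst (_⟶ vertex x) (sym (vertex-s⁺ (α x))) (edge⟶′ i) ])
    ... | h , h∼ , b = h , Setoid.trans Faces h∼ (φ∼ x) , b

  side-between : ∀ k {x} → In x → Out (iterate k x) → ∃ λ h → vertex h ≡ vertex x × Side h
  side-between zero    i o = ⊥-elim (out≢in o i)
  side-between (suc k) {x} i o with out-or-in (iterate k x)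
  ... | inj₁ o′ = side-between k i o′
  ... | inj₂ i′ = s⁺ (iterate k x) , vertex-iterate (suc k) x , o , subst In (sym (s⁻s⁺ _)) i′

  side-at : ∀ u → u ≢ vs → u ≢ vt → ∃ λ h → vertex h ≡ u × Side h
  side-at u u≢s u≢t with in-dart-at u u≢s | out-dart-at u u≢t
  ... | g , refl , i | h , eq , o with rotate-to (sym eq)
  ... | k , refl = side-between k i o

  face : Dart → Fin #faces
  face = Inverse.to face-count
  edge : Dart → Fin #edges
  edge = Inverse.to edge-count

  edge-injective : ∀ {g h} → Out g → Out h → edge g ≡ edge h → g ≡ h
  edge-injective {g} {h} og oh eq with same-edge (to-reflects edge-count eq)
    where
    same-edge : ∀ {g h} → Setoid._≈_ Edges g h → g ≡ h ⊎ α g ≡ h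
    same-edge ε = inj₁ refl
    same-edge (fwd refl ◅ p) with same-edge p
    ... | inj₁ q = inj₂ q
    ... | inj₂ q = inj₁ (trans (sym (α-involutive _)) q)
    same-edge (bwd refl ◅ p) with same-edge p
    ... | inj₁ q = inj₂ (trans (α-involutive _) q)
    ... | inj₂ q = inj₁ q
  ... | inj₁ q = q
  ... | inj₂ q = ⊥-elim (out≢in oh (subst In q (α-out og)))

  data Mark : Fin #vertices ⊎ Fin #faces → Fin #edges ⊎ Fin 2 → Set where
    source : ∀ {u} → u ≡ vs → Mark (inj₁ u) (inj₂ zero)
    target : ∀ {u} → u ≡ vt → Mark (inj₁ u) (inj₂ (suc zero))
    side   : ∀ {u e} h → Side h → vertex h ≡ u → edge h ≡ e → Mark (inj₁ u) (inj₁ e)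
    bottom : ∀ {f e} h → Bottom h → face h ≡ f → edge h ≡ e → Mark (inj₂ f) (inj₁ e)

  mark : ∀ z → ∃ (Mark z)
  mark (inj₁ u) with u Fin.≟ vs | u Fin.≟ vt
  ... | yes p | _     = _ , source p
  ... | no _  | yes q = _ , target q
  ... | no p  | no q  with side-at u p q
  ... | h , at , s = _ , side h s at refl
  mark (inj₂ f) with bottom-in-face (Inverse.from face-count f)
  ... | h , h∼ , b =
      _ , bottom h b (trans (Inverse.to-cong face-count h∼) (Inverse.strictlyInverseˡ face-count f)) refl

  mark-injective : ∀ {z z′ e} → Mark z e → Mark z′ e → z ≡ z′
  mark-injective (source p) (source q) = cong inj₁ (trans p (sym q))
  mark-injective (target p) (target q) = cong inj₁ (trans p (sym q))
  mark-injective (side h s p q) (side h′ s′ p′ q′)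
    with edge-injective (proj₁ s) (proj₁ s′) (trans q (sym q′))
  ... | refl = cong inj₁ (trans (sym p) p′)
  mark-injective (side h s p q) (bottom h′ s′ p′ q′)
    with edge-injective (proj₁ s) (proj₁ s′) (trans q (sym q′))
  ... | refl = ⊥-elim (out≢in (proj₂ s′) (proj₂ s))
  mark-injective (bottom h s p q) (side h′ s′ p′ q′)
    with edge-injective (proj₁ s) (proj₁ s′) (trans q (sym q′))
  ... | refl = ⊥-elim (out≢in (proj₂ s) (proj₂ s′))
  mark-injective (bottom h s p q) (bottom h′ s′ p′ q′)
    with edge-injective (proj₁ s) (proj₁ s′) (trans q (sym q′))
  ... | refl = cong inj₂ (trans (sym p) p′)

  -- An injection between finite sets of the same size is onto. The planarity of a given map enters
  -- only here.
  marked : ∀ e → ∃ λ z → proj₁ (mark z) ≡ e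
  marked = ⊎-injective⇒surjective genus-zero (proj₁ ∘ mark) λ {z} {z′} eq →
    mark-injective (subst (Mark z) eq (proj₂ (mark z))) (proj₂ (mark z′))

  -- Any admissible corner of `z` gives an edge that `mark` reaches from some `z′`, by `marked`;
  -- then `z′` is `z` by `mark-injective`, so the corner is the one that `mark` chose.
  mark-functional : ∀ {z e e′} → Mark z (inj₁ e) → Mark z (inj₁ e′) → e ≡ e′
  mark-functional {z} m m′ = inj₁-injective (trans (sym (forced m)) (forced m′))
    where
    inj₁-injective : ∀ {A B : Set} {x y : A} → inj₁ {B = B} x ≡ inj₁ y → x ≡ y
    inj₁-injective refl = refl
    forced : ∀ {e} → Mark z e → proj₁ (mark z) ≡ e
    forced {e} m with marked e
    ... | z′ , refl = cong (proj₁ ∘ mark) (mark-injective m (proj₂ (mark z′)))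

  side-unique : ∀ {h h′} → Side h → Side h′ → vertex h ≡ vertex h′ → h ≡ h′
  side-unique s s′ eq = edge-injective (proj₁ s) (proj₁ s′)
    (mark-functional (side _ s eq refl) (side _ s′ refl refl))

  bottom-unique : ∀ {h h′} → Bottom h → Bottom h′ → h ∼ᶠ h′ → h ≡ h′
  bottom-unique s s′ h∼ = edge-injective (proj₁ s) (proj₁ s′)
    (mark-functional (bottom _ s (Inverse.to-cong face-count h∼) refl) (bottom _ s′ refl refl))

-- Lexicographic order on paths

-- A path is the list of its steps, the last one first, so prefixes of paths
-- are suffixes of lists.
module Divergence {A : Set} (_⟪_ : Rel A 0ℓ) (⟪-irrefl : ∀ {a} → ¬ a ⟪ a)
                 (⟪-trans : ∀ {a b c} → a ⟪ b → b ⟪ c → a ⟪ c) where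

  data Prefix (p : List A) : List A → Set where
    refl : Prefix p p
    ext  : ∀ {a q} → Prefix p q → Prefix p (a ∷ q)

  prefix-trans : ∀ {p q r} → Prefix p q → Prefix q r → Prefix p r
  prefix-trans a refl    = a
  prefix-trans a (ext b) = ext (prefix-trans a b)

  prefix-length : ∀ {p q} → Prefix p q → length p ≤ length q
  prefix-length refl    = ℕ.≤-refl
  prefix-length (ext a) = ℕ.m≤n⇒m≤1+n (prefix-length a)

  prefix-tail : ∀ {a p q} → Prefix (a ∷ p) q → Prefix p q
  prefix-tail = prefix-trans (ext refl)

  ¬prefix-cons : ∀ {a p} → ¬ Prefix (a ∷ p) p
  ¬prefix-cons a = ℕ.1+n≰n (prefix-length a)

  prefix-next : ∀ {p q} → Prefix p q → p ≡ q ⊎ ∃ λ a → Prefix (a ∷ p) q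
  prefix-next refl = inj₁ refl
  prefix-next (ext {a} x) with prefix-next x
  ... | inj₁ refl    = inj₂ (a , refl)
  ... | inj₂ (b , y) = inj₂ (b , ext y)

  prefixes-comparable : ∀ {p q r} → Prefix p r → Prefix q r → Prefix p q ⊎ Prefix q p
  prefixes-comparable refl    b       = inj₂ b
  prefixes-comparable (ext a) refl    = inj₁ (ext a)
  prefixes-comparable (ext a) (ext b) = prefixes-comparable a b

  same-step : ∀ {a b p r} → Prefix (a ∷ p) r → Prefix (b ∷ p) r → a ≡ b
  same-step x y with prefixes-comparable x y
  ... | inj₁ refl    = refl
  ... | inj₂ refl    = refl
  ... | inj₁ (ext z) = ⊥-elim (¬prefix-cons z)
  ... | inj₂ (ext z) = ⊥-elim (¬prefix-cons z)

  infix 4 _◁_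
  -- Proper branching only: neither path is a prefix of the other. Prefixes are kept apart because,
  -- for paths from the source, they mean reachability of the ends and not a position to the left.
  record _◁_ (p q : List A) : Set where
    constructor diverge
    field
      {trunk}        : List A
      {left right}   : A
      turn           : left ⟪ right
      left-branch    : Prefix (left ∷ trunk) p
      right-branch   : Prefix (right ∷ trunk) q

  ◁-irrefl : ∀ {p} → ¬ p ◁ p
  ◁-irrefl (diverge t a b) with same-step a b
  ... | refl = ⟪-irrefl t

  ◁-extend : ∀ {p p′ q q′} → Prefix p p′ → Prefix q q′ → p ◁ q → p′ ◁ q′
  ◁-extend x y (diverge t a b) = diverge t (prefix-trans a x) (prefix-trans b y)

  ◁-trans : ∀ {p q r} → p ◁ q → q ◁ r → p ◁ r
  ◁-trans (diverge t a b) (diverge t′ a′ b′) with prefixes-comparable b a′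
  ... | inj₁ refl    = diverge (⟪-trans t t′) a b′
  ... | inj₂ refl    = diverge (⟪-trans t t′) a b′
  ... | inj₁ (ext c) = diverge t a (prefix-trans c (prefix-tail b′))
  ... | inj₂ (ext c) = diverge t′ (prefix-trans c (prefix-tail a)) b′

  ◁-asym : ∀ {p q} → p ◁ q → ¬ q ◁ p
  ◁-asym x y = ◁-irrefl (◁-trans x y)

  ◁⇒¬prefix : ∀ {p q} → p ◁ q → ¬ Prefix p q
  ◁⇒¬prefix x y = ◁-irrefl (◁-extend y refl x)

  ◁⇒¬prefix˘ : ∀ {p q} → p ◁ q → ¬ Prefix q p
  ◁⇒¬prefix˘ x y = ◁-irrefl (◁-extend refl y x)

  cons-◁ : ∀ {a p q} → (a ∷ p) ◁ q → p ◁ q ⊎ ∃ λ b → a ⟪ b × Prefix (b ∷ p) q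
  cons-◁ (diverge t refl b)    = inj₂ (_ , t , b)
  cons-◁ (diverge t (ext a) b) = inj₁ (diverge t a b)

  ◁-cons : ∀ {a p q} → q ◁ (a ∷ p) → q ◁ p ⊎ ∃ λ b → b ⟪ a × Prefix (b ∷ p) q
  ◁-cons (diverge t a refl)    = inj₂ (_ , t , a)
  ◁-cons (diverge t a (ext b)) = inj₁ (diverge t a b)

  data Compare (p q : List A) : Set where
    prefix  : Prefix p q → Compare p q
    prefix˘ : Prefix q p → Compare p q
    left    : p ◁ q → Compare p q
    right   : q ◁ p → Compare p q

  _⊴_ : Rel (List A) 0ℓ
  p ⊴ q = p ≡ q ⊎ p ◁ q

  ⊴-◁ : ∀ {p q r} → p ⊴ q → q ◁ r → p ◁ r
  ⊴-◁ (inj₁ refl) y = y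
  ⊴-◁ (inj₂ x)    y = ◁-trans x y

  ◁-⊴ : ∀ {p q r} → p ◁ q → q ⊴ r → p ◁ r
  ◁-⊴ x (inj₁ refl) = x
  ◁-⊴ x (inj₂ y)    = ◁-trans x y

  ⊴-cons : ∀ {a p q} → p ⊴ q → (a ∷ p) ⊴ (a ∷ q)
  ⊴-cons (inj₁ refl) = inj₁ refl
  ⊴-cons (inj₂ x)    = inj₂ (◁-extend (ext refl) (ext refl) x)

  prefix-antisym : ∀ {p q} → Prefix p q → Prefix q p → p ≡ q
  prefix-antisym refl    b = refl
  prefix-antisym (ext a) b = ⊥-elim (¬prefix-cons (prefix-trans b a))

  infix 4 _<ₗ_
  _<ₗ_ : Rel (List A) 0ℓ
  p <ₗ q = (Prefix p q × p ≢ q) ⊎ p ◁ q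

  <ₗ-irrefl : ∀ {p} → ¬ p <ₗ p
  <ₗ-irrefl (inj₁ (_ , p≢p)) = p≢p refl
  <ₗ-irrefl (inj₂ x)         = ◁-irrefl x

  <ₗ-trans : ∀ {p q r} → p <ₗ q → q <ₗ r → p <ₗ r
  <ₗ-trans (inj₁ (a , p≢q)) (inj₁ (b , _)) =
    inj₁ (prefix-trans a b , λ { refl → p≢q (prefix-antisym a b) })
  <ₗ-trans (inj₁ (a , _)) (inj₂ (diverge t b c)) with prefixes-comparable a b
  ... | inj₂ d       = inj₂ (diverge t d c)
  ... | inj₁ refl    = inj₂ (diverge t refl c)
  ... | inj₁ (ext d) = inj₁ (prefix-trans d (prefix-tail c) ,
                             λ { refl → ¬prefix-cons (prefix-trans c d) })
  <ₗ-trans (inj₂ x) (inj₁ (b , _)) = inj₂ (◁-extend refl b x)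
  <ₗ-trans (inj₂ x) (inj₂ y)       = inj₂ (◁-trans x y)

-- Faces and rightmost paths

module PlanarStructure (O : PlaneBipolarOrientation) where
  open OrientationBasics O
  private module C = CornerUniqueness O
  private module C˘ = CornerUniqueness (reversed O)
  open C using (Bottom; Side; side-unique; bottom-unique)

  not-false : ∀ {b} → b ≡ false → not b ≡ true
  not-false refl = refl

  top-unique : ∀ {g g′} → In g → In (s⁻ g) → In g′ → In (s⁻ g′) → g ∼ᶠ g′ → g ≡ g′
  top-unique a b c d = C˘.bottom-unique (not-false a , not-false b) (not-false c , not-false d)

  -- The outgoing darts of a vertex are listed from right to left (i.e.
  -- counterclockwise), starting after the outer corner at the source, and
  -- the incoming darts from left to right.
  RightmostOut LeftmostOut RightmostIn : Dart → Set
  RightmostOut h = Out h × (In (s⁻ h) ⊎ h ≡ root)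
  LeftmostOut  h = Out h × (In (s⁺ h) ⊎ s⁺ h ≡ root)
  RightmostIn  g = In g × (Out (s⁺ g) ⊎ s⁺ g ≡ sink)

  rightmostOut-unique : ∀ {h h′} → RightmostOut h → RightmostOut h′ → vertex h ≡ vertex h′ → h ≡ h′
  rightmostOut-unique (o , inj₁ i)    (o′ , inj₁ i′)   eq = side-unique (o , i) (o′ , i′) eq
  rightmostOut-unique (o , inj₁ i)    (o′ , inj₂ refl) eq =
    ⊥-elim (out≢in (out-at-vs (trans (vertex-s⁻ _) eq)) i)
  rightmostOut-unique (o , inj₂ refl) (o′ , inj₁ i)    eq =
    ⊥-elim (out≢in (out-at-vs (trans (vertex-s⁻ _) (sym eq))) i)
  rightmostOut-unique (o , inj₂ refl) (o′ , inj₂ refl) eq = refl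

  rightmostIn-unique : ∀ {g g′} → RightmostIn g → RightmostIn g′ → vertex g ≡ vertex g′ → g ≡ g′
  rightmostIn-unique {g} {g′} (i , inj₁ o) (i′ , inj₁ o′) eq = s⁺-injective
    (side-unique (o , subst In (sym (s⁻s⁺ g)) i) (o′ , subst In (sym (s⁻s⁺ g′)) i′)
      (trans (vertex-s⁺ g) (trans eq (sym (vertex-s⁺ g′)))))
  rightmostIn-unique {g} {g′} (i , inj₁ o) (i′ , inj₂ p) eq = ⊥-elim (out≢in o
    (in-at-vt (trans (vertex-s⁺ g) (trans eq (trans (sym (vertex-s⁺ g′)) (cong vertex p))))))
  rightmostIn-unique {g} {g′} (i , inj₂ p) (i′ , inj₁ o) eq = ⊥-elim (out≢in o
    (in-at-vt (trans (vertex-s⁺ g′) (trans (sym eq) (trans (sym (vertex-s⁺ g)) (cong vertex p))))))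
  rightmostIn-unique (i , inj₂ p) (i′ , inj₂ p′) eq = s⁺-injective (trans p (sym p′))

  data ToRightmost : Dart → Set where
    stop : ∀ {g} → RightmostIn g → ToRightmost g
    step : ∀ {g} → In (s⁺ g) → s⁺ g ≢ sink → ToRightmost (s⁺ g) → ToRightmost g

  rightmostIn-at : ∀ u → u ≢ vs → ∃ λ g → vertex g ≡ u × RightmostIn g
  rightmostIn-at u u≢ with u Fin.≟ vt
  ... | yes refl = s⁻ sink , vertex-s⁻ sink , in-at-vt (vertex-s⁻ sink) , inj₂ (s⁺s⁻ sink)
  ... | no u≢t with C.side-at u u≢ u≢t
  ... | h , at , o , i = s⁻ h , trans (vertex-s⁻ h) at , i , inj₁ (subst Out (sym (s⁺s⁻ h)) o)

  iterate-s⁺ : ∀ k x → iterate (suc k) x ≡ iterate k (s⁺ x)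
  iterate-s⁺ zero    x = refl
  iterate-s⁺ (suc k) x = cong s⁺ (iterate-s⁺ k x)

  toRightmost : ∀ {g} → In g → ToRightmost g
  toRightmost {g} i with rightmostIn-at (vertex g) (λ eq → out≢in (out-at-vs eq) i)
  ... | g* , at , r with rotate-to (sym at)
  ... | k , eq = go k i eq
    where
    go : ∀ k {g} → In g → iterate k g ≡ g* → ToRightmost g
    go zero    i refl = stop r
    go (suc k) {g} i eq with out-or-in (s⁺ g) | s⁺ g Fin.≟ sink
    ... | inj₁ o  | _     = stop (i , inj₁ o)
    ... | inj₂ _  | yes p = stop (i , inj₂ p)
    ... | inj₂ i′ | no ¬p = step i′ ¬p (go k i′ (trans (sym (iterate-s⁺ k g)) eq))

  -- Position among the outgoing darts, counted from the right. The condition `h′ ≢ root` stops the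
  -- count at the outer corner of the source, where no incoming dart separates the last outgoing
  -- dart from the first.
  data _hasIndex_ : Dart → ℕ → Set where
    first : ∀ {h} → RightmostOut h → h hasIndex zero
    next  : ∀ {h h′ k} → h hasIndex k → Out h′ → h′ ≢ root → s⁺ h ≡ h′ → h′ hasIndex suc k

  index-out : ∀ {h k} → h hasIndex k → Out h
  index-out (first r)      = proj₁ r
  index-out (next _ o _ _) = o

  ¬rightmostOut : ∀ {h} → Out h → Out (s⁺ h) → s⁺ h ≢ root → ¬ RightmostOut (s⁺ h)
  ¬rightmostOut o o′ ≢root (_ , inj₁ i) = out≢in o (subst In (s⁻s⁺ _) i)
  ¬rightmostOut o o′ ≢root (_ , inj₂ p) = ≢root p

  index-functional : ∀ {h k k′} → h hasIndex k → h hasIndex k′ → k ≡ k′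
  index-functional (first _) (first _) = refl
  index-functional (first r) (next a o ≢root refl) = ⊥-elim (¬rightmostOut (index-out a) o ≢root r)
  index-functional (next a o ≢root refl) (first r) = ⊥-elim (¬rightmostOut (index-out a) o ≢root r)
  index-functional (next a _ _ refl) (next a′ _ _ eq) with s⁺-injective eq
  ... | refl = cong suc (index-functional a a′)

  index-injective : ∀ {h h′ k} → h hasIndex k → h′ hasIndex k → vertex h ≡ vertex h′ → h ≡ h′
  index-injective (first r) (first r′) eq = rightmostOut-unique r r′ eq
  index-injective (next a _ _ refl) (next a′ _ _ refl) eq =
    cong s⁺ (index-injective a a′ (trans (sym (vertex-s⁺ _)) (trans eq (vertex-s⁺ _))))

  index-exists : ∀ {h} → Out h → ∃ (h hasIndex_)
  index-exists {h} o with rightmost (vertex h) (λ eq → out≢in o (in-at-vt eq))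
    where
    rightmost : ∀ u → u ≢ vt → ∃ λ h → vertex h ≡ u × RightmostOut h
    rightmost u u≢ with u Fin.≟ vs
    ... | yes refl = root , refl , out-at-vs refl , inj₂ refl
    ... | no u≢s with C.side-at u u≢s u≢
    ... | h , at , o , i = h , at , o , inj₁ i
  ... | r , at , rm with rotate-to at
  ... | k , refl = go k o
    where
    go : ∀ k → Out (iterate k r) → ∃ (iterate k r hasIndex_)
    go zero    o = 0 , first rm
    go (suc k) o with out-or-in (iterate k r) | s⁺ (iterate k r) Fin.≟ root
    ... | inj₂ i  | _     = 0 , first (o , inj₁ (subst In (sym (s⁻s⁺ _)) i))
    ... | inj₁ o′ | yes p = 0 , first (o , inj₂ p)
    ... | inj₁ o′ | no ¬p with go k o′
    ... | m , a = suc m , next a o ¬p refl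

  infix 4 _⟪_
  record _⟪_ (h h′ : Dart) : Set where
    constructor leftOf
    field
      common     : vertex h ≡ vertex h′
      {index index′} : ℕ
      at-left    : h hasIndex index
      at-right   : h′ hasIndex index′
      decreasing : index′ < index

  ⟪-irrefl : ∀ {h} → ¬ h ⟪ h
  ⟪-irrefl (leftOf _ a b lt) = ℕ.<-irrefl (index-functional b a) lt

  ⟪-trans : ∀ {a b c} → a ⟪ b → b ⟪ c → a ⟪ c
  ⟪-trans (leftOf e a b lt) (leftOf e′ b′ c lt′) with index-functional b b′
  ... | refl = leftOf (trans e e′) a c (ℕ.<-trans lt′ lt)

  ⟪-cmp : ∀ {h h′} → Out h → Out h′ → vertex h ≡ vertex h′ → Tri (h ⟪ h′) (h ≡ h′) (h′ ⟪ h)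
  ⟪-cmp o o′ eq with index-exists o | index-exists o′
  ... | k , a | k′ , a′ with ℕ.<-cmp k′ k
  ... | tri< lt ¬eq ¬gt = tri< (leftOf eq a a′ lt) (λ { refl → ¬eq (index-functional a′ a) })
        (λ { (leftOf _ b b′ lt′) → ℕ.<-asym lt (subst₂ _<_ (index-functional b′ a) (index-functional b a′) lt′) })
  ... | tri≈ _ refl _ with index-injective a a′ eq
  ... | refl = tri≈ ⟪-irrefl refl ⟪-irrefl
  ⟪-cmp o o′ eq | k , a | k′ , a′ | tri> ¬lt ¬eq gt = tri> (λ { (leftOf _ b b′ lt′) → ℕ.<-asym gt
    (subst₂ _<_ (index-functional b′ a′) (index-functional b a) lt′) }) (λ { refl → ¬eq (index-functional a′ a) })
        (leftOf (sym eq) a′ a gt)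

  rightmostOut-⟪ : ∀ {h k} → RightmostOut h → ¬ h ⟪ k
  rightmostOut-⟪ r (leftOf _ a b lt) with index-functional a (first r)
  rightmostOut-⟪ r (leftOf _ a b ()) | refl

  ⟪-leftmostOut : ∀ {h k} → LeftmostOut h → ¬ k ⟪ h
  ⟪-leftmostOut {h} l (leftOf eq a b lt) = go a eq lt
    where
    go : ∀ {k i} → k hasIndex i → vertex k ≡ vertex h → ¬ _ < i
    go (next {g} {k = i} a o ≢root refl) eq (s≤s le) with ℕ.m≤n⇒m<n∨m≡n le
    ... | inj₁ lt = go a (trans (sym (vertex-s⁺ g)) eq) lt
    ... | inj₂ refl with index-injective a b (trans (sym (vertex-s⁺ g)) eq)
    ... | refl with proj₂ l
    ... | inj₁ i = out≢in o i
    ... | inj₂ p = ≢root p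

  bottom-index : ∀ {h k} → Bottom h → h ≢ root → s⁻ h hasIndex k → h hasIndex suc k
  bottom-index (o , _) ≢root a = next a o ≢root (s⁺s⁻ _)

  bottom-⟪ : ∀ {h} → Bottom h → h ≢ root → h ⟪ s⁻ h
  bottom-⟪ {h} b ≢root with index-exists (proj₂ b)
  ... | k , a = leftOf (sym (vertex-s⁻ h)) (bottom-index b ≢root a) a ℕ.≤-refl

  bottom-consecutive : ∀ {h a} → Bottom h → h ≢ root → h ⟪ a → ¬ a ⟪ s⁻ h
  bottom-consecutive b ≢root (leftOf _ x y lt) (leftOf _ y′ z lt′)
    with index-functional y y′ | index-functional x (bottom-index b ≢root z)
  ... | refl | refl = ℕ.<⇒≱ lt lt′

  open Divergence _⟪_ ⟪-irrefl ⟪-trans public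

  infix 4 _⟶*_
  _⟶*_ : Rel Vx 0ℓ
  _⟶*_ = Star _⟶_

  ⟶⁺⇒⟶* : ∀ {u w} → u ⟶⁺ w → u ⟶* w
  ⟶⁺⇒⟶* [ e ]   = e ◅ ε
  ⟶⁺⇒⟶* (e ∷ p) = e ◅ ⟶⁺⇒⟶* p

  ⟶*-split : ∀ {u w} → u ⟶* w → u ≡ w ⊎ u ⟶⁺ w
  ⟶*-split ε = inj₁ refl
  ⟶*-split (e ◅ p) with ⟶*-split p
  ... | inj₁ refl = inj₂ [ e ]
  ... | inj₂ q    = inj₂ (e ∷ q)

  ⟶*-⟶⁺ : ∀ {u v w} → u ⟶* v → v ⟶⁺ w → u ⟶⁺ w
  ⟶*-⟶⁺ p q with ⟶*-split p
  ... | inj₁ refl = q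
  ... | inj₂ r    = r ++ q

  data Path : List Dart → Vx → Set where
    []   : ∀ {u} → vs ≡ u → Path [] u
    snoc : ∀ {h p u} → Path p (vertex h) → Out h → vertex (α h) ≡ u → Path (h ∷ p) u

  data Right : List Dart → Set where
    []   : Right []
    snoc : ∀ {h p} → Right p → RightmostIn (α h) → Right (h ∷ p)

  path-end : ∀ {p u w} → Path p u → Path p w → u ≡ w
  path-end ([] a)       ([] b)       = trans (sym a) b
  path-end (snoc _ _ a) (snoc _ _ b) = trans (sym a) b

  right-unique : ∀ {p q u} → Path p u → Right p → Path q u → Right q → p ≡ q
  right-unique ([] _) _ ([] _) _ = refl
  right-unique ([] a) _ (snoc _ o b) _ = ⊥-elim (out≢in (out-at-vs (trans b (sym a))) (α-out o))
  right-unique (snoc _ o a) _ ([] b) _ = ⊥-elim (out≢in (out-at-vs (trans a (sym b))) (α-out o))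
  right-unique (snoc x o a) (snoc r m) (snoc x′ o′ b) (snoc r′ m′)
    with rightmostIn-unique m m′ (trans a (sym b))
  ... | eq with trans (sym (α-involutive _)) (trans (cong α eq) (α-involutive _))
  ... | refl = cong (_ ∷_) (right-unique x r x′ r′)

  opaque
    rightPath : ∀ u → ∃ λ p → Path p u × Right p
    rightPath u = go (⟶⁺-wf u)
      where
      go : ∀ {u} → Acc _⟶⁺_ u → ∃ λ p → Path p u × Right p
      go {u} (acc rs) with u Fin.≟ vs
      ... | yes refl = [] , [] refl , []
      ... | no u≢ with rightmostIn-at u u≢
      ... | g , refl , m with go (rs [ edge⟶′ (proj₁ m) ])
      ... | p , x , r = α g ∷ p , snoc x (α-in (proj₁ m)) (cong vertex (α-involutive g)) ,
                        snoc r (subst RightmostIn (sym (α-involutive g)) m)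

  prefix-reach : ∀ {p q u w} → Prefix p q → Path p u → Path q w → u ⟶* w
  prefix-reach refl x y with path-end x y
  ... | refl = ε
  prefix-reach (ext a) x (snoc y o refl) = prefix-reach a x y ◅◅ (edge⟶ o ◅ ε)

  prefix-right : ∀ {p q} → Prefix p q → Right q → Right p
  prefix-right refl    r          = r
  prefix-right (ext a) (snoc r _) = prefix-right a r

  prefix-path : ∀ {h p q w} → Prefix (h ∷ p) q → Path q w → Path p (vertex h) × Out h
  prefix-path refl    (snoc x o _) = x , o
  prefix-path (ext a) (snoc x _ _) = prefix-path a x

  compare : ∀ {p q u w} → Path p u → Path q w → Compare p q
  compare ([] _) y = prefix (empty _)
    where
    empty : ∀ q → Prefix [] q
    empty []      = refl
    empty (_ ∷ q) = ext (empty q)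
  compare (snoc x o _) y with compare x y
  ... | prefix˘ b = prefix˘ (ext b)
  ... | left b    = left (◁-extend (ext refl) refl b)
  ... | right b   = right (◁-extend refl (ext refl) b)
  ... | prefix b with prefix-next b
  ... | inj₁ refl = prefix˘ (ext refl)
  ... | inj₂ (k , c) with prefix-path c y
  ... | z , o′ with ⟪-cmp o o′ (path-end x z)
  ... | tri< t _ _    = left (diverge t refl c)
  ... | tri≈ _ refl _ = prefix c
  ... | tri> _ _ t    = right (diverge t c refl)

  -- The face lies to the right of its left boundary, so above the first step `h` the boundary
  -- always leaves by the rightmost outgoing dart; a right boundary leaves by the leftmost one. The
  -- trunk leads from the source to the bottom of the face.
  data LeftBoundary (trunk : List Dart) (h : Dart) : List Dart → Set where
    start : LeftBoundary trunk h (h ∷ trunk)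
    along : ∀ {k p} → RightmostOut k → LeftBoundary trunk h p → LeftBoundary trunk h (k ∷ p)

  data RightBoundary (trunk : List Dart) (h : Dart) : List Dart → Set where
    start : RightBoundary trunk h (h ∷ trunk)
    along : ∀ {k p} → LeftmostOut k → RightBoundary trunk h p → RightBoundary trunk h (k ∷ p)

  -- Nothing branches off to the right of a rightmost outgoing dart, so the branching must happen at
  -- `h` or below it.
  leftBoundary-◁ : ∀ {c h p q} → LeftBoundary c h p → p ◁ q → (h ∷ c) ◁ q
  leftBoundary-◁ start x = x
  leftBoundary-◁ (along r b) x with cons-◁ x
  ... | inj₁ y = leftBoundary-◁ b y
  ... | inj₂ (_ , t , _) = ⊥-elim (rightmostOut-⟪ r t)

  ◁-rightBoundary : ∀ {c h p q} → RightBoundary c h p → q ◁ p → q ◁ (h ∷ c)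
  ◁-rightBoundary start x = x
  ◁-rightBoundary (along l b) x with ◁-cons x
  ... | inj₁ y = ◁-rightBoundary b y
  ... | inj₂ (_ , t , _) = ⊥-elim (⟪-leftmostOut l t)

  leftBoundary-prefix : ∀ {c h p} → LeftBoundary c h p → Prefix (h ∷ c) p
  leftBoundary-prefix start       = refl
  leftBoundary-prefix (along _ b) = ext (leftBoundary-prefix b)

  rightBoundary-prefix : ∀ {c h p} → RightBoundary c h p → Prefix (h ∷ c) p
  rightBoundary-prefix start       = refl
  rightBoundary-prefix (along _ b) = ext (rightBoundary-prefix b)

  -- As long as the dart before `e` is incoming, it is the rightmost incoming one, hence the last
  -- step of the rightmost path. So the descent along the left boundary retraces the rightmost path,
  -- and what is left of that path at the bottom is the trunk.
  walk-left : ∀ {e p} → Out e → Path p (vertex e) → Right p →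
              ∃ λ h → ∃ λ c → Bottom h × h ∼ᶠ e × Path c (vertex h) × Right c × LeftBoundary c h (e ∷ p)
  walk-left {e} o x r with out-or-in (s⁻ e)
  ... | inj₁ o′ = e , _ , (o , o′) , Setoid.refl Faces , x , r , start
  walk-left {e} o ([] at) r | inj₂ i = ⊥-elim (out≢in (out-at-vs (trans (vertex-s⁻ e) (sym at))) i)
  walk-left {e} o (snoc {k} x o′ at) (snoc r m) | inj₂ i with walk-left o′ x r
  ... | h , c , b , h∼ , xc , rc , lb =
    h , c , b , Setoid.trans Faces h∼ (EqClosure.return (trans (cong s⁺ αk) (s⁺s⁻ e))) , xc , rc ,
    along (o , inj₁ i) lb
    where
    αk : α k ≡ s⁻ e
    αk = rightmostIn-unique m (i , inj₁ (subst Out (sym (s⁺s⁻ e)) o)) (trans at (sym (vertex-s⁻ e)))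

  -- The result accepts any path `c` to the bottom vertex: the trunk is supplied by the walk on the
  -- left, once the two bottoms are known to agree.
  walk-right : ∀ {g} → In g → Acc _⟶⁺_ (vertex g) →
               ∃ λ h → Bottom h × h ∼ᶠ g × (∀ {c} → Path c (vertex h) →
                 ∃ λ q → Path q (vertex (α g)) × RightBoundary c (s⁻ h) (α g ∷ q))
  walk-right {g} i (acc rs) with out-or-in (φ g)
  ... | inj₁ o = φ g , (o , subst Out (sym (s⁻s⁺ _)) (α-in i)) , φ∼ g , λ {c} x →
    c , subst (Path c) (vertex-s⁺ (α g)) x ,
    subst (λ h → RightBoundary c h (α g ∷ c)) (sym (s⁻s⁺ (α g))) start
  ... | inj₂ i′ with walk-right {φ g} i′
                       (rs [ subst (_⟶ vertex g) (sym (vertex-s⁺ (α g))) (edge⟶′ i) ])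
  ... | h , b , h∼ , build = h , b , Setoid.trans Faces h∼ (φ∼ g) , λ {c} x →
    let q , y , rb = build x in
    α (φ g) ∷ q ,
    snoc y (α-in i′) (trans (cong vertex (α-involutive _)) (vertex-s⁺ (α g))) ,
    along (α-in i , inj₁ i′) rb

  -- The face with its top corner between `e` and the next incoming dart to the right. Its left
  -- boundary ends with `e`, its right boundary with `α (s⁺ (α e))`.
  record Face (e : Dart) (p : List Dart) : Set where
    field
      {lowest}      : Dart
      {trunk other} : List Dart
      bottom        : Bottom lowest
      lowest≢root   : lowest ≢ root
      trunk-path    : Path trunk (vertex lowest)
      trunk-right   : Right trunk
      leftBoundary  : LeftBoundary trunk lowest (e ∷ p)
      other-path    : Path other (vertex (α (s⁺ (α e))))
      rightBoundary : RightBoundary trunk (s⁻ lowest) (α (s⁺ (α e)) ∷ other)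

    boundaries-◁ : (e ∷ p) ◁ (α (s⁺ (α e)) ∷ other)
    boundaries-◁ = diverge (bottom-⟪ bottom lowest≢root)
      (leftBoundary-prefix leftBoundary) (rightBoundary-prefix rightBoundary)

    nothing-between : ∀ {q} → (e ∷ p) ◁ q → ¬ q ◁ (α (s⁺ (α e)) ∷ other)
    nothing-between x y
      with cons-◁ (leftBoundary-◁ leftBoundary x) | ◁-cons (◁-rightBoundary rightBoundary y)
    ... | inj₁ a             | inj₁ b             = ◁-asym a b
    ... | inj₁ a             | inj₂ (_ , _ , b)   = ◁⇒¬prefix a (prefix-tail b)
    ... | inj₂ (_ , _ , a)   | inj₁ b             = ◁⇒¬prefix˘ b (prefix-tail a)
    ... | inj₂ (_ , t , a)   | inj₂ (_ , t′ , b)  with same-step a b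
    ... | refl = bottom-consecutive bottom lowest≢root t t′

  opaque
    -- Both walks stay in the face of `e`, so they end at its only bottom corner.
    face-right-of : ∀ {e p} → Out e → Path p (vertex e) → Right p →
                    In (s⁺ (α e)) → s⁺ (α e) ≢ sink → Face e p
    face-right-of {e} o x r i ≢sink
      with walk-left o x r | walk-right i (⟶⁺-wf _)
    ... | h , c , b , h∼ , xc , rc , lb | h′ , b′ , h′∼ , build
      with bottom-unique b b′ (Setoid.trans Faces h∼
             (Setoid.trans Faces (Setoid.sym Faces (φ∼ e)) (Setoid.sym Faces h′∼)))
    ... | refl with build xc
    ... | q , y , rb = record
      { bottom = b ; lowest≢root = h≢root ; trunk-path = xc ; trunk-right = rc
      ; leftBoundary = lb ; other-path = y ; rightBoundary = rb }
      where
      -- With the root corner as bottom the face would be the outer one, whose only top corner is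
      -- that of `sink`.
      h≢root : h ≢ root
      h≢root refl = ≢sink (top-unique i (subst In (sym (s⁻s⁺ _)) (α-out o))
        (in-at-vt refl) (in-at-vt (vertex-s⁻ sink))
        (Setoid.trans Faces (Setoid.sym Faces h′∼) (Setoid.sym Faces sink-outer)))

  next-in : ∀ {e u} → In (s⁺ (α e)) → vertex (α e) ≡ u → vertex (α (α (s⁺ (α e)))) ≡ u
  next-in i at = trans (cong vertex (α-involutive _)) (trans (vertex-s⁺ _) at)

  -- The last edge moves to the right, one incoming dart at a time. The part below it is first made
  -- rightmost by induction; then the edge is exchanged across a face, from the left boundary to the
  -- right one.
  path-⊴ : ∀ {q r u} → Path q u → Path r u → Right r → q ⊴ r
  path-⊴ {u = u} x y r = outer x y r (⟶⁺-wf u)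
    where
    outer : ∀ {q r u} → Path q u → Path r u → Right r → Acc _⟶⁺_ u → q ⊴ r
    inner : ∀ {e g q r u} → α e ≡ g → ToRightmost g → Path q (vertex e) → Out e → vertex (α e) ≡ u →
            Path r u → Right r → (∀ {t} → t ⟶⁺ u → Acc _⟶⁺_ t) → (e ∷ q) ⊴ r

    outer ([] refl) y r _ = inj₁ (right-unique ([] refl) [] y r)
    outer (snoc x o at) y r (acc rs) = inner refl (toRightmost (α-out o)) x o at y r rs

    inner {e} refl (stop m) x o refl y r rs with rightPath (vertex e)
    ... | p , z , rp with right-unique (snoc z o refl) (snoc rp m) y r
    ... | refl = ⊴-cons (outer x z rp (rs [ edge⟶ o ]))
    inner {e} {u = u} refl (step i ≢sink to) x o at y r rs with rightPath (vertex e)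
    ... | p , z , rp = inj₂ (◁-⊴ (⊴-◁ (⊴-cons
        (outer x z rp (rs [ subst (vertex e ⟶_) at (edge⟶ o) ]))) boundaries-◁)
        (inner (α-involutive _) to other-path (α-in i) (next-in i at) y r rs))
      where open Face (face-right-of o z rp i ≢sink)

  -- The faces below w are scanned from left to right: no path runs strictly
  -- between the two boundaries of a face without passing through its top.
  module Between {p v} (xp : Path p v) (rp : Right p) where

    outer : ∀ {q c k r w} → Path q w → Right c → RightBoundary c k q → Path r w → Right r →
            Acc _⟶⁺_ w → q ◁ p → p ◁ r → v ⟶* w
    inner : ∀ {e g q c k r w} → α e ≡ g → ToRightmost g → Path q (vertex e) → Out e → vertex (α e) ≡ w →
            Right c → RightBoundary c k (e ∷ q) → Path r w → Right r →
            (∀ {t} → t ⟶⁺ w → Acc _⟶⁺_ t) → (e ∷ q) ◁ p → p ◁ r → v ⟶* w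
    -- Here `p` is caught between two paths with the same last edge `e`. If the boundary starts with
    -- `e`, these paths coincide. Otherwise `e` is leftmost at its lower end, so `p` cannot branch
    -- off to its left and is caught already between the two paths to that end; this is what the
    -- hypothesis `RightBoundary` is for.
    left-of-edge : ∀ {e q c k s w} → Path q (vertex e) → Out e → vertex (α e) ≡ w →
                   Right c → RightBoundary c k (e ∷ q) → Path s (vertex e) → Right s →
                   (∀ {t} → t ⟶⁺ w → Acc _⟶⁺_ t) → (e ∷ q) ◁ p → p ◁ (e ∷ s) → v ⟶* w
    right-of-edge : ∀ {e g s r w} → α e ≡ g → ToRightmost g → Path s (vertex e) → Right s → Out e →
                    vertex (α e) ≡ w → Path r w → Right r →
                    (∀ {t} → t ⟶⁺ w → Acc _⟶⁺_ t) → (e ∷ s) ◁ p → p ◁ r → v ⟶* w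
    -- Being to the right of the left boundary, `p` cannot run inside the face. Either it is a part
    -- of the right boundary, which ends at `w`, or it lies further to the right and the scan goes
    -- on from that boundary.
    beyond-face : ∀ {e g s r w} → s⁺ (α e) ≡ g → ToRightmost g → In (s⁺ (α e)) → Face e s →
                  vertex (α e) ≡ w → Path r w → Right r →
                  (∀ {t} → t ⟶⁺ w → Acc _⟶⁺_ t) → (e ∷ s) ◁ p → p ◁ r → v ⟶* w

    outer (snoc x o at) rc b xr rr (acc below) = inner refl (toRightmost (α-out o)) x o at rc b xr rr below

    left-of-edge x o at rc start xs rs below e◁p p◁e with right-unique x rc xs rs
    ... | refl = ⊥-elim (◁-asym e◁p p◁e)
    left-of-edge x o refl rc (along l b) xs rs below e◁p p◁e with cons-◁ e◁p | ◁-cons p◁e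
    ... | _ | inj₂ (_ , t , _) = ⊥-elim (⟪-leftmostOut l t)
    ... | inj₁ q◁p | inj₁ p◁s = outer x rc b xs rs (below [ edge⟶ o ]) q◁p p◁s ◅◅ (edge⟶ o ◅ ε)
    ... | inj₂ (_ , _ , a) | inj₁ _ with right-unique x (prefix-right (prefix-tail a) rp) xs rs
    ... | refl = ⊥-elim (◁-asym e◁p p◁e)

    beyond-face eq to i f at xr rr below e◁p p◁r
      with compare xp (snoc (Face.other-path f) (α-in i) (next-in i at))
    ... | right a  = inner (trans (α-involutive _) eq) to (Face.other-path f) (α-in i)
                       (next-in i at) (Face.trunk-right f) (Face.rightBoundary f) xr rr below a p◁r
    ... | prefix a = prefix-reach a xp (snoc (Face.other-path f) (α-in i) (next-in i at))
    ... | left a   = ⊥-elim (Face.nothing-between f e◁p a)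
    ... | prefix˘ a
      with right-unique (snoc (Face.other-path f) (α-in i) (next-in i at)) (prefix-right a rp) xr rr
    ... | refl = ⊥-elim (◁⇒¬prefix˘ p◁r a)

    right-of-edge refl (stop m) xs rs o at xr rr below e◁p p◁r
      with right-unique (snoc xs o at) (snoc rs m) xr rr
    ... | refl = ⊥-elim (◁-asym e◁p p◁r)
    right-of-edge refl (step i ≢sink to) xs rs o at xr rr below e◁p p◁r =
      beyond-face refl to i (face-right-of o xs rs i ≢sink) at xr rr below e◁p p◁r

    inner {e} eq to x o at rc b xr rr below e◁p p◁r with rightPath (vertex e)
    ... | s , xs , rs with compare xp (snoc xs o at)
    ... | left a    = left-of-edge x o at rc b xs rs below e◁p a
    ... | right a   = right-of-edge eq to xs rs o at xr rr below a p◁r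
    ... | prefix a  = prefix-reach a xp (snoc xs o at)
    ... | prefix˘ a with right-unique (snoc xs o at) (prefix-right a rp) xr rr
    ... | refl = ⊥-elim (◁⇒¬prefix˘ p◁r a)

  between⇒below : ∀ {q c k p r v w} → Path q w → Right c → RightBoundary c k q →
                  Path p v → Right p → Path r w → Right r → q ◁ p → p ◁ r → v ⟶* w
  between⇒below {w = w} xq rc b xp rp xr rr = Between.outer xp rp xq rc b xr rr (⟶⁺-wf w)

-- Drawings in the plane

module Dominance {N : ℕ} (y : Fin N → Fin N) where

  infix 4 _⊏_ _⋖_
  _⊏_ _⋖_ : Rel (Fin N) 0ℓ
  i ⊏ j = i <ᶠ j × y i <ᶠ y j
  i ⋖ j = i ⊏ j × (∀ k → i ⊏ k → ¬ k ⊏ j)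

  ⊏-irrefl : ∀ {i} → ¬ i ⊏ i
  ⊏-irrefl (lt , _) = ℕ.<-irrefl refl lt

  ⊏-trans : ∀ {i j k} → i ⊏ j → j ⊏ k → i ⊏ k
  ⊏-trans (a , b) (c , d) = ℕ.<-trans a c , ℕ.<-trans b d

PlaneFunction : ∀ {N} → (Fin N → Fin N) → Set
PlaneFunction y = ∀ i j j′ k → i <ᶠ j → toℕ j′ ≡ suc (toℕ j) → j′ <ᶠ k →
                  y j <ᶠ y i → y i <ᶠ y k → ¬ y k <ᶠ y j′

-- The key of a dart is its direction and the abscissa of its other end.  Up to
-- a cyclic shift, the darts of a vertex appear counterclockwise by increasing
-- key: outgoing ones from right to left, then incoming ones from left to right.
Key : ℕ → Set
Key N = Bool × Fin N

infix 4 _≺_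
data _≺_ {N} : Rel (Key N) 0ℓ where
  out-out : ∀ {i j} → j <ᶠ i → (true , i) ≺ (true , j)
  out-in  : ∀ {i j} → (true , i) ≺ (false , j)
  in-in   : ∀ {i j} → i <ᶠ j → (false , i) ≺ (false , j)

≺-irrefl : ∀ {N} {a : Key N} → ¬ a ≺ a
≺-irrefl (out-out lt) = ℕ.<-irrefl refl lt
≺-irrefl (in-in lt)   = ℕ.<-irrefl refl lt

≺-trans : ∀ {N} {a b c : Key N} → a ≺ b → b ≺ c → a ≺ c
≺-trans (out-out a) (out-out b) = out-out (ℕ.<-trans b a)
≺-trans (out-out a) out-in      = out-in
≺-trans out-in      (in-in b)   = out-in
≺-trans (in-in a)   (in-in b)   = in-in (ℕ.<-trans a b)

≺-connex : ∀ {N} (a b : Key N) → a ≺ b ⊎ a ≡ b ⊎ b ≺ a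
≺-connex (true , i)  (true , j)  with Fin.<-cmp i j
... | tri< p _ _    = inj₂ (inj₂ (out-out p))
... | tri≈ _ refl _ = inj₂ (inj₁ refl)
... | tri> _ _ p    = inj₁ (out-out p)
≺-connex (true , i)  (false , j) = inj₁ out-in
≺-connex (false , i) (true , j)  = inj₂ (inj₂ out-in)
≺-connex (false , i) (false , j) with Fin.<-cmp i j
... | tri< p _ _    = inj₁ (in-in p)
... | tri≈ _ refl _ = inj₂ (inj₁ refl)
... | tri> _ _ p    = inj₂ (inj₂ (in-in p))

≺-cmp : ∀ {N} (a b : Key N) → Tri (a ≺ b) (a ≡ b) (b ≺ a)
≺-cmp a b = trichotomy ≺-irrefl ≺-trans (≺-connex a b)

_≺?_ : ∀ {N} (a b : Key N) → Dec (a ≺ b)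
a ≺? b with ≺-cmp a b
... | tri< p _ _ = yes p
... | tri≈ p _ _ = no p
... | tri> p _ _ = no p

module CyclicOrder {M N : ℕ} (X : Fin M → Fin N) (key : Fin M → Key N)
                   (key-injective : ∀ {g h} → X g ≡ X h → key g ≡ key h → g ≡ h) where

  key-connex : ∀ {g h} → X g ≡ X h → key g ≺ key h ⊎ g ≡ h ⊎ key h ≺ key g
  key-connex {g} {h} eq with ≺-connex (key g) (key h)
  ... | inj₁ lt         = inj₁ lt
  ... | inj₂ (inj₁ eq′) = inj₂ (inj₁ (key-injective eq eq′))
  ... | inj₂ (inj₂ gt)  = inj₂ (inj₂ gt)

  _≺ᵏ_ : Rel (Fin M) 0ℓ
  g ≺ᵏ h = key g ≺ key h

  opaque
    ≺ᵏ-wf : WellFounded _≺ᵏ_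
    ≺ᵏ-wf = wellFounded ≺-irrefl ≺-trans
    ≻ᵏ-wf : WellFounded (flip _≺ᵏ_)
    ≻ᵏ-wf = wellFounded ≺-irrefl (flip ≺-trans)

  Greatest Least : Fin M → Set
  Greatest h = ∀ g → X g ≡ X h → ¬ key h ≺ key g
  Least    k = ∀ g → X g ≡ X k → ¬ key g ≺ key k

  Next : Rel (Fin M) 0ℓ
  Next h k = X k ≡ X h ×
    ((key h ≺ key k × (∀ g → X g ≡ X h → key h ≺ key g → ¬ key g ≺ key k)) ⊎
     (Greatest h × Least k))

  next-functional : ∀ {h k k′} → Next h k → Next h k′ → k ≡ k′
  next-functional {h} {k} {k′} (eq , x) (eq′ , x′) = cases x x′ (key-connex k≡k′)
    where
    k≡k′ : X k ≡ X k′
    k≡k′ = trans eq (sym eq′)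
    cases : _ → _ → key k ≺ key k′ ⊎ k ≡ k′ ⊎ key k′ ≺ key k → k ≡ k′
    cases _ _ (inj₂ (inj₁ same)) = same
    cases (inj₁ (a , _)) (inj₁ (_ , b′)) (inj₁ lt)        = ⊥-elim (b′ k eq a lt)
    cases (inj₁ (_ , b)) (inj₁ (a′ , _)) (inj₂ (inj₂ gt)) = ⊥-elim (b k′ eq′ a′ gt)
    cases (inj₂ _) (inj₂ (_ , b′)) (inj₁ lt)              = ⊥-elim (b′ k k≡k′ lt)
    cases (inj₂ (_ , b)) (inj₂ _) (inj₂ (inj₂ gt))        = ⊥-elim (b k′ (sym k≡k′) gt)
    cases (inj₁ (a , _)) (inj₂ (a′ , _)) _                = ⊥-elim (a′ k eq a)
    cases (inj₂ (a , _)) (inj₁ (a′ , _)) _                = ⊥-elim (a k′ eq′ a′)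

  next-injective : ∀ {h h′ k} → Next h k → Next h′ k → h ≡ h′
  next-injective {h} {h′} {k} (eq , x) (eq′ , x′) = cases x x′ (key-connex h≡h′)
    where
    h≡h′ : X h ≡ X h′
    h≡h′ = trans (sym eq) eq′
    cases : _ → _ → key h ≺ key h′ ⊎ h ≡ h′ ⊎ key h′ ≺ key h → h ≡ h′
    cases _ _ (inj₂ (inj₁ same)) = same
    cases (inj₁ (_ , b)) (inj₁ (a′ , _)) (inj₁ lt)        = ⊥-elim (b h′ (sym h≡h′) lt a′)
    cases (inj₁ (a , _)) (inj₁ (_ , b′)) (inj₂ (inj₂ gt)) = ⊥-elim (b′ h h≡h′ gt a)
    cases (inj₂ (a , _)) (inj₂ _) (inj₁ lt)               = ⊥-elim (a h′ (sym h≡h′) lt)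
    cases (inj₂ _) (inj₂ (a′ , _)) (inj₂ (inj₂ gt))       = ⊥-elim (a′ h h≡h′ gt)
    cases (inj₁ (a , _)) (inj₂ (_ , b′)) _                = ⊥-elim (b′ h (sym eq) a)
    cases (inj₂ (_ , b)) (inj₁ (a′ , _)) _                = ⊥-elim (b h′ (sym eq′) a′)

  next : ∀ h → ∃ (Next h)
  next h with Fin.any? (λ k → (X k Fin.≟ X h) ×-dec (key h ≺? key k))
  ... | yes above with maximal (λ g h → key h ≺? key g) ≺-irrefl (flip ≺-trans)
                         (λ k → (X k Fin.≟ X h) ×-dec (key h ≺? key k)) above
  ... | k , (eq , lt) , min = k , eq , inj₁ (lt , λ g at p → min g (at , p))
  next h | no none with maximal (λ g h → key h ≺? key g) ≺-irrefl (flip ≺-trans)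
                         (λ k → X k Fin.≟ X h) (h , refl)
  ... | k , eq , min = k , eq , inj₂ ((λ g at p → none (g , at , p)) , λ g at → min g (trans at eq))

-- The graph of the bijection: `O` is the Hasse diagram of the points `(i , y i)`. A single
-- non-ascent at each vertex means that the rotation lists the keys in cyclic order; this is the
-- form that uniqueness of corners delivers directly. `root-descent` puts the break at the source
-- just before the root.
record Drawing {N} (y : Fin N → Fin N) (O : PlaneBipolarOrientation) : Set where
  open PlaneBipolarOrientation O
  open Dominance y
  field
    X             : Dart → Fin N
    X-cong        : ∀ {g h} → g ∼ᵛ h → X g ≡ X h
    X-reflects    : ∀ {g h} → X g ≡ X h → g ∼ᵛ h
    X-onto        : ∀ i → ∃ λ h → X h ≡ i
    edge-cover    : ∀ {h} → outgoing h ≡ true → X h ⋖ X (α h)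
    cover-edge    : ∀ {i j} → i ⋖ j → ∃ λ h → outgoing h ≡ true × X h ≡ i × X (α h) ≡ j
    edge-unique   : ∀ {g h} → outgoing g ≡ true → outgoing h ≡ true → X g ≡ X h →
                    X (α g) ≡ X (α h) → g ≡ h

  key : Dart → Key N
  key h = outgoing h , X (α h)

  Ascending : Dart → Set
  Ascending h = key h ≺ key (σ ⟨$⟩ʳ h)

  field
    descent-unique : ∀ {g h} → X g ≡ X h → ¬ Ascending g → ¬ Ascending h → g ≡ h
    root-descent   : ¬ Ascending (σ ⟨$⟩ˡ root)

-- Coordinates of plane bipolar posets

module VertexOrders (O : PlaneBipolarOrientation) where
  open OrientationBasics O
  open PlanarStructure O

  rpath : Vx → List Dart
  rpath u = proj₁ (rightPath u)
  rpath-path : ∀ u → Path (rpath u) u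
  rpath-path u = proj₁ (proj₂ (rightPath u))
  rpath-right : ∀ u → Right (rpath u)
  rpath-right u = proj₂ (proj₂ (rightPath u))

  infix 4 _<ˣ_ _<ʸ_
  _<ˣ_ : Rel Vx 0ℓ
  u <ˣ v = rpath u <ₗ rpath v

  <ˣ-asym : ∀ {u v} → u <ˣ v → ¬ v <ˣ u
  <ˣ-asym a b = <ₗ-irrefl (<ₗ-trans a b)

  <ˣ-connex : ∀ u v → u <ˣ v ⊎ u ≡ v ⊎ v <ˣ u
  <ˣ-connex u v with u Fin.≟ v
  ... | yes eq = inj₂ (inj₁ eq)
  ... | no u≢v with compare (rpath-path u) (rpath-path v)
  ... | prefix a =
      inj₁ (inj₁ (a , λ eq → u≢v (path-end (subst (λ p → Path p u) eq (rpath-path u)) (rpath-path v))))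
  ... | prefix˘ a =
      inj₂ (inj₂ (inj₁ (a , λ eq → u≢v (path-end (subst (λ p → Path p u) (sym eq) (rpath-path u)) (rpath-path v)))))
  ... | left a    = inj₁ (inj₂ a)
  ... | right a   = inj₂ (inj₂ (inj₂ a))

  step-path : ∀ {u w} (e : u ⟶ w) → Path (proj₁ e ∷ rpath u) w
  step-path (h , o , refl , at) = snoc (rpath-path _) o at

  -- The rightmost path to `u` continued by the edge is a path to `w`, so it is the rightmost path
  -- to `w` or branches to the left of it.
  ⟶⇒<ˣ : ∀ {u w} → u ⟶ w → u <ˣ w
  ⟶⇒<ˣ {u} {w} e with path-⊴ (step-path e) (rpath-path w) (rpath-right w)
  ... | inj₁ eq = inj₁ (subst (Prefix (rpath u)) eq (ext refl) ,
                        λ eq′ → ¬prefix-cons (subst (λ p → Prefix p (rpath u)) (trans eq′ (sym eq)) refl))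
  ... | inj₂ x with cons-◁ x
  ... | inj₁ y = inj₂ y
  ... | inj₂ (_ , _ , a) = inj₁ (prefix-tail a , λ eq → ¬prefix-cons (subst (Prefix _) (sym eq) a))

  ⟶⁺⇒<ˣ : ∀ {u w} → u ⟶⁺ w → u <ˣ w
  ⟶⁺⇒<ˣ [ e ]   = ⟶⇒<ˣ e
  ⟶⁺⇒<ˣ (e ∷ p) = <ₗ-trans (⟶⇒<ˣ e) (⟶⁺⇒<ˣ p)

  ⟶*⇒≯ˣ : ∀ {u w} → u ⟶* w → ¬ w <ˣ u
  ⟶*⇒≯ˣ p lt with ⟶*-split p
  ... | inj₁ refl = <ₗ-irrefl lt
  ... | inj₂ q    = <ˣ-asym lt (⟶⁺⇒<ˣ q)

  rpath-prefix⇒⟶* : ∀ {u v} → Prefix (rpath u) (rpath v) → u ⟶* v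
  rpath-prefix⇒⟶* a = prefix-reach a (rpath-path _) (rpath-path _)

  ◁-below-edge : ∀ {u v w} → u ⟶ w → rpath u ◁ rpath v → v <ˣ w → v ⟶* w
  ◁-below-edge e x (inj₁ (a , _)) = rpath-prefix⇒⟶* a
  ◁-below-edge {u} {v} {w} e x (inj₂ y) = between⇒below (step-path e) (rpath-right u) start
    (rpath-path v) (rpath-right v) (rpath-path w) (rpath-right w) (◁-extend (ext refl) refl x) y

  between-edge : ∀ {u v w} → u ⟶ w → u <ˣ v → v <ˣ w → u ⟶* v ⊎ v ⟶* w
  between-edge e (inj₁ (a , _)) _ = inj₁ (rpath-prefix⇒⟶* a)
  between-edge e (inj₂ x) v<w     = inj₂ (◁-below-edge e x v<w)

  -- So `<ˣ` is a non-separating linear extension in the sense of Dushnik and Miller, which is what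
  -- makes the conjugate relation `<ʸ` transitive.
  between : ∀ {u v w} → u ⟶* w → u <ˣ v → v <ˣ w → u ⟶* v ⊎ v ⟶* w
  between ε u<v v<u = ⊥-elim (<ˣ-asym u<v v<u)
  between {v = v} (_◅_ {j = m} e p) u<v v<w with <ˣ-connex v m
  ... | inj₂ (inj₁ refl) = inj₂ p
  ... | inj₂ (inj₂ m<v) with between p m<v v<w
  ... | inj₁ q = inj₁ (e ◅ q)
  ... | inj₂ q = inj₂ q
  between (e ◅ p) u<v v<w | inj₁ v<m with between-edge e u<v v<m
  ... | inj₁ q = inj₁ q
  ... | inj₂ q = inj₂ (q ◅◅ p)

  _⟶*?_ : ∀ u w → Dec (u ⟶* w)
  u ⟶*? w = go (⟶⁺-wf w)
    where
    go : ∀ {w} → Acc _⟶⁺_ w → Dec (u ⟶* w)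
    go {w} (acc rs) with u Fin.≟ w
    ... | yes refl = yes ε
    ... | no u≢w with Fin.any? last?
      where
      last? : ∀ h → Dec (Out h × vertex (α h) ≡ w × u ⟶* vertex h)
      last? h with outgoing h ≟ᵇ true | vertex (α h) Fin.≟ w
      ... | no ¬o | _     = no (¬o ∘ proj₁)
      ... | yes _ | no ¬p = no (¬p ∘ proj₁ ∘ proj₂)
      ... | yes o | yes p with go (rs [ h , o , refl , p ])
      ... | yes q = yes (o , p , q)
      ... | no ¬q = no (¬q ∘ proj₂ ∘ proj₂)
    ... | yes (h , o , p , q) = yes (q ◅◅ ((h , o , refl , p) ◅ ε))
    ... | no none = no λ q → none (last u≢w q)
      where
      last : ∀ {t w} → t ≢ w → t ⟶* w → ∃ λ h → Out h × vertex (α h) ≡ w × t ⟶* vertex h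
      last t≢w ε = ⊥-elim (t≢w refl)
      last {w = w} _ (_◅_ {j = m} (h , o , a , b) p) with m Fin.≟ w
      ... | yes refl = h , o , b , subst (_⟶* vertex h) a ε
      ... | no m≢w with last m≢w p
      ... | h′ , o′ , b′ , q = h′ , o′ , b′ , (h , o , a , b) ◅ q

  _<ʸ_ : Rel Vx 0ℓ
  u <ʸ v = u ⟶⁺ v ⊎ (¬ u ⟶* v × ¬ v ⟶* u × v <ˣ u)

  <ʸ-irrefl : ∀ {u} → ¬ u <ʸ u
  <ʸ-irrefl (inj₁ p)           = ⟶⁺-irrefl p
  <ʸ-irrefl (inj₂ (_ , _ , q)) = <ₗ-irrefl q

  <ʸ-connex : ∀ u v → u <ʸ v ⊎ u ≡ v ⊎ v <ʸ u
  <ʸ-connex u v with u ⟶*? v | v ⟶*? u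
  ... | yes p | _ with ⟶*-split p
  ... | inj₁ eq = inj₂ (inj₁ eq)
  ... | inj₂ q  = inj₁ (inj₁ q)
  <ʸ-connex u v | no _ | yes p with ⟶*-split p
  ... | inj₁ eq = inj₂ (inj₁ (sym eq))
  ... | inj₂ q  = inj₂ (inj₂ (inj₁ q))
  <ʸ-connex u v | no ¬p | no ¬q with <ˣ-connex u v
  ... | inj₁ lt        = inj₂ (inj₂ (inj₂ (¬q , ¬p , lt)))
  ... | inj₂ (inj₁ eq) = inj₂ (inj₁ eq)
  ... | inj₂ (inj₂ gt) = inj₁ (inj₂ (¬p , ¬q , gt))

  -- By `<ʸ-connex` it is enough to refute `u ≡ w` and `w <ʸ u`. Each case contradicts an assumed
  -- incomparability or `<ˣ-asym`, in the mixed cases by way of `between`.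
  <ʸ-trans : ∀ {u v w} → u <ʸ v → v <ʸ w → u <ʸ w
  <ʸ-trans (inj₁ p) (inj₁ q) = inj₁ (p ++ q)
  <ʸ-trans {u} {v} {w} (inj₁ p) (inj₂ (¬vw , ¬wv , w<v)) with <ʸ-connex u w
  ... | inj₁ lt = lt
  ... | inj₂ (inj₁ refl) = ⊥-elim (¬wv (⟶⁺⇒⟶* p))
  ... | inj₂ (inj₂ (inj₁ q)) = ⊥-elim (¬wv (⟶⁺⇒⟶* (q ++ p)))
  ... | inj₂ (inj₂ (inj₂ (¬wu , ¬uw , u<w))) with between (⟶⁺⇒⟶* p) u<w w<v
  ... | inj₁ q = ⊥-elim (¬uw q)
  ... | inj₂ q = ⊥-elim (¬wv q)
  <ʸ-trans {u} {v} {w} (inj₂ (¬uv , ¬vu , v<u)) (inj₁ p) with <ʸ-connex u w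
  ... | inj₁ lt = lt
  ... | inj₂ (inj₁ refl) = ⊥-elim (¬vu (⟶⁺⇒⟶* p))
  ... | inj₂ (inj₂ (inj₁ q)) = ⊥-elim (¬vu (⟶⁺⇒⟶* (p ++ q)))
  ... | inj₂ (inj₂ (inj₂ (¬wu , ¬uw , u<w))) with between (⟶⁺⇒⟶* p) v<u u<w
  ... | inj₁ q = ⊥-elim (¬vu q)
  ... | inj₂ q = ⊥-elim (¬uw q)
  <ʸ-trans {u} {v} {w} (inj₂ (¬uv , ¬vu , v<u)) (inj₂ (¬vw , ¬wv , w<v)) with <ʸ-connex u w
  ... | inj₁ lt = lt
  ... | inj₂ (inj₁ refl) = ⊥-elim (<ˣ-asym v<u w<v)
  ... | inj₂ (inj₂ (inj₂ (_ , _ , u<w))) = ⊥-elim (<ˣ-asym u<w (<ₗ-trans w<v v<u))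
  ... | inj₂ (inj₂ (inj₁ p)) with between (⟶⁺⇒⟶* p) w<v v<u
  ... | inj₁ q = ⊥-elim (¬wv q)
  ... | inj₂ q = ⊥-elim (¬vu q)

  from-vs : ∀ u → vs ⟶* u
  from-vs u = prefix-reach (empty _) ([] refl) (rpath-path u)
    where
    empty : ∀ q → Prefix [] q
    empty []      = refl
    empty (_ ∷ q) = ext (empty q)

  to-vt : ∀ u → u ⟶* vt
  to-vt u = go (⟵⁺-wf u)
    where
    go : ∀ {u} → Acc (λ a b → b ⟶⁺ a) u → u ⟶* vt
    go {u} (acc rs) with u Fin.≟ vt
    ... | yes refl = ε
    ... | no u≢ with out-dart-at u u≢
    ... | h , refl , o = edge⟶ o ◅ go (rs [ edge⟶ o ])

  -- Every edge of the path after `k` starts strictly above the common tail of `h` and `k`, so by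
  -- acyclicity it is not `h`.
  avoiding⇒transitive : ∀ {h k} → Out k → vertex k ≡ vertex h → k ≢ h →
                        vertex (α k) ⟶* vertex (α h) → IsTransitive h
  avoiding⇒transitive {h} {k} o eq k≢h p = build [ edge⟶ o ] (≡⇒∼ eq) refl k≢h o p
    where
    build : ∀ {k m x} → vertex _ ⟶⁺ m → k ∼ᵛ x → vertex (α k) ≡ m → k ≢ h → Out k →
            m ⟶* vertex (α h) → TransClosure (ArcAvoiding h) x (α h)
    build r k∼ at k≢h o ε = [ _ , o , k≢h , k∼ , ≡⇒∼ at ]
    build {k} r k∼ at k≢h o ((e , o′ , a , b) ◅ p) =
      (k , o , k≢h , k∼ , ≡⇒∼ (trans at (sym a))) ∷
      build (r ++ [ e , o′ , a , b ]) (≡⇒∼ refl) b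
        (λ { refl → ⟶⁺-irrefl (subst (vertex _ ⟶⁺_) (trans (sym a) (sym eq)) r) }) o′ p

-- Consequences of the absence of transitive edges

module PosetOrders (P : PlaneBipolarPoset) where
  open PlaneBipolarPoset P using (orientation; no-transitive)
  open OrientationBasics orientation
  open PlanarStructure orientation
  open VertexOrders orientation

  edge⇒cover : ∀ {u v w} → u ⟶ w → u ⟶⁺ v → ¬ v ⟶⁺ w
  edge⇒cover {v = v} (h , o , refl , refl) p q = via-head p
    where
    via-head : vertex h ⟶⁺ v → ⊥
    via-edge : ∀ {k} → Out k → vertex k ≡ vertex h → vertex (α k) ⟶* v → ⊥
    via-edge {k} o′ eq r with k Fin.≟ h
    ... | yes refl = ⟶⁺-irrefl (⟶*-⟶⁺ r q)
    ... | no k≢h   = no-transitive h o (avoiding⇒transitive o′ eq k≢h (⟶⁺⇒⟶* (⟶*-⟶⁺ r q)))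
    via-head [ k , o′ , eq , refl ]     = via-edge o′ eq ε
    via-head ((k , o′ , eq , refl) ∷ r) = via-edge o′ eq (⟶⁺⇒⟶* r)

  parallel⇒≡ : ∀ {g h} → Out g → Out h → vertex g ≡ vertex h → vertex (α g) ≡ vertex (α h) → g ≡ h
  parallel⇒≡ {g} {h} o o′ eq eq′ with g Fin.≟ h
  ... | yes p = p
  ... | no ¬p = ⊥-elim (no-transitive h o′
    (avoiding⇒transitive o eq ¬p (subst (vertex (α g) ⟶*_) eq′ ε)))

  leftBoundary-split : ∀ {c h e p} → LeftBoundary c h (e ∷ p) →
                       (h ≡ e × c ≡ p) ⊎ (RightmostOut e × Prefix (h ∷ c) p)
  leftBoundary-split start       = inj₁ (refl , refl)
  leftBoundary-split (along r b) = inj₂ (r , leftBoundary-prefix b)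

  rightBoundary-split : ∀ {c h e p} → RightBoundary c h (e ∷ p) →
                        (h ≡ e × c ≡ p) ⊎ (LeftmostOut e × Prefix (h ∷ c) p)
  rightBoundary-split start       = inj₁ (refl , refl)
  rightBoundary-split (along r b) = inj₂ (r , rightBoundary-prefix b)

  boundary-reach : ∀ {h c q w} → Prefix (h ∷ c) q → Path q w → vertex (α h) ⟶* w
  boundary-reach a y with prefix-path a y
  ... | x , o = prefix-reach a (snoc x o refl) y

  -- A boundary with a single edge would make this edge transitive, because of
  -- the other boundary.
  left-boundary-long : ∀ {e p} → Out e → Path p (vertex e) → Right p → In (s⁺ (α e)) →
                       (f : Face e p) → RightmostOut e × Prefix (Face.lowest f ∷ Face.trunk f) p
  left-boundary-long {e} o x r i f with leftBoundary-split (Face.leftBoundary f)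
  ... | inj₂ a = a
  ... | inj₁ (refl , refl) = ⊥-elim (no-transitive e o (avoiding⇒transitive (proj₂ (Face.bottom f))
          (vertex-s⁻ e) (λ eq → ⟪-irrefl (subst (e ⟪_) eq (bottom-⟪ (Face.bottom f) (Face.lowest≢root f))))
          (boundary-reach (rightBoundary-prefix (Face.rightBoundary f))
            (snoc (Face.other-path f) (α-in i) (next-in i refl)))))

  right-boundary-long : ∀ {e p} → Out e → Path p (vertex e) → In (s⁺ (α e)) →
                        (f : Face e p) → Prefix (s⁻ (Face.lowest f) ∷ Face.trunk f) (Face.other f)
  right-boundary-long {e} o x i f with rightBoundary-split (Face.rightBoundary f)
  ... | inj₂ (_ , a) = a
  ... | inj₁ (eq , _) =
      ⊥-elim (no-transitive (α (s⁺ (α e))) (α-in i) (avoiding⇒transitive (proj₁ (Face.bottom f))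
          (trans (sym (vertex-s⁻ _)) (cong vertex eq))
          (λ eq′ → ⟪-irrefl (subst (Face.lowest f ⟪_) (trans eq (sym eq′)) (bottom-⟪ (Face.bottom f) (Face.lowest≢root f))))
          (subst (vertex (α (Face.lowest f)) ⟶*_) (sym (next-in i refl))
            (boundary-reach (leftBoundary-prefix (Face.leftBoundary f)) (snoc x o refl)))))

  -- Both boundaries of the face between the two incoming edges have more than one edge, so the
  -- paths to the lower ends of these edges already contain the branching at the bottom of the face.
  incoming-increase : ∀ {e} → Out e → In (s⁺ (α e)) → s⁺ (α e) ≢ sink →
                      vertex e <ˣ vertex (α (s⁺ (α e)))
  incoming-increase {e} o i ≢sink = inj₂ (◁-⊴
    (diverge (bottom-⟪ (Face.bottom f) (Face.lowest≢root f))
      (proj₂ (left-boundary-long o x r i f)) (right-boundary-long o x i f))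
    (path-⊴ (Face.other-path f) (rpath-path _) (rpath-right _)))
    where
    x = rpath-path (vertex e)
    r = rpath-right (vertex e)
    f = face-right-of o x r i ≢sink

  -- The edge `h` is the rightmost one into its head: a face to its right there would have `h` as
  -- the last edge of a long left boundary, hence as a rightmost outgoing edge, against the presence
  -- of `s⁻ h`. So the rightmost path to the head of `h` ends with `h`, and it branches off to the
  -- left of `s⁻ h`.
  outgoing-decrease : ∀ {h} → Out h × Out (s⁻ h) → h ≢ root → vertex (α h) <ˣ vertex (α (s⁻ h))
  outgoing-decrease {h} (o , o′) ≢root = branch (out-or-in (s⁺ (α h))) (s⁺ (α h) Fin.≟ sink)
    where
    x = rpath-path (vertex h)
    r = rpath-right (vertex h)
    rightmost : RightmostIn (α h) → vertex (α h) <ˣ vertex (α (s⁻ h))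
    rightmost m with right-unique (snoc x o refl) (snoc r m) (rpath-path _) (rpath-right _)
    ... | eq = inj₂ (subst (_◁ rpath (vertex (α (s⁻ h)))) eq
      (◁-⊴ (diverge (bottom-⟪ (o , o′) ≢root) refl refl)
        (path-⊴ (snoc (subst (Path _) (sym (vertex-s⁻ h)) x) o′ refl) (rpath-path _) (rpath-right _))))
    branch : Out (s⁺ (α h)) ⊎ In (s⁺ (α h)) → Dec (s⁺ (α h) ≡ sink) → vertex (α h) <ˣ vertex (α (s⁻ h))
    branch (inj₁ o″) _        = rightmost (α-out o , inj₁ o″)
    branch (inj₂ _)  (yes eq) = rightmost (α-out o , inj₂ eq)
    branch (inj₂ i)  (no ¬eq) with proj₁ (left-boundary-long o x r i (face-right-of o x r i ¬eq))
    ... | _ , inj₁ i′ = ⊥-elim (out≢in o′ i′)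
    ... | _ , inj₂ eq = ⊥-elim (≢root eq)

  Adjacent : Rel Vx 0ℓ
  Adjacent u v = u <ˣ v × (∀ w → u <ˣ w → ¬ w <ˣ v)

  -- Suppose the path to `u` branches to the left, and look at the last edge of the rightmost path
  -- to `v`. Either its tail comes between `u` and `v`, or the path to `u` leaves from its tail, and
  -- then `u` lies strictly between the two ends of an edge.
  adjacent-prefix : ∀ {u v} → Adjacent u v → u ⟶⁺ v → Prefix (rpath u) (rpath v)
  adjacent-prefix (inj₁ (a , _) , _) _ = a
  adjacent-prefix {u} {v} (inj₂ x , none) p = last-step (rpath-path v) (rpath-right v) refl
    where
    last-step : ∀ {q} → Path q v → Right q → q ≡ rpath v → Prefix (rpath u) (rpath v)
    last-step ([] refl) _ _ = ⊥-elim (⟶*⇒≯ˣ (from-vs u) (inj₂ x))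
    last-step (snoc {h} y o at) (snoc r _) eq
      with right-unique y r (rpath-path (vertex h)) (rpath-right (vertex h))
    ... | refl with ◁-cons (subst (rpath u ◁_) (sym eq) x)
    ... | inj₁ z = ⊥-elim (none (vertex h) (inj₂ z) (⟶⇒<ˣ (h , o , refl , at)))
    ... | inj₂ (_ , _ , a) with ⟶*-split (rpath-prefix⇒⟶* (prefix-tail a))
    ... | inj₁ refl = ⊥-elim (¬prefix-cons a)
    ... | inj₂ q    = ⊥-elim (edge⇒cover (h , o , refl , at) q p)

  -- The letters 2, 1, 4, 3 are `a`, `b`, `c`, `d`. A path from `a` to `d` has an edge that jumps
  -- over `b`; by adjacency it reaches `c` or jumps over it as well, and in the latter case
  -- `◁-below-edge` puts `c` below its head. Either way `c` lies below `d`.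
  no-crossing : ∀ {a b c d} → a <ˣ b → ¬ a ⟶* b → a ⟶* d → Adjacent b c → b ⟶⁺ c →
                c <ˣ d → ¬ c ⟶* d → ⊥
  no-crossing a<b ¬ab ε (b<c , _) _ c<a _ = <ˣ-asym a<b (<ₗ-trans b<c c<a)
  no-crossing {a} {b} {c} (inj₁ (x , _)) ¬ab _ _ _ _ _ = ¬ab (rpath-prefix⇒⟶* x)
  no-crossing {a} {b} {c} (inj₂ x) ¬ab (_◅_ {j = m} e p) adj b→c c<d ¬cd with <ˣ-connex m b
  ... | inj₁ m<b = no-crossing m<b (λ q → ¬ab (e ◅ q)) p adj b→c c<d ¬cd
  ... | inj₂ (inj₁ refl) = ¬ab (e ◅ ε)
  ... | inj₂ (inj₂ b<m) with <ˣ-connex c m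
  ... | inj₁ c<m =
    ¬cd (◁-below-edge e (◁-extend refl (adjacent-prefix adj b→c) x) c<m ◅◅ p)
  ... | inj₂ (inj₁ refl) = ¬cd p
  ... | inj₂ (inj₂ m<c) = proj₂ adj m b<m m<c

module PosetCoordinates (P : PlaneBipolarPoset) {N : ℕ} (size : PlaneBipolarPoset.#vertices P ≡ N) where
  open PlaneBipolarPoset P using (orientation; no-transitive)
  open OrientationBasics orientation
  open PlanarStructure orientation
  open VertexOrders orientation
  open PosetOrders P

  private
    module RX = Rank _<ˣ_ <ₗ-irrefl <ₗ-trans (λ u v → trichotomy <ₗ-irrefl <ₗ-trans (<ˣ-connex u v))
    module RY = Rank _<ʸ_ <ʸ-irrefl <ʸ-trans (λ u v → trichotomy <ʸ-irrefl <ʸ-trans (<ʸ-connex u v))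

    cast-mono : ∀ {i j : Fin #vertices} → i <ᶠ j → cast size i <ᶠ cast size j
    cast-mono = subst₂ ℕ._<_ (sym (Fin.toℕ-cast size _)) (sym (Fin.toℕ-cast size _))
    cast-cancel : ∀ {i j : Fin #vertices} → cast size i <ᶠ cast size j → i <ᶠ j
    cast-cancel = subst₂ ℕ._<_ (Fin.toℕ-cast size _) (Fin.toℕ-cast size _)
    cast-inj : ∀ {i j : Fin #vertices} → cast size i ≡ cast size j → i ≡ j
    cast-inj eq =
        Fin.toℕ-injective (trans (sym (Fin.toℕ-cast size _)) (trans (cong toℕ eq) (Fin.toℕ-cast size _)))

  xcoord ycoord : Vx → Fin N
  xcoord u = cast size (RX.rank u)
  ycoord u = cast size (RY.rank u)

  xcoord-injective : ∀ {u v} → xcoord u ≡ xcoord v → u ≡ v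
  xcoord-injective = RX.rank-injective ∘ cast-inj

  at : Fin N → Vx
  at i = proj₁ (RX.rank-surjective (cast (sym size) i))

  xcoord-at : ∀ i → xcoord (at i) ≡ i
  xcoord-at i = trans (cong (cast size) (proj₂ (RX.rank-surjective (cast (sym size) i))))
    (Fin.toℕ-injective (trans (Fin.toℕ-cast size _) (Fin.toℕ-cast (sym size) i)))

  at-xcoord : ∀ u → at (xcoord u) ≡ u
  at-xcoord u = xcoord-injective (xcoord-at (xcoord u))

  height : Fin N → Fin N
  height i = ycoord (at i)

  height-injective : ∀ {i j} → height i ≡ height j → i ≡ j
  height-injective {i} {j} eq = trans (sym (xcoord-at i))
    (trans (cong xcoord (RY.rank-injective (cast-inj eq))) (xcoord-at j))

  <⇒<ˣ : ∀ {i j} → i <ᶠ j → at i <ˣ at j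
  <⇒<ˣ {i} {j} lt = RX.rank-cancel (cast-cancel (subst₂ _<ᶠ_ (sym (xcoord-at i)) (sym (xcoord-at j)) lt))

  <ˣ⇒< : ∀ {u v} → u <ˣ v → xcoord u <ᶠ xcoord v
  <ˣ⇒< lt = cast-mono (RX.rank-mono lt)

  <⇒<ʸ : ∀ {i j} → height i <ᶠ height j → at i <ʸ at j
  <⇒<ʸ lt = RY.rank-cancel (cast-cancel lt)

  open Dominance height

  ⊏⇒⟶⁺ : ∀ {i j} → i ⊏ j → at i ⟶⁺ at j
  ⊏⇒⟶⁺ (lt , lt′) with <⇒<ʸ lt′
  ... | inj₁ p           = p
  ... | inj₂ (_ , _ , q) = ⊥-elim (<ˣ-asym q (<⇒<ˣ lt))

  ⟶⁺⇒⊏ : ∀ {u v} → u ⟶⁺ v → xcoord u ⊏ xcoord v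
  ⟶⁺⇒⊏ {u} {v} p = <ˣ⇒< (⟶⁺⇒<ˣ p) ,
    subst₂ (λ a b → ycoord a <ᶠ ycoord b) (sym (at-xcoord u)) (sym (at-xcoord v))
      (cast-mono (RY.rank-mono (inj₁ p)))

  ⟶⇒⋖ : ∀ {u v} → u ⟶ v → xcoord u ⋖ xcoord v
  ⟶⇒⋖ {u} {v} e = ⟶⁺⇒⊏ [ e ] , λ k a b → edge⇒cover e
    (subst (_⟶⁺ at k) (at-xcoord u) (⊏⇒⟶⁺ a)) (subst (at k ⟶⁺_) (at-xcoord v) (⊏⇒⟶⁺ b))

  ⋖⇒⟶ : ∀ {i j} → i ⋖ j → at i ⟶ at j
  ⋖⇒⟶ {i} {j} (lt , none) with ⊏⇒⟶⁺ lt
  ... | [ e ] = e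
  ... | _∷_ {y = m} e p = ⊥-elim (none (xcoord m)
    (subst (_⊏ xcoord m) (xcoord-at i) (⟶⁺⇒⊏ [ e ])) (subst (xcoord m ⊏_) (xcoord-at j) (⟶⁺⇒⊏ p)))

  height-plane : PlaneFunction height
  height-plane i j j′ k i<j j′≡ j′<k yj<yi yi<yk yk<yj′ =
    no-crossing (<⇒<ˣ i<j)
      (λ p → ℕ.<⇒≱ yj<yi (≤ʸ p))
      (⟶⁺⇒⟶* (⊏⇒⟶⁺ (i<k , yi<yk)))
      (<⇒<ˣ j<j′ , λ w a b → ℕ.<⇒≱ (subst (xcoord w <ᶠ_) (xcoord-at j′) (<ˣ⇒< b))
        (subst (ℕ._≤ toℕ (xcoord w)) (trans (cong (suc ∘ toℕ) (xcoord-at j)) (sym j′≡)) (<ˣ⇒< a)))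
      (⊏⇒⟶⁺ (j<j′ , ℕ.<-trans yj<yi (ℕ.<-trans yi<yk yk<yj′)))
      (<⇒<ˣ j′<k)
      (λ p → ℕ.<⇒≱ yk<yj′ (≤ʸ p))
    where
    j<j′ : j <ᶠ j′
    j<j′ = ℕ.≤-reflexive (sym j′≡)
    i<k : i <ᶠ k
    i<k = ℕ.<-trans i<j (ℕ.<-trans j<j′ j′<k)
    ≤ʸ : ∀ {a b} → at a ⟶* at b → toℕ (height a) ℕ.≤ toℕ (height b)
    ≤ʸ p with ⟶*-split p
    ... | inj₁ eq = ℕ.≤-reflexive (cong (toℕ ∘ ycoord) eq)
    ... | inj₂ q  = ℕ.<⇒≤ (cast-mono (RY.rank-mono (inj₁ q)))

  height-vs : ∀ i → i ≢ xcoord vs → xcoord vs ⊏ i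
  height-vs i i≢ with ⟶*-split (from-vs (at i))
  ... | inj₁ eq = ⊥-elim (i≢ (trans (sym (xcoord-at i)) (cong xcoord (sym eq))))
  ... | inj₂ p  = subst (xcoord vs ⊏_) (xcoord-at i) (⟶⁺⇒⊏ p)

  height-vt : ∀ i → i ≢ xcoord vt → i ⊏ xcoord vt
  height-vt i i≢ with ⟶*-split (to-vt (at i))
  ... | inj₁ eq = ⊥-elim (i≢ (trans (sym (xcoord-at i)) (cong xcoord eq)))
  ... | inj₂ p  = subst (_⊏ xcoord vt) (xcoord-at i) (⟶⁺⇒⊏ p)

  -- The three places where the keys may fail to increase: from incoming to outgoing darts, and
  -- before the outer corners of the source and of the sink. At one vertex they exclude each other.
  Descent : Dart → Set
  Descent h = (In h × Out (s⁺ h)) ⊎ s⁺ h ≡ root ⊎ s⁺ h ≡ sink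

  Descent-unique : ∀ {g h} → vertex g ≡ vertex h → Descent g → Descent h → g ≡ h
  Descent-unique {g} {h} eq = cases
    where
    in-root : ∀ {g h} → vertex g ≡ vertex h → In g → s⁺ h ≢ root
    in-root {h = h} eq i p = out≢in (out-at-vs (trans eq (trans (sym (vertex-s⁺ h)) (cong vertex p)))) i
    out-sink : ∀ {g h} → vertex g ≡ vertex h → Out (s⁺ g) → s⁺ h ≢ sink
    out-sink {g} {h} eq o p = out≢in o
      (in-at-vt (trans (vertex-s⁺ g) (trans eq (trans (sym (vertex-s⁺ h)) (cong vertex p)))))
    root-sink : ∀ {g h} → vertex g ≡ vertex h → s⁺ g ≡ root → s⁺ h ≢ sink
    root-sink eq p = out-sink eq (subst Out (sym p) (out-at-vs refl))
    cases : Descent g → Descent h → g ≡ h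
    cases (inj₁ (i , o)) (inj₁ (i′ , o′))    = rightmostIn-unique (i , inj₁ o) (i′ , inj₁ o′) eq
    cases (inj₁ (i , _)) (inj₂ (inj₁ p))     = ⊥-elim (in-root eq i p)
    cases (inj₁ (_ , o)) (inj₂ (inj₂ p))     = ⊥-elim (out-sink eq o p)
    cases (inj₂ (inj₁ p)) (inj₁ (i , _))     = ⊥-elim (in-root (sym eq) i p)
    cases (inj₂ (inj₂ p)) (inj₁ (_ , o))     = ⊥-elim (out-sink (sym eq) o p)
    cases (inj₂ (inj₁ p)) (inj₂ (inj₁ q))    = s⁺-injective (trans p (sym q))
    cases (inj₂ (inj₁ p)) (inj₂ (inj₂ q))    = ⊥-elim (root-sink eq p q)
    cases (inj₂ (inj₂ p)) (inj₂ (inj₁ q))    = ⊥-elim (root-sink (sym eq) q p)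
    cases (inj₂ (inj₂ p)) (inj₂ (inj₂ q))    = s⁺-injective (trans p (sym q))

  key : Dart → Key N
  key h = outgoing h , xcoord (vertex (α h))

  Ascending : Dart → Set
  Ascending h = key h ≺ key (s⁺ h)

  directed : ∀ {g h b b′} → outgoing g ≡ b → outgoing h ≡ b′ →
             (b , xcoord (vertex (α g))) ≺ (b′ , xcoord (vertex (α h))) → key g ≺ key h
  directed {g} {h} eq eq′ = subst₂ (λ b b′ → (b , xcoord (vertex (α g))) ≺ (b′ , xcoord (vertex (α h))))
    (sym eq) (sym eq′)

  descent : ∀ {h} → ¬ Ascending h → Descent h
  descent {h} ¬asc with out-or-in h | out-or-in (s⁺ h)
  ... | inj₂ i | inj₁ o = inj₁ (i , o)
  ... | inj₁ o | inj₂ i = ⊥-elim (¬asc (directed o i out-in))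
  ... | inj₁ o | inj₁ o′ with s⁺ h Fin.≟ root
  ... | yes p = inj₂ (inj₁ p)
  ... | no ¬p = ⊥-elim (¬asc (directed o o′
    (out-out (<ˣ⇒< (subst (λ k → vertex (α (s⁺ h)) <ˣ vertex (α k)) (s⁻s⁺ h)
      (outgoing-decrease (o′ , subst Out (sym (s⁻s⁺ h)) o) ¬p))))))
  descent {h} ¬asc | inj₂ i | inj₂ i′ with s⁺ h Fin.≟ sink
  ... | yes p = inj₂ (inj₂ p)
  ... | no ¬p = ⊥-elim (¬asc (directed i i′
    (in-in (<ˣ⇒< (subst (λ k → vertex (α h) <ˣ vertex (α (s⁺ k))) (α-involutive h)
      (incoming-increase (α-in i) (subst (In ∘ s⁺) (sym (α-involutive h)) i′)
        (λ eq → ¬p (trans (cong s⁺ (sym (α-involutive h))) eq))))))))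

  drawing : Drawing height orientation
  drawing = record
    { X              = xcoord ∘ vertex
    ; X-cong         = λ g∼h → cong xcoord (∼⇒≡ g∼h)
    ; X-reflects     = λ eq → ≡⇒∼ (xcoord-injective eq)
    ; X-onto         = λ i → rep (at i) , trans (cong xcoord (vertex-rep (at i))) (xcoord-at i)
    ; edge-cover     = λ o → ⟶⇒⋖ (edge⟶ o)
    ; cover-edge     = λ {i} {j} c → let h , o , a , b = ⋖⇒⟶ c in
        h , o , trans (cong xcoord a) (xcoord-at i) , trans (cong xcoord b) (xcoord-at j)
    ; edge-unique    = λ o o′ eq eq′ → parallel⇒≡ o o′ (xcoord-injective eq) (xcoord-injective eq′)
    ; descent-unique = λ eq a b → Descent-unique (xcoord-injective eq) (descent a) (descent b)
    ; root-descent   = root-descent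
    }
    where
    root-descent : ¬ Ascending (s⁻ root)
    -- The dart of greatest key at the source does not ascend, and of the three kinds of descent
    -- only the one before the root can occur there.
    root-descent with maximal (λ g h → key g ≺? key h) ≺-irrefl ≺-trans (λ h → vertex h Fin.≟ vs) (root , refl)
    ... | m , m-at , max with descent {m} (max (s⁺ m) (trans (vertex-s⁺ m) m-at))
    ... | inj₁ (i , _)    = ⊥-elim (out≢in (out-at-vs m-at) i)
    ... | inj₂ (inj₂ p)   = ⊥-elim (out≢in (out-at-vs m-at)
                              (in-at-vt (trans (sym (vertex-s⁺ m)) (cong vertex p))))
    ... | inj₂ (inj₁ p)   = subst (¬_ ∘ Ascending) (trans (sym (s⁻s⁺ m)) (cong s⁻ p))
                              (max (s⁺ m) (trans (vertex-s⁺ m) m-at))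

record PlaneDrawing (N : ℕ) (O : PlaneBipolarOrientation) : Set where
  field
    height           : Fin N → Fin N
    height-injective : ∀ {i j} → height i ≡ height j → i ≡ j
    height-plane     : PlaneFunction height
    lowest           : ∃ λ v → ∀ i → i ≢ v → Dominance._⊏_ height v i
    highest          : ∃ λ v → ∀ i → i ≢ v → Dominance._⊏_ height i v
    drawing          : Drawing height O

opaque
  planeDrawing : ∀ P {N} → PlaneBipolarPoset.#vertices P ≡ N →
                 PlaneDrawing N (PlaneBipolarPoset.orientation P)
  planeDrawing P size = record
    { height = height ; height-injective = height-injective ; height-plane = height-plane
    ; lowest = _ , height-vs ; highest = _ , height-vt ; drawing = drawing }
    where open PosetCoordinates P size

-- Uniqueness of drawings

module _ {N : ℕ} (y : Fin N → Fin N) where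
  open Dominance y

  ⊏? : ∀ i j → Dec (i ⊏ j)
  ⊏? i j = (i Fin.<? j) ×-dec (y i Fin.<? y j)

  last-cover : ∀ {i j} → i ⊏ j → i ⋖ j ⊎ ∃ λ k → i ⊏ k × k ⋖ j
  last-cover {i} {j} lt with Fin.any? (λ k → ⊏? i k ×-dec ⊏? k j)
  ... | no none = inj₁ (lt , λ k a b → none (k , a , b))
  ... | yes found with maximal (λ a b → ⊏? a b) ⊏-irrefl ⊏-trans (λ k → ⊏? i k ×-dec ⊏? k j) found
  ... | k , (a , b) , max = inj₂ (k , a , b , λ m c d → max m (⊏-trans a c , d) c)

module DrawingFacts {N : ℕ} {y : Fin N → Fin N} {O : PlaneBipolarOrientation} (D : Drawing y O) where
  open OrientationBasics O
  open VertexOrders O using (from-vs; to-vt)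
  open PlanarStructure O using (_⟶*_; ⟶*-split)
  open Drawing D
  open Dominance y

  X-s⁺ : ∀ h → X (s⁺ h) ≡ X h
  X-s⁺ h = X-cong (≡⇒∼ (vertex-s⁺ h))

  X-s⁻ : ∀ h → X (s⁻ h) ≡ X h
  X-s⁻ h = X-cong (≡⇒∼ (vertex-s⁻ h))

  key-injective : ∀ {g h} → X g ≡ X h → key g ≡ key h → g ≡ h
  key-injective {g} {h} eq eq′ with out-or-in g | out-or-in h
  ... | inj₁ o | inj₁ o′ = edge-unique o o′ eq (cong proj₂ eq′)
  ... | inj₁ o | inj₂ i  = ⊥-elim (out≢in (trans (sym (cong proj₁ eq′)) o) i)
  ... | inj₂ i | inj₁ o  = ⊥-elim (out≢in (trans (cong proj₁ eq′) o) i)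
  ... | inj₂ i | inj₂ i′ = trans (sym (α-involutive g)) (trans (cong α
    (edge-unique (α-in i) (α-in i′) (cong proj₂ eq′)
      (trans (cong X (α-involutive g)) (trans eq (cong X (sym (α-involutive h)))))))
    (α-involutive h))

  open CyclicOrder X key key-injective public

  -- A rotation of the fibers with a single descent in each is the cyclic
  -- successor for the order of the keys.
  descent⇒greatest : ∀ {h k} → ¬ Ascending h → X k ≡ X h → ¬ key h ≺ key k
  descent⇒greatest {h} {k} ¬asc eq
    with maximal (λ g h → key g ≺? key h) ≺-irrefl ≺-trans (λ g → X g Fin.≟ X h) (h , refl)
  ... | m , m-at , max with descent-unique m-at (max (s⁺ m) (trans (X-s⁺ m) m-at)) ¬asc
  ... | refl = max k eq

  -- Let `e` have the greatest key below that of `s⁺ h`. It ascends, as it is not the greatest dart.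
  -- If `s⁺ e` is `s⁺ h`, then `e` is `h`, which is too small; otherwise `s⁺ h` lies in the gap
  -- after `e`, the same situation with a larger dart.
  ascent-gap : ∀ {h k} → Ascending h → X k ≡ X h → key h ≺ key k → ¬ key k ≺ key (s⁺ h)
  ascent-gap {h} = go (≻ᵏ-wf h)
    where
    go : ∀ {h} → Acc (flip _≺ᵏ_) h → ∀ {k} → Ascending h → X k ≡ X h → key h ≺ key k → ¬ key k ≺ key (s⁺ h)
    go {h} (acc rs) {k} asc eq h<k k<h⁺
      with maximal (λ g h → key g ≺? key h) ≺-irrefl ≺-trans
             (λ g → (X g Fin.≟ X h) ×-dec (key g ≺? key (s⁺ h))) (k , eq , k<h⁺)
    ... | e , (e-at , e<h⁺) , max = conclude (key-connex (trans (X-s⁺ e) (trans e-at (sym (X-s⁺ h)))))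
      where
      h<e : key h ≺ key e
      h<e with key-connex (trans eq (sym e-at))
      ... | inj₁ k<e         = ≺-trans h<k k<e
      ... | inj₂ (inj₁ refl) = h<k
      ... | inj₂ (inj₂ e<k)  = ⊥-elim (max k (eq , k<h⁺) e<k)
      e-asc : Ascending e
      e-asc with key e ≺? key (s⁺ e)
      ... | yes p = p
      ... | no ¬p = ⊥-elim (descent⇒greatest ¬p (trans (X-s⁺ h) (sym e-at)) e<h⁺)
      conclude : key (s⁺ e) ≺ key (s⁺ h) ⊎ s⁺ e ≡ s⁺ h ⊎ key (s⁺ h) ≺ key (s⁺ e) → ⊥
      conclude (inj₁ lt) = max (s⁺ e) (trans (X-s⁺ e) e-at , lt) e-asc
      conclude (inj₂ (inj₁ same)) = ≺-irrefl (subst (λ z → key z ≺ key e) (sym (s⁺-injective same)) h<e)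
      conclude (inj₂ (inj₂ gt)) = go (rs h<e) e-asc (trans (X-s⁺ h) (sym e-at)) e<h⁺ gt

  descent⇒least : ∀ {h k} → ¬ Ascending h → X k ≡ X h → ¬ key k ≺ key (s⁺ h)
  descent⇒least {h} {k} ¬asc eq k<h⁺
    with maximal (λ g h → key h ≺? key g) ≺-irrefl (flip ≺-trans) (λ g → X g Fin.≟ X h) (h , refl)
  ... | e , e-at , min with descent-unique (trans (X-s⁻ e) e-at)
      (λ asc → min (s⁻ e) (trans (X-s⁻ e) e-at) (subst (λ z → key (s⁻ e) ≺ key z) (s⁺s⁻ e) asc)) ¬asc
  ... | refl = min k (trans eq e-at′) (subst (λ z → key k ≺ key z) (s⁺s⁻ e) k<h⁺)
    where
    e-at′ : X (s⁻ e) ≡ X (s⁻ e)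
    e-at′ = refl

  s⁺-next : ∀ h → Next h (s⁺ h)
  s⁺-next h with key h ≺? key (s⁺ h)
  ... | yes p = X-s⁺ h , inj₁ (p , λ g eq → ascent-gap p eq)
  ... | no ¬p =
      X-s⁺ h , inj₂ ((λ g eq → descent⇒greatest ¬p eq) , λ g eq → descent⇒least ¬p (trans eq (X-s⁺ h)))

  root-least : ∀ {k} → X k ≡ X root → ¬ key k ≺ key root
  root-least {k} eq lt = descent⇒least root-descent (trans eq (sym (X-s⁻ root)))
    (subst (λ z → key k ≺ key z) (sym (s⁺s⁻ root)) lt)

  pos : Vx → Fin N
  pos u = X (rep u)

  pos-vertex : ∀ h → pos (vertex h) ≡ X h
  pos-vertex h = X-cong (≡⇒∼ (vertex-rep _))

  pos-injective : ∀ {u v} → pos u ≡ pos v → u ≡ v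
  pos-injective eq = trans (sym (vertex-rep _)) (trans (∼⇒≡ (X-reflects eq)) (vertex-rep _))

  pos-onto : ∀ i → ∃ λ u → pos u ≡ i
  pos-onto i with X-onto i
  ... | h , eq = vertex h , trans (pos-vertex h) eq

  <-connex : ∀ u v → pos u <ᶠ pos v ⊎ u ≡ v ⊎ pos v <ᶠ pos u
  <-connex u v with Fin.<-cmp (pos u) (pos v)
  ... | tri< p _ _ = inj₁ p
  ... | tri≈ _ p _ = inj₂ (inj₁ (pos-injective p))
  ... | tri> _ _ p = inj₂ (inj₂ p)

  ⟶⇒⋖ : ∀ {u v} → u ⟶ v → pos u ⋖ pos v
  ⟶⇒⋖ (h , o , refl , refl) = subst₂ _⋖_ (sym (pos-vertex h)) (sym (pos-vertex (α h))) (edge-cover o)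

  ⋖⇒⟶ : ∀ {u v} → pos u ⋖ pos v → u ⟶ v
  ⋖⇒⟶ c with cover-edge c
  ... | h , o , a , b = h , o , pos-injective (trans (pos-vertex h) a) ,
                        pos-injective (trans (pos-vertex (α h)) b)

  ⟶⁺⇒⊏ : ∀ {u v} → u ⟶⁺ v → pos u ⊏ pos v
  ⟶⁺⇒⊏ [ e ]   = proj₁ (⟶⇒⋖ e)
  ⟶⁺⇒⊏ (e ∷ p) = ⊏-trans (proj₁ (⟶⇒⋖ e)) (⟶⁺⇒⊏ p)

  ⊏⇒⟶⁺ : ∀ {u v} → pos u ⊏ pos v → u ⟶⁺ v
  ⊏⇒⟶⁺ {u} {v} = go (FinI.<-wellFounded (pos v))
    where
    go : ∀ {v} → Acc _<ᶠ_ (pos v) → pos u ⊏ pos v → u ⟶⁺ v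
    go {v} (acc rs) lt with last-cover y lt
    ... | inj₁ c = [ ⋖⇒⟶ c ]
    ... | inj₂ (k , a , c) with pos-onto k
    ... | w , refl = TransClosure-snoc (go (rs (proj₁ (proj₁ c))) a) (⋖⇒⟶ c)

  -- Being to the left of `w` but not below it, `v` is at least as high as `w`, hence higher than
  -- `u`.
  lower : ∀ {u v w} → pos u <ᶠ pos v → pos v <ᶠ pos w → u ⟶⁺ w → ¬ v ⟶⁺ w → u ⟶⁺ v
  lower {u} {v} {w} u<v v<w p ¬q = ⊏⇒⟶⁺ (u<v , ℕ.<-≤-trans (proj₂ (⟶⁺⇒⊏ p))
    (ℕ.≮⇒≥ λ lt → ¬q (⊏⇒⟶⁺ (v<w , lt))))

  reach⇒≯ : ∀ {u v} → u ⟶* v → ¬ pos v <ᶠ pos u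
  reach⇒≯ p lt with ⟶*-split p
  ... | inj₁ refl = ℕ.<-irrefl refl lt
  ... | inj₂ q    = ℕ.<-asym lt (proj₁ (⟶⁺⇒⊏ q))

  vs-least : ∀ u → ¬ pos u <ᶠ pos vs
  vs-least u = reach⇒≯ (from-vs u)

  vt-greatest : ∀ u → ¬ pos vt <ᶠ pos u
  vt-greatest u = reach⇒≯ (to-vt u)

  LastIn : Dart → Set
  LastIn g = In g × Out (s⁺ g)

  lastIn-descent : ∀ {g} → LastIn g → ¬ Ascending g
  lastIn-descent {g} (i , o) asc with outgoing g | outgoing (s⁺ g) | asc
  lastIn-descent {g} (refl , refl) asc | _ | _ | ()

  -- The last incoming dart has the greatest key, so it comes from the rightmost lower neighbour;
  -- any other vertex below is to the left of some lower neighbour.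
  lastIn-parent : ∀ {g q} → LastIn g → q ⟶⁺ vertex g → toℕ (pos q) ℕ.≤ toℕ (pos (vertex (α g)))
  lastIn-parent {g} {q} l p = snoc-case p
    where
    last-step : ∀ {w} → w ⟶ vertex g → toℕ (pos w) ℕ.≤ toℕ (pos (vertex (α g)))
    last-step (h , o , refl , eq) = ℕ.≮⇒≥ λ lt → descent⇒greatest (lastIn-descent l)
      (X-cong (≡⇒∼ eq))
      (subst₂ (λ b b′ → (b , X (α g)) ≺ (b′ , X (α (α h)))) (sym (proj₁ l)) (sym (α-out o))
        (in-in (subst₂ _<ᶠ_ (pos-vertex (α g))
          (trans (pos-vertex h) (cong X (sym (α-involutive h)))) lt)))
    snoc-case : ∀ {q} → q ⟶⁺ vertex g → toℕ (pos q) ℕ.≤ toℕ (pos (vertex (α g)))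
    snoc-case [ e ]   = last-step e
    snoc-case (e ∷ p) = ℕ.≤-trans (ℕ.<⇒≤ (proj₁ (proj₁ (⟶⇒⋖ e)))) (snoc-case p)

-- The orientation drawn on a given point set

module Matching {N : ℕ} {y : Fin N → Fin N} {O O′ : PlaneBipolarOrientation}
                (D : Drawing y O) (D′ : Drawing y O′) where
  private
    module O = OrientationBasics O
    module O′ = OrientationBasics O′
    module D = Drawing D
    module D′ = Drawing D′
    module F = DrawingFacts D
    module F′ = DrawingFacts D′

  Match : O.Dart → O′.Dart → Set
  Match h h′ = D′.X h′ ≡ D.X h × D′.key h′ ≡ D.key h

  match : ∀ h → ∃ (Match h)
  match h with O.out-or-in h
  ... | inj₁ o with D′.cover-edge (D.edge-cover o)
  ... | h′ , o′ , a , b = h′ , a , cong₂ _,_ (trans o′ (sym o)) b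
  match h | inj₂ i with D′.cover-edge (D.edge-cover (O.α-in i))
  ... | h′ , o′ , a , b = O′.α h′ , trans b (cong D.X (O.α-involutive h)) ,
    cong₂ _,_ (trans (O′.α-out o′) (sym i)) (trans (cong D′.X (O′.α-involutive h′)) a)

  match-unique : ∀ {h h′ k′} → Match h h′ → Match h k′ → h′ ≡ k′
  match-unique (a , b) (a′ , b′) = F′.key-injective (trans a (sym a′)) (trans b (sym b′))

  match-α : ∀ {h h′} → Match h h′ → Match (O.α h) (O′.α h′)
  match-α {h} {h′} (a , b) = cong proj₂ b , cong₂ _,_
    (trans (O′.outgoing-α h′) (trans (cong not (cong proj₁ b)) (sym (O.outgoing-α h))))
    (trans (cong D′.X (O′.α-involutive h′)) (trans a (cong D.X (sym (O.α-involutive h)))))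

module _ {N : ℕ} {y : Fin N → Fin N} {O O′ : PlaneBipolarOrientation}
                (D : Drawing y O) (D′ : Drawing y O′) where
  private
    module O = OrientationBasics O
    module O′ = OrientationBasics O′
    module D = Drawing D
    module D′ = Drawing D′
    module F = DrawingFacts D
    module F′ = DrawingFacts D′
    module M = Matching D D′
    module M˘ = Matching D′ D

    to : O.Dart → O′.Dart
    to h = proj₁ (M.match h)
    from : O′.Dart → O.Dart
    from h = proj₁ (M˘.match h)

    match˘ : ∀ {h h′} → M.Match h h′ → M˘.Match h′ h
    match˘ (a , b) = sym a , sym b

    match-next : ∀ {h k h′ k′} → M.Match h h′ → M.Match k k′ → F.Next h k → F′.Next h′ k′
    match-next {h} {k} {h′} {k′} (a , b) (c , d) (eq , x) = trans c (trans eq (sym a)) , cases x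
      where
      back : ∀ {g′} → D′.X g′ ≡ D′.X h′ → D.X (from g′) ≡ D.X h
      back {g′} eq = trans (proj₁ (proj₂ (M˘.match g′))) (trans eq a)
      pull : ∀ {g′ l l′} → D′.key l′ ≡ D.key l → D′.key g′ ≺ D′.key l′ → D.key (from g′) ≺ D.key l
      pull {g′} eq lt = subst₂ _≺_ (sym (proj₂ (proj₂ (M˘.match g′)))) eq lt
      pull˘ : ∀ {g′ l l′} → D′.key l′ ≡ D.key l → D′.key l′ ≺ D′.key g′ → D.key l ≺ D.key (from g′)
      pull˘ {g′} eq lt = subst₂ _≺_ eq (sym (proj₂ (proj₂ (M˘.match g′)))) lt
      cases : _ → _
      cases (inj₁ (lt , none)) = inj₁ (subst₂ _≺_ (sym b) (sym d) lt ,
        λ g′ at p q → none (from g′) (back at) (pull˘ {g′} {h} {h′} b p) (pull {g′} {k} {k′} d q))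
      cases (inj₂ (top , bot)) = inj₂
        ((λ g′ at p → top (from g′) (back at) (pull˘ {g′} {h} {h′} b p)) ,
         (λ g′ at q → bot (from g′) (trans (proj₁ (proj₂ (M˘.match g′))) (trans at c)) (pull {g′} {k} {k′} d q)))

  -- On both sides the darts are the covers of one dominance order, each with a chosen end. The
  -- rotations agree as cyclic successors of the same keys, and the root is the dart of least key at
  -- the source.
  drawings⇒≅ : O ≅ O′
  drawings⇒≅ = record
    { bijection   = mk↔ₛ′ to from
        (λ h′ → M.match-unique (proj₂ (M.match (from h′))) (match˘˘ (proj₂ (M˘.match h′))))
        (λ h → M˘.match-unique (proj₂ (M˘.match (to h))) (match˘ (proj₂ (M.match h))))
    ; to-σ        = λ h → F′.next-functional
        (match-next (proj₂ (M.match h)) (proj₂ (M.match (O.s⁺ h))) (F.s⁺-next h)) (F′.s⁺-next (to h))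
    ; to-α        = λ h → M.match-unique (proj₂ (M.match (O.α h))) (M.match-α (proj₂ (M.match h)))
    ; to-root     = to-root
    ; to-outgoing = λ h → cong proj₁ (proj₂ (proj₂ (M.match h)))
    }
    where
    match˘˘ : ∀ {h h′} → M˘.Match h′ h → M.Match h h′
    match˘˘ (a , b) = sym a , sym b
    root-match = proj₂ (M.match O.root)
    source : O′.IsSource (to O.root)
    source h h∼ = trans (sym (cong proj₁ (proj₂ (proj₂ (M˘.match h)))))
      (O.root-source (from h) (D.X-reflects
        (trans (proj₁ (proj₂ (M˘.match h))) (trans (D′.X-cong h∼) (proj₁ root-match)))))
    to-root : to O.root ≡ O′.root
    to-root with F′.key-connex (D′.X-cong (O′.source-unique (to O.root) source))
    ... | inj₂ (inj₁ eq) = eq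
    ... | inj₁ lt = ⊥-elim (F′.root-least (D′.X-cong (O′.source-unique (to O.root) source)) lt)
    ... | inj₂ (inj₂ gt) = ⊥-elim (F.root-least
      (trans (proj₁ (proj₂ (M˘.match O′.root)))
        (trans (sym (D′.X-cong (O′.source-unique (to O.root) source))) (proj₁ root-match)))
      (subst₂ _≺_ (sym (proj₂ (proj₂ (M˘.match O′.root)))) (proj₂ root-match) gt))

-- The point set drawn by a given orientation

module _ {N : ℕ} {y y′ : Fin N → Fin N} {O : PlaneBipolarOrientation} (D : Drawing y O) (D′ : Drawing y′ O)
         (y-inj : ∀ {i j} → y i ≡ y j → i ≡ j) (y′-inj : ∀ {i j} → y′ i ≡ y′ j → i ≡ j) where
  open OrientationBasics O
  private
    module D = Drawing D
    module D′ = Drawing D′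
    module F = DrawingFacts D
    module F′ = DrawingFacts D′

    -- Both orders come from the same rotation, cut open after the same dart `d`; the induction
    -- replaces `k` by its predecessor.
    order-agrees : ∀ {d} → ¬ D.Ascending d → ¬ D′.Ascending d → ∀ {h k} → vertex h ≡ vertex d →
                   vertex k ≡ vertex d → D.key h ≺ D.key k → D′.key h ≺ D′.key k
    order-agrees {d} d-desc d-desc′ {h} {k} h-at = go (F′.≺ᵏ-wf k)
      where
      go : ∀ {k} → Acc F′._≺ᵏ_ k → vertex k ≡ vertex d → D.key h ≺ D.key k → D′.key h ≺ D′.key k
      go {k} (acc rs) k-at h<k = subst (λ z → D′.key h ≺ D′.key z) (s⁺s⁻ k)
          (conclude (F.key-connex (D.X-cong (≡⇒∼ (trans h-at (sym g-at))))))
        where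
        g = s⁻ k
        g-at : vertex g ≡ vertex d
        g-at = trans (vertex-s⁻ k) k-at
        h<g⁺ : D.key h ≺ D.key (s⁺ g)
        h<g⁺ = subst (λ z → D.key h ≺ D.key z) (sym (s⁺s⁻ k)) h<k
        asc : D.Ascending g
        asc with D.key g ≺? D.key (s⁺ g)
        ... | yes p = p
        ... | no ¬p = ⊥-elim (F.descent⇒least ¬p (D.X-cong (≡⇒∼ (trans h-at (sym g-at)))) h<g⁺)
        asc′ : D′.Ascending g
        asc′ with D′.key g ≺? D′.key (s⁺ g)
        ... | yes p = p
        ... | no ¬p = ⊥-elim (subst (¬_ ∘ D.Ascending)
          (D′.descent-unique (D′.X-cong (≡⇒∼ (sym g-at))) d-desc′ ¬p) d-desc asc)
        conclude : D.key h ≺ D.key g ⊎ h ≡ g ⊎ D.key g ≺ D.key h → D′.key h ≺ D′.key (s⁺ g)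
        conclude (inj₁ lt) = ≺-trans
          (go (rs (subst (λ z → D′.key g ≺ D′.key z) (s⁺s⁻ k) asc′)) g-at lt) asc′
        conclude (inj₂ (inj₁ refl)) = asc′
        conclude (inj₂ (inj₂ gt)) =
          ⊥-elim (F.ascent-gap asc (D.X-cong (≡⇒∼ (trans h-at (sym g-at)))) gt h<g⁺)

    -- The sink is left out: a drawing prescribes the break of the rotation only at the source, and
    -- at an inner vertex the turn from incoming to outgoing darts forces it.
    descent-at : ∀ u → u ≢ vt → ∃ λ d → vertex d ≡ u × ¬ D.Ascending d × ¬ D′.Ascending d
    descent-at u u≢vt with u Fin.≟ vs
    ... | yes refl = s⁻ root , vertex-s⁻ root , D.root-descent , D′.root-descent
    ... | no u≢vs with CornerUniqueness.side-at O u u≢vs u≢vt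
    ... | h , at , o , i = s⁻ h , trans (vertex-s⁻ h) at , F.lastIn-descent last , F′.lastIn-descent last
      where last = i , subst Out (sym (s⁺s⁻ h)) o

    parent : ∀ u → u ≢ vs → u ≢ vt → ∃ λ g → vertex g ≡ u × F.LastIn g
    parent u u≢vs u≢vt with CornerUniqueness.side-at O u u≢vs u≢vt
    ... | h , at , o , i = s⁻ h , trans (vertex-s⁻ h) at , i , subst Out (sym (s⁺s⁻ h)) o

    siblings : ∀ {g h} → In g → In h → vertex (α g) ≡ vertex (α h) →
               F.pos (vertex g) <ᶠ F.pos (vertex h) → ¬ F′.pos (vertex h) <ᶠ F′.pos (vertex g)
    siblings {g} {h} i i′ eq lt lt′ with descent-at (vertex (α g)) (λ at → out≢in (α-in i) (in-at-vt at))
    ... | d , d-at , desc , desc′ = ≺-irrefl (≺-trans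
        (order-agrees desc desc′ (trans (sym eq) (sym d-at)) (sym d-at)
          (out-keys D.X (subst₂ _<ᶠ_ (F.pos-vertex g) (F.pos-vertex h) lt) i i′))
        (out-keys D′.X (subst₂ _<ᶠ_ (F′.pos-vertex h) (F′.pos-vertex g) lt′) i′ i))
      where
      out-keys : (X : Dart → Fin N) → ∀ {g h} → X g <ᶠ X h → In g → In h →
                 (outgoing (α h) , X (α (α h))) ≺ (outgoing (α g) , X (α (α g)))
      out-keys X {g} {h} lt i i′ = subst₂ _≺_
        (cong₂ _,_ (sym (α-in i′)) (cong X (sym (α-involutive h))))
        (cong₂ _,_ (sym (α-in i)) (cong X (sym (α-involutive g)))) (out-out lt)

    -- A pair of vertices that the two drawings order differently, with leftmost
    -- positions, has a common parent; but siblings are ordered by the rotation.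
    no-discord : ∀ {u v} → Acc ℕ._<_ (toℕ (F.pos u) + toℕ (F.pos v)) →
                 F.pos u <ᶠ F.pos v → ¬ F′.pos v <ᶠ F′.pos u
    no-discord {u} {v} (acc rs) u<v v<′u
      with parent v (λ { refl → F.vs-least u u<v }) (λ { refl → F′.vt-greatest u v<′u })
         | parent u (λ { refl → F′.vs-least v v<′u }) (λ { refl → F.vt-greatest v u<v })
    ... | g , refl , last | g′ , refl , last′ = cases (F.<-connex p u) (F′.<-connex p′ v)
      where
      p = vertex (α g)
      p′ = vertex (α g′)
      pv : p ⟶⁺ v
      pv = [ edge⟶′ (proj₁ last) ]
      p′u : p′ ⟶⁺ u
      p′u = [ edge⟶′ (proj₁ last′) ]
      ¬uv : ¬ u ⟶⁺ v
      ¬uv q = ℕ.<-asym v<′u (proj₁ (F′.⟶⁺⇒⊏ q))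
      ¬vu : ¬ v ⟶⁺ u
      ¬vu q = ℕ.<-asym u<v (proj₁ (F.⟶⁺⇒⊏ q))
      p<v = proj₁ (F.⟶⁺⇒⊏ pv)
      p<′v = proj₁ (F′.⟶⁺⇒⊏ pv)
      p′<u = proj₁ (F.⟶⁺⇒⊏ p′u)
      p′<′u = proj₁ (F′.⟶⁺⇒⊏ p′u)
      cases : F.pos p <ᶠ F.pos u ⊎ p ≡ u ⊎ F.pos u <ᶠ F.pos p →
              F′.pos p′ <ᶠ F′.pos v ⊎ p′ ≡ v ⊎ F′.pos v <ᶠ F′.pos p′ → ⊥
      -- The pair `u`, `p` is ordered differently as well, and `p` is to the left of `v`, so the sum
      -- of positions drops.
      cases (inj₂ (inj₂ u<p)) _ =
        no-discord (rs (ℕ.+-monoʳ-< (toℕ (F.pos u)) p<v)) u<p (ℕ.<-trans p<′v v<′u)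
      cases (inj₂ (inj₁ eq)) _ = ¬uv (subst (_⟶⁺ v) eq pv)
      cases _ (inj₂ (inj₂ v<′p′)) =
        no-discord (rs (ℕ.+-monoˡ-< (toℕ (F.pos v)) p′<u)) (ℕ.<-trans p′<u u<v) v<′p′
      cases _ (inj₂ (inj₁ eq)) = ¬vu (subst (_⟶⁺ u) eq p′u)
      -- Now `p` is below `v` and to the left of `u`, which is not below `v`; hence `p` is below
      -- `u`, and likewise `p′` is below `v`. Each parent is the rightmost vertex below its child,
      -- so the two parents coincide.
      cases (inj₁ p<u) (inj₁ p′<′v) = siblings (proj₁ last′) (proj₁ last)
        (F.pos-injective (Fin.≤-antisym (F.lastIn-parent last p′v) (F.lastIn-parent last′ pu))) u<v v<′u
        where
        pu : p ⟶⁺ u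
        pu = F.lower p<u u<v pv ¬uv
        p′v : p′ ⟶⁺ v
        p′v = F′.lower p′<′v v<′u p′u ¬vu

    pos-mono : ∀ {u v} → F.pos u <ᶠ F.pos v → F′.pos u <ᶠ F′.pos v
    pos-mono {u} {v} lt with F′.<-connex u v
    ... | inj₁ p = p
    ... | inj₂ (inj₁ refl) = ⊥-elim (ℕ.<-irrefl refl lt)
    ... | inj₂ (inj₂ q) = ⊥-elim (no-discord (ℕI.<-wellFounded _) lt q)

    pos-agrees : ∀ u → F′.pos u ≡ F.pos u
    pos-agrees u = trans (cong F′.pos (F.pos-injective (sym (proj₂ (F.pos-onto (F.pos u))))))
      (monotone⇒id (λ i → F′.pos (proj₁ (F.pos-onto i)))
        (λ {i} {j} lt → pos-mono (subst₂ _<ᶠ_ (sym (proj₂ (F.pos-onto i))) (sym (proj₂ (F.pos-onto j))) lt))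
        (F.pos u))

    height-mono : ∀ {u v} → y (F.pos u) <ᶠ y (F.pos v) → y′ (F.pos u) <ᶠ y′ (F.pos v)
    height-mono {u} {v} lt with F.<-connex u v
    ... | inj₁ p = subst₂ (λ i j → y′ i <ᶠ y′ j) (pos-agrees u) (pos-agrees v)
                     (proj₂ (F′.⟶⁺⇒⊏ (F.⊏⇒⟶⁺ (p , lt))))
    ... | inj₂ (inj₁ refl) = ⊥-elim (ℕ.<-irrefl refl lt)
    ... | inj₂ (inj₂ q) = ℕ.≰⇒> λ le → ℕ.<-asym lt (proj₂ (F.⟶⁺⇒⊏ (F′.⊏⇒⟶⁺
      (subst₂ _<ᶠ_ (sym (pos-agrees v)) (sym (pos-agrees u)) q ,
       subst₂ (λ i j → y′ i <ᶠ y′ j) (sym (pos-agrees v)) (sym (pos-agrees u))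
         (ℕ.≤∧≢⇒< le λ eq → ℕ.<-irrefl (cong toℕ (y′-inj (Fin.toℕ-injective eq))) q)))))

  -- The abscissas agree and both height orders are recovered from reachability, so the map from the
  -- heights `y i` to the heights `y′ i` is monotone.
  drawings⇒≗ : ∀ i → y′ i ≡ y i
  drawings⇒≗ i = trans (cong y′ (y-inj (sym (y-y⁻¹ (y i)))))
    (monotone⇒id (λ j → y′ (y⁻¹ j)) mono (y i))
    where
    y⁻¹ : Fin N → Fin N
    y⁻¹ j = proj₁ (injective⇒surjective y y-inj j)
    y-y⁻¹ : ∀ j → y (y⁻¹ j) ≡ j
    y-y⁻¹ j = proj₂ (injective⇒surjective y y-inj j)
    mono : ∀ {i j} → i <ᶠ j → y′ (y⁻¹ i) <ᶠ y′ (y⁻¹ j)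
    mono {i} {j} lt with F.pos-onto (y⁻¹ i) | F.pos-onto (y⁻¹ j)
    ... | u , a | v , b = subst₂ (λ i j → y′ i <ᶠ y′ j) a b (height-mono
      (subst₂ (λ i j → y i <ᶠ y j) (sym a) (sym b) (subst₂ _<ᶠ_ (sym (y-y⁻¹ i)) (sym (y-y⁻¹ j)) lt)))

module _ {N : ℕ} {y : Fin N → Fin N} {O : PlaneBipolarOrientation} where
  open PlaneBipolarOrientation O

  drawing-≗ : ∀ {y′} → (∀ i → y i ≡ y′ i) → Drawing y O → Drawing y′ O
  drawing-≗ {y′} eq D = record
    { X              = X
    ; X-cong         = X-cong
    ; X-reflects     = X-reflects
    ; X-onto         = X-onto
    ; edge-cover     = λ o → cover eq (edge-cover o)
    ; cover-edge     = λ c → cover-edge (cover (sym ∘ eq) c)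
    ; edge-unique    = edge-unique
    ; descent-unique = descent-unique
    ; root-descent   = root-descent
    }
    where
    open Drawing D
    cover : ∀ {y y′ : Fin N → Fin N} → (∀ i → y i ≡ y′ i) → ∀ {i j} → Dominance._⋖_ y i j → Dominance._⋖_ y′ i j
    cover eq {i} {j} ((lt , lt′) , none) = (lt , subst₂ _<ᶠ_ (eq i) (eq j) lt′) , λ k a b →
      none k (proj₁ a , subst₂ _<ᶠ_ (sym (eq i)) (sym (eq k)) (proj₂ a))
             (proj₁ b , subst₂ _<ᶠ_ (sym (eq k)) (sym (eq j)) (proj₂ b))

  drawing-≅ : ∀ {O′} → O ≅ O′ → Drawing y O → Drawing y O′
  drawing-≅ {O′} iso D = record
    { X              = X ∘ from
    ; X-cong         = λ g∼h → X-cong (carry g∼h)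
    ; X-reflects     = λ {g} {h} eq → subst₂ O′._∼ᵛ_ (to-from g) (to-from h) (carry˘ (X-reflects eq))
    ; X-onto         = λ i → let h , eq = X-onto i in to h , trans (cong X (from-to h)) eq
    ; edge-cover     = λ {h} o → subst (Dominance._⋖_ y (X (from h)) ∘ X) (sym (from-α h))
                         (edge-cover (trans (from-outgoing h) o))
    ; cover-edge     = λ c → let h , o , a , b = cover-edge c in
        to h , trans (to-outgoing h) o , trans (cong X (from-to h)) a ,
        trans (cong X (trans (from-α (to h)) (cong α (from-to h)))) b
    ; edge-unique    = λ {g} {h} o o′ eq eq′ → from-injective (edge-unique
        (trans (from-outgoing g) o) (trans (from-outgoing h) o′) eq
        (trans (cong X (sym (from-α g))) (trans eq′ (cong X (from-α h)))))
    ; descent-unique = λ eq a b → from-injective (descent-unique eq (a ∘ asc) (b ∘ asc))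
    ; root-descent   = λ a → root-descent (subst Ascending
        (trans (sym (σ-cancel _)) (cong (σ ⟨$⟩ˡ_) (trans (sym (from-σ _)) (trans (cong from (σ′-cancel _)) from-root))))
        (asc˘ a))
    }
    where
    open Drawing D
    module O′ = PlaneBipolarOrientation O′
    module I = _≅_ (≅-sym {O} {O′} iso)
    open _≅_ iso
    to-from : ∀ h → to (from h) ≡ h
    to-from = Inverse.strictlyInverseˡ bijection
    from-to : ∀ h → from (to h) ≡ h
    from-to = Inverse.strictlyInverseʳ bijection
    from-injective : ∀ {g h} → from g ≡ from h → g ≡ h
    from-injective eq = trans (sym (to-from _)) (trans (cong to eq) (to-from _))
    from-σ : ∀ h → from (O′.σ ⟨$⟩ʳ h) ≡ σ ⟨$⟩ʳ from h
    from-σ = I.to-σ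
    from-α : ∀ h → from (O′.α h) ≡ α (from h)
    from-α = I.to-α
    from-root : from O′.root ≡ root
    from-root = I.to-root
    from-outgoing : ∀ h → outgoing (from h) ≡ O′.outgoing h
    from-outgoing = I.to-outgoing
    σ-cancel : ∀ h → σ ⟨$⟩ˡ (σ ⟨$⟩ʳ h) ≡ h
    σ-cancel = Inverse.strictlyInverseʳ σ
    σ′-cancel : ∀ h → O′.σ ⟨$⟩ʳ (O′.σ ⟨$⟩ˡ h) ≡ h
    σ′-cancel = Inverse.strictlyInverseˡ O′.σ
    carry : ∀ {g h} → g O′.∼ᵛ h → from g ∼ᵛ from h
    carry = EqClosure.gmap from (λ {g} eq → trans (sym (from-σ g)) (cong from eq))
    carry˘ : ∀ {g h} → g ∼ᵛ h → to g O′.∼ᵛ to h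
    carry˘ = EqClosure.gmap to (λ {g} eq → trans (sym (to-σ g)) (cong to eq))
    key′ : O′.Dart → Key N
    key′ h = O′.outgoing h , X (from (O′.α h))
    key-from : ∀ h → key (from h) ≡ key′ h
    key-from h = cong₂ _,_ (from-outgoing h) (cong X (sym (from-α h)))
    asc : ∀ {h} → Ascending (from h) → key′ h ≺ key′ (O′.σ ⟨$⟩ʳ h)
    asc {h} a = subst₂ _≺_ (key-from h) (trans (cong key (sym (from-σ h))) (key-from _)) a
    asc˘ : ∀ {h} → key′ h ≺ key′ (O′.σ ⟨$⟩ʳ h) → Ascending (from h)
    asc˘ {h} a = subst₂ _≺_ (sym (key-from h)) (trans (sym (key-from _)) (cong key (from-σ h))) a

-- Boundaries of faces in a dominance order

-- The two orders play symmetric roles, so that exchanging them turns a statement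
-- about left boundaries of faces into one about right boundaries.
record PlanarOrders (N : ℕ) : Set₁ where
  infix 4 _<₁_ _<₂_
  field
    _<₁_ _<₂_ : Rel (Fin N) 0ℓ
    <₁-irrefl : ∀ {a} → ¬ a <₁ a
    <₂-irrefl : ∀ {a} → ¬ a <₂ a
    <₁-trans  : Transitive _<₁_
    <₂-trans  : Transitive _<₂_
    <₁-connex : ∀ a b → a <₁ b ⊎ a ≡ b ⊎ b <₁ a
    <₂-connex : ∀ a b → a <₂ b ⊎ a ≡ b ⊎ b <₂ a
    -- An occurrence of 2143 whose central rectangle contains no point. Unlike the vincular form,
    -- this one is visibly symmetric in the two orders.
    no-2143   : ∀ {a b c d} → a <₁ b → b <₁ c → c <₁ d → b <₂ a → a <₂ d → d <₂ c →
                ¬ (∀ r → b <₁ r → r <₁ c → a <₂ r → ¬ r <₂ d)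

transpose : ∀ {N} → PlanarOrders N → PlanarOrders N
transpose P = record
  { _<₁_ = _<₂_ ; _<₂_ = _<₁_ ; <₁-irrefl = <₂-irrefl ; <₂-irrefl = <₁-irrefl
  ; <₁-trans = <₂-trans ; <₂-trans = <₁-trans ; <₁-connex = <₂-connex ; <₂-connex = <₁-connex
  ; no-2143 = λ a<b b<c c<d b<a a<d d<c none →
      no-2143 b<a a<d d<c a<b b<c c<d (λ r p q s t → none r s t p q) }
  where open PlanarOrders P

module Walks {N : ℕ} (P : PlanarOrders N) where
  open PlanarOrders P

  infix 4 _⊏_ _⋖_
  _⊏_ _⋖_ : Rel (Fin N) 0ℓ
  a ⊏ b = a <₁ b × a <₂ b
  a ⋖ b = a ⊏ b × (∀ k → a ⊏ k → ¬ k ⊏ b)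

  ⊏-irrefl : ∀ {a} → ¬ a ⊏ a
  ⊏-irrefl (p , _) = <₁-irrefl p

  ⊏-trans : Transitive _⊏_
  ⊏-trans (a , b) (c , d) = <₁-trans a c , <₂-trans b d

  <₁-dec : ∀ a b → Dec (a <₁ b)
  <₁-dec a b with <₁-connex a b
  ... | inj₁ p           = yes p
  ... | inj₂ (inj₁ refl) = no <₁-irrefl
  ... | inj₂ (inj₂ p)    = no λ q → <₁-irrefl (<₁-trans p q)

  <₂-dec : ∀ a b → Dec (a <₂ b)
  <₂-dec a b with <₂-connex a b
  ... | inj₁ p           = yes p
  ... | inj₂ (inj₁ refl) = no <₂-irrefl
  ... | inj₂ (inj₂ p)    = no λ q → <₂-irrefl (<₂-trans p q)

  ⊏-dec : ∀ a b → Dec (a ⊏ b)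
  ⊏-dec a b = <₁-dec a b ×-dec <₂-dec a b

  -- The covers of a point descend from left to right, so the lowest upper cover is also the
  -- rightmost one. With `<₁` read from left to right and `<₂` upwards, these are the rightmost
  -- edges into `a` and out of `z`; for the transposed orders they are the leftmost ones.
  MaxBelow MinAbove : Rel (Fin N) 0ℓ
  MaxBelow z a = z ⊏ a × (∀ q → q ⊏ a → ¬ z <₁ q)
  MinAbove a z = z ⊏ a × (∀ q → z ⊏ q → ¬ q <₂ a)

  maxBelow : ∀ {z a} → z ⊏ a → ∃ λ m → MaxBelow m a
  maxBelow {z} {a} p = maximal <₁-dec <₁-irrefl <₁-trans (λ m → ⊏-dec m a) (z , p)

  minAbove : ∀ {z a} → z ⊏ a → ∃ λ m → MinAbove m z
  minAbove {z} {a} p =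
    maximal (flip <₂-dec) <₂-irrefl (flip <₂-trans) (λ m → ⊏-dec z m) (a , p)

  maxBelow-cover : ∀ {z a} → MaxBelow z a → z ⋖ a
  maxBelow-cover (p , max) = p , λ k z⊏k k⊏a → max k k⊏a (proj₁ z⊏k)

  minAbove-cover : ∀ {a z} → MinAbove a z → z ⋖ a
  minAbove-cover (p , min) = p , λ k z⊏k k⊏a → min k z⊏k (proj₂ k⊏a)

  maxBelow-unique : ∀ {z z′ a} → MaxBelow z a → MaxBelow z′ a → z ≡ z′
  maxBelow-unique {z} {z′} (p , max) (p′ , max′) with <₁-connex z z′
  ... | inj₁ lt         = ⊥-elim (max _ p′ lt)
  ... | inj₂ (inj₁ eq)  = eq
  ... | inj₂ (inj₂ gt)  = ⊥-elim (max′ _ p gt)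

  minAbove-unique : ∀ {a a′ z} → MinAbove a z → MinAbove a′ z → a ≡ a′
  minAbove-unique {a} {a′} (p , min) (p′ , min′) with <₂-connex a a′
  ... | inj₁ lt         = ⊥-elim (min′ _ p lt)
  ... | inj₂ (inj₁ eq)  = eq
  ... | inj₂ (inj₂ gt)  = ⊥-elim (min _ p′ gt)

  covers-above : ∀ {z a b} → z ⋖ a → z ⋖ b → a <₁ b → b <₂ a
  covers-above {z} {a} {b} (p , none) (q , none′) lt with <₂-connex a b
  ... | inj₁ lt′          = ⊥-elim (none′ a p (lt , lt′))
  ... | inj₂ (inj₁ refl)  = ⊥-elim (<₁-irrefl lt)
  ... | inj₂ (inj₂ gt)    = gt

  covers-below : ∀ {z a b} → a ⋖ z → b ⋖ z → a <₁ b → b <₂ a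
  covers-below {z} {a} {b} (p , none) (q , none′) lt with <₂-connex a b
  ... | inj₁ lt′          = ⊥-elim (none b (lt , lt′) q)
  ... | inj₂ (inj₁ refl)  = ⊥-elim (<₁-irrefl lt)
  ... | inj₂ (inj₂ gt)    = gt

  cover-under : ∀ {i j} → i ⊏ j → i ⋖ j ⊎ ∃ λ k → i ⊏ k × k ⋖ j
  cover-under {i} {j} p with maximal <₁-dec <₁-irrefl <₁-trans (λ k → above-or-i k ×-dec ⊏-dec k j) (i , inj₁ refl , p)
    where
    above-or-i : ∀ k → Dec (i ≡ k ⊎ i ⊏ k)
    above-or-i k with <₁-connex i k | ⊏-dec i k
    ... | _                | yes q = yes (inj₂ q)
    ... | inj₂ (inj₁ eq)   | no _  = yes (inj₁ eq)
    ... | inj₁ lt          | no ¬q = no λ { (inj₁ refl) → <₁-irrefl lt ; (inj₂ q) → ¬q q }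
    ... | inj₂ (inj₂ gt)   | no ¬q = no λ { (inj₁ refl) → <₁-irrefl gt ; (inj₂ q) → ¬q q }
  ... | k , (inj₁ refl , q) , max = inj₁ (q , λ m a b → max m (inj₂ a , b) (proj₁ a))
  ... | k , (inj₂ i⊏k , q) , max =
      inj₂ (k , i⊏k , q , λ m a b → max m (inj₂ (⊏-trans i⊏k a) , b) (proj₁ a))

  -- Consecutive lower covers p and p′ of w, from left to right.
  record Corner (p p′ w : Fin N) : Set where
    field
      p⋖w   : p ⋖ w
      p′⋖w  : p′ ⋖ w
      p<p′  : p <₁ p′
      p′<p  : p′ <₂ p
      empty : ∀ q → p <₁ q → q <₁ p′ → p′ <₂ q → ¬ q <₂ p

  -- The invariant of the walk down the left boundary of the face below w.
  record Left (p p′ a : Fin N) : Set where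
    field
      a≤p   : a ≡ p ⊎ a ⊏ p
      a<p′  : a <₁ p′
      p′<a  : p′ <₂ a
      -- `sharp` pushes any point obstructing the next step into the rectangle of `Corner.empty`;
      -- `lower` ensures that the walk does not descend past a common lower bound of `p` and `p′`.
      sharp : ∀ q → a <₁ q → q <₂ a → p <₁ q
      lower : ∀ r → r ⊏ p → r ⊏ p′ → r ⊏ a

    below-p₂ : ∀ {q} → q <₂ a → q <₂ p
    below-p₂ lt with a≤p
    ... | inj₁ refl = lt
    ... | inj₂ p    = <₂-trans lt (proj₂ p)

    a<₁ : ∀ {q} → p <₁ q → a <₁ q
    a<₁ lt with a≤p
    ... | inj₁ refl = lt
    ... | inj₂ p    = <₁-trans (proj₁ p) lt

  module _ {p p′ w} (C : Corner p p′ w) where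
    open Corner C

    start : MinAbove w p × Left p p′ p
    start = (proj₁ p⋖w , least) , record
      { a≤p = inj₁ refl ; a<p′ = p<p′ ; p′<a = p′<p ; sharp = λ _ lt _ → lt ; lower = λ _ r _ → r }
      where
      least : ∀ q → p ⊏ q → ¬ q <₂ w
      least q p⊏q q<w with <₁-connex q w
      ... | inj₁ lt          = proj₂ p⋖w q p⊏q (lt , q<w)
      ... | inj₂ (inj₁ refl) = <₂-irrefl q<w
      -- The points `p`, `p′`, `w`, `q` form a 2143; a point in its centre would lie between `p′`
      -- and its cover `w`.
      ... | inj₂ (inj₂ w<q)  = no-2143 p<p′ (proj₁ (proj₁ p′⋖w)) w<q p′<p (proj₂ p⊏q) q<w
        λ r p′<r r<w p<r r<q → proj₂ p′⋖w r (p′<r , <₂-trans p′<p p<r) (r<w , <₂-trans r<q q<w)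

    -- Down the rightmost lower cover, either the walk comes below `p′`, where the face closes, or
    -- the edge is also the rightmost one out of `z`, so the face continues along it. A lower point
    -- above `z` would lie in the empty rectangle, below the cover `w` of `p′`, or in a 2143 with
    -- `z`, `p′` and `w`.
    step : ∀ {z a} → Left p p′ a → MaxBelow z a → z ⊏ p′ ⊎ (MinAbove a z × Left p p′ z)
    step {z} {a} L (z⊏a , max) with <₂-connex z p′
    ... | inj₁ lt          = inj₁ (<₁-trans (proj₁ z⊏a) a<p′ , lt)
      where open Left L
    ... | inj₂ (inj₁ refl) = ⊥-elim (<₁-irrefl (<₁-trans (proj₁ z⊏a) (Left.a<p′ L)))
    ... | inj₂ (inj₂ p′<z) = inj₂ ((z⊏a , least) , record
      { a≤p = inj₂ z⊏p ; a<p′ = z<p′ ; p′<a = p′<z ; sharp = sharp′ ; lower = lower′ })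
      where
      open Left L
      z⊏p : z ⊏ p
      z⊏p with a≤p
      ... | inj₁ refl = z⊏a
      ... | inj₂ q    = ⊏-trans z⊏a q
      z<p′ : z <₁ p′
      z<p′ = <₁-trans (proj₁ z⊏a) a<p′
      least : ∀ q → z ⊏ q → ¬ q <₂ a
      least q (z<q , z<₂q) q<a with <₁-connex q a
      ... | inj₁ lt          = max q (lt , q<a) z<q
      ... | inj₂ (inj₁ refl) = <₂-irrefl q<a
      ... | inj₂ (inj₂ a<q) with <₁-connex q p′
      ... | inj₁ q<p′        = empty q (sharp q a<q q<a) q<p′ (<₂-trans p′<z z<₂q) (below-p₂ q<a)
      ... | inj₂ (inj₁ refl) = <₂-irrefl (<₂-trans p′<z z<₂q)
      ... | inj₂ (inj₂ p′<q) with <₁-connex q w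
      ... | inj₁ q<w         = proj₂ p′⋖w q (p′<q , <₂-trans p′<z z<₂q)
                                 (q<w , <₂-trans (below-p₂ q<a) (proj₂ (proj₁ p⋖w)))
      ... | inj₂ (inj₁ refl) = <₂-irrefl (<₂-trans (below-p₂ q<a) (proj₂ (proj₁ p⋖w)))
      ... | inj₂ (inj₂ w<q)  = no-2143 z<p′ (proj₁ (proj₁ p′⋖w)) w<q p′<z z<₂q q<w
        λ r p′<r r<w z<r r<q → proj₂ p′⋖w r (p′<r , <₂-trans p′<z z<r) (r<w , <₂-trans r<q q<w)
        where
        q<w : q <₂ w
        q<w = <₂-trans (below-p₂ q<a) (proj₂ (proj₁ p⋖w))
      sharp′ : ∀ q → z <₁ q → q <₂ z → p <₁ q
      sharp′ q z<q q<z with <₁-connex q a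
      ... | inj₁ lt          = ⊥-elim (max q (lt , <₂-trans q<z (proj₂ z⊏a)) z<q)
      ... | inj₂ (inj₁ refl) = ⊥-elim (<₂-irrefl (<₂-trans q<z (proj₂ z⊏a)))
      ... | inj₂ (inj₂ a<q)  = sharp q a<q (<₂-trans q<z (proj₂ z⊏a))
      lower′ : ∀ r → r ⊏ p → r ⊏ p′ → r ⊏ z
      lower′ r r⊏p r⊏p′ with <₁-connex r z
      ... | inj₁ lt          = lt , <₂-trans (proj₂ r⊏p′) p′<z
      ... | inj₂ (inj₁ refl) = ⊥-elim (<₂-irrefl (<₂-trans (proj₂ r⊏p′) p′<z))
      ... | inj₂ (inj₂ gt)   = ⊥-elim (max r (lower r r⊏p r⊏p′) gt)

  -- The first edge of the left boundary, counted upwards: `z` is the lowest point of the face.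
  record End (p p′ z a : Fin N) : Set where
    field
      left : Left p p′ a
      max  : MaxBelow z a
      z⊏p′ : z ⊏ p′

    ¬least : ¬ MinAbove a z
    ¬least (_ , min) = min p′ z⊏p′ (Left.p′<a left)

    z⊏p : z ⊏ p
    z⊏p with Left.a≤p left
    ... | inj₁ refl = proj₁ max
    ... | inj₂ q    = ⊏-trans (proj₁ max) q

    greatest : ∀ r → r ⊏ p → r ⊏ p′ → ¬ z <₁ r
    greatest r r⊏p r⊏p′ = proj₂ max r (Left.lower left r r⊏p r⊏p′)

  -- No point is lower and further to the right, so `a` is on the border of the drawing, and the
  -- walk down from it follows the border.
  Outer : Fin N → Set
  Outer a = ∀ q → a <₁ q → a <₂ q

  outer-step : ∀ {z a} → Outer a → MaxBelow z a → MinAbove a z × Outer z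
  outer-step {z} {a} out (z⊏a , max) = (z⊏a , least) , out′
    where
    least : ∀ q → z ⊏ q → ¬ q <₂ a
    least q z⊏q q<a with <₁-connex q a
    ... | inj₁ lt          = max q (lt , q<a) (proj₁ z⊏q)
    ... | inj₂ (inj₁ refl) = <₂-irrefl q<a
    ... | inj₂ (inj₂ gt)   = <₂-irrefl (<₂-trans q<a (out q gt))
    out′ : Outer z
    out′ q z<q with <₂-connex z q
    ... | inj₁ lt          = lt
    ... | inj₂ (inj₁ refl) = ⊥-elim (<₁-irrefl z<q)
    ... | inj₂ (inj₂ q<z) with <₁-connex q a
    ... | inj₁ lt          = ⊥-elim (max q (lt , <₂-trans q<z (proj₂ z⊏a)) z<q)
    ... | inj₂ (inj₁ refl) = proj₂ z⊏a
    ... | inj₂ (inj₂ gt)   = <₂-trans (proj₂ z⊏a) (out q gt)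

module Meeting {N : ℕ} (P : PlanarOrders N) where
  open PlanarOrders P
  open Walks P
  private module R = Walks (transpose P)

  corner-transpose : ∀ {p p′ w} → Corner p p′ w → R.Corner p′ p w
  corner-transpose C = record
    { p⋖w = cover p′⋖w ; p′⋖w = cover p⋖w ; p<p′ = p′<p ; p′<p = p<p′
    ; empty = λ q a b c d → empty q c d a b }
    where
    open Corner C
    cover : ∀ {a b} → a ⋖ b → a R.⋖ b
    cover (p , none) = swap p , λ k x y → none k (swap x) (swap y)

  module _ {p p′ w z a z′ a′} (C : Corner p p′ w) (E : End p p′ z a) (E′ : R.End p′ p z′ a′) where
    private
      module E = End E
      module E′ = R.End E′
      module C = Corner C

    -- Each walk stops at the common lower bound of `p` and `p′` that is extreme in its own order.
    -- If the two differed, `z′`, `z`, `p`, `p′` would form a 2143, and a point in its centre would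
    -- be a common lower bound further along.
    meet : z ≡ z′
    meet with <₁-connex z z′ | <₂-connex z z′
    ... | inj₂ (inj₁ eq) | _              = eq
    ... | _              | inj₂ (inj₁ eq) = eq
    ... | inj₁ lt        | _              = ⊥-elim (E.greatest z′ (swap E′.z⊏p′) (swap E′.z⊏p) lt)
    ... | _              | inj₂ (inj₂ gt) = ⊥-elim (E′.greatest z (swap E.z⊏p′) (swap E.z⊏p) gt)
    ... | inj₂ (inj₂ gt) | inj₁ lt        = ⊥-elim (no-2143 gt (proj₁ E.z⊏p) C.p<p′ lt (proj₁ E′.z⊏p) C.p′<p
      λ r z<r r<p z′<r r<p′ → E.greatest r (r<p , <₂-trans r<p′ C.p′<p) (<₁-trans r<p C.p<p′ , r<p′) z<r)

    ends-ordered : a <₁ a′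
    ends-ordered = Left.a<₁ E.left (R.Left.p′<a E′.left)

    -- A cover of `z` between the two ends would fall into the empty rectangle between `p` and `p′`.
    ends-consecutive : ∀ q → z ⋖ q → a <₁ q → ¬ q <₁ a′
    ends-consecutive q c a<q q<a′ =
      C.empty q (Left.sharp E.left q a<q q<a)
        (R.Left.below-p₂ E′.left q<a′)
        (R.Left.sharp E′.left q a′<q q<a′)
        (Left.below-p₂ E.left q<a)
      where
      q<a : q <₂ a
      q<a = covers-above (maxBelow-cover E.max) c a<q
      a′<q : a′ <₂ q
      a′<q with R.maxBelow-cover E′.max
      ... | z′⊏a′ , none = covers-above c
        (subst (_⋖ a′) (sym meet) (swap z′⊏a′ , λ k x y → none k (swap x) (swap y))) q<a′

-- Hasse diagrams of plane permutations

module PlaneOrders {N : ℕ} (y : Fin N → Fin N) (y-inj : ∀ {i j} → y i ≡ y j → i ≡ j)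
                   (plane : PlaneFunction y) where

  <-connex : ∀ (i j : Fin N) → i <ᶠ j ⊎ i ≡ j ⊎ j <ᶠ i
  <-connex i j with Fin.<-cmp i j
  ... | tri< p _ _ = inj₁ p
  ... | tri≈ _ p _ = inj₂ (inj₁ p)
  ... | tri> _ _ p = inj₂ (inj₂ p)

  height-connex : ∀ i j → y i <ᶠ y j ⊎ i ≡ j ⊎ y j <ᶠ y i
  height-connex i j with <-connex (y i) (y j)
  ... | inj₁ p        = inj₁ p
  ... | inj₂ (inj₁ p) = inj₂ (inj₁ (y-inj p))
  ... | inj₂ (inj₂ p) = inj₂ (inj₂ p)

  -- Scanning from b to c, the values below that of a are followed by values
  -- above that of d; the change occurs between adjacent positions.
  no-2143 : ∀ {a b c d} → a <ᶠ b → b <ᶠ c → c <ᶠ d → y b <ᶠ y a → y a <ᶠ y d → y d <ᶠ y c →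
            ¬ (∀ r → b <ᶠ r → r <ᶠ c → y a <ᶠ y r → ¬ y r <ᶠ y d)
  no-2143 {a} {b} {c} {d} a<b b<c c<d b<a a<d d<c none =
    scan b (FinI.>-wellFounded b) (inj₁ refl) a<b b<c b<a
    where
    scan : ∀ j → Acc (flip _<ᶠ_) j → b ≡ j ⊎ b <ᶠ j → a <ᶠ j → j <ᶠ c → y j <ᶠ y a → ⊥
    scan j (acc rs) b≤j a<j j<c j<a = at-next (<-connex j′ c)
      where
      j′ = fromℕ< (ℕ.≤-<-trans j<c (Fin.toℕ<n c))
      j′≡ : toℕ j′ ≡ suc (toℕ j)
      j′≡ = Fin.toℕ-fromℕ< _
      j<j′ : j <ᶠ j′
      j<j′ = ℕ.≤-reflexive (sym j′≡)
      b<j′ : b <ᶠ j′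
      b<j′ = [ (λ eq → subst (_<ᶠ j′) (sym eq) j<j′) , (λ lt → ℕ.<-trans lt j<j′) ]′ b≤j
      at-next : j′ <ᶠ c ⊎ j′ ≡ c ⊎ c <ᶠ j′ → ⊥
      at-next (inj₂ (inj₂ c<j′)) = ℕ.<⇒≱ c<j′ (subst (ℕ._≤ toℕ c) (sym j′≡) j<c)
      at-next (inj₂ (inj₁ eq))   = plane a j j′ d a<j j′≡ (subst (_<ᶠ d) (sym eq) c<d) j<a a<d
                                     (subst (λ z → y d <ᶠ y z) (sym eq) d<c)
      at-next (inj₁ j′<c) with height-connex j′ a | height-connex j′ d
      ... | inj₁ j′<a        | _ =
          scan j′ (rs j<j′) (inj₂ b<j′) (ℕ.<-trans a<j j<j′) j′<c j′<a
      ... | inj₂ (inj₁ eq)   | _                = ℕ.<-irrefl (cong toℕ (sym eq)) (ℕ.<-trans a<j j<j′)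
      ... | inj₂ (inj₂ a<j′) | inj₁ j′<d        = none j′ b<j′ j′<c a<j′ j′<d
      ... | _                | inj₂ (inj₁ eq)   = ℕ.<-irrefl (cong toℕ eq) (ℕ.<-trans j′<c c<d)
      ... | _                | inj₂ (inj₂ d<j′) = plane a j j′ d a<j j′≡ (ℕ.<-trans j′<c c<d) j<a a<d d<j′

  orders : PlanarOrders N
  orders = record
    { _<₁_ = _<ᶠ_ ; _<₂_ = λ i j → y i <ᶠ y j
    ; <₁-irrefl = ℕ.<-irrefl refl ; <₂-irrefl = ℕ.<-irrefl refl
    ; <₁-trans = ℕ.<-trans ; <₂-trans = ℕ.<-trans
    ; <₁-connex = <-connex ; <₂-connex = height-connex
    ; no-2143 = no-2143 }

module HasseDiagram {n : ℕ} (y : Fin (suc (suc n)) → Fin (suc (suc n))) (y-inj : ∀ {i j} → y i ≡ y j → i ≡ j)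
                    (plane : PlaneFunction y) (y-zero : y zero ≡ zero)
                    (y-top : y (fromℕ (suc n)) ≡ fromℕ (suc n)) where

  N : ℕ
  N = suc (suc n)

  open PlaneOrders y y-inj plane
  module L = Walks orders
  module R = Walks (transpose orders)
  module M = Meeting orders
  open L using (_⊏_; _⋖_; ⊏-irrefl; ⊏-trans)

  top : Fin N
  top = fromℕ (suc n)

  below-top : ∀ {i} → i ≢ top → i <ᶠ top
  below-top {i} i≢ = ℕ.≤∧≢⇒< (Fin.≤fromℕ i) (i≢ ∘ Fin.toℕ-injective)

  above-zero : ∀ {i : Fin N} → i ≢ zero → zero {suc n} <ᶠ i
  above-zero {zero}  i≢ = ⊥-elim (i≢ refl)
  above-zero {suc i} i≢ = s≤s z≤n

  zero⊏ : ∀ {i} → i ≢ zero → zero ⊏ i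
  zero⊏ {i} i≢ = above-zero i≢ , subst (_<ᶠ y i) (sym y-zero)
    (above-zero (λ eq → i≢ (y-inj (trans eq (sym y-zero)))))

  ⊏top : ∀ {i} → i ≢ top → i ⊏ top
  ⊏top {i} i≢ = below-top i≢ , subst (y i <ᶠ_) (sym y-top)
    (below-top (λ eq → i≢ (y-inj (trans eq (sym y-top)))))

  ≮zero : ∀ {i : Fin N} → ¬ i <ᶠ zero {suc n}
  ≮zero ()

  y≮zero : ∀ {i} → ¬ y i <ᶠ y zero
  y≮zero {i} lt = ≮zero {y i} (subst (y i <ᶠ_) y-zero lt)

  top≮ : ∀ {i : Fin N} → ¬ top <ᶠ i
  top≮ {i} lt = ℕ.<⇒≱ lt (Fin.≤fromℕ i)

  ytop≮ : ∀ {i} → ¬ y top <ᶠ y i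
  ytop≮ {i} lt = top≮ (subst (_<ᶠ y i) y-top lt)

  below⇒≢zero : ∀ {i j} → i ⊏ j → j ≢ zero
  below⇒≢zero {i} (lt , _) refl = ≮zero {i} lt

  above⇒≢top : ∀ {i j} → i ⊏ j → i ≢ top
  above⇒≢top {j = j} (lt , _) refl = top≮ {j} lt

  cover? : ∀ (ij : Fin N × Fin N) → Dec (proj₁ ij ⋖ proj₂ ij)
  cover? (i , j) = L.⊏-dec i j ×-dec Fin.all? (λ k → L.⊏-dec i k →-dec ¬? (L.⊏-dec k j))

  Covers : Setoid 0ℓ 0ℓ
  Covers = record
    { Carrier       = Σ (Fin N × Fin N) (λ ij → proj₁ ij ⋖ proj₂ ij)
    ; isEquivalence = On.isEquivalence proj₁ isEquivalence }

  opaque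
    covers-finite : ∃ (HasCardinality Covers)
    covers-finite = enumerated⇒cardinality Covers (λ c d → ≡-dec Fin._≟_ Fin._≟_ (proj₁ c) (proj₁ d))
      (satisfying cover? (cartesianProduct (allFin N) (allFin N)))
      (λ c → satisfying-complete cover? (proj₂ c)
        (∈-cartesianProduct⁺ (∈-allFin (proj₁ (proj₁ c))) (∈-allFin (proj₂ (proj₁ c)))))

  E : ℕ
  E = proj₁ covers-finite

  private module C = Inverse (proj₂ covers-finite)

  lo hi : Fin E → Fin N
  lo e = proj₁ (proj₁ (C.from e))
  hi e = proj₂ (proj₁ (C.from e))

  edge-cover : ∀ e → lo e ⋖ hi e
  edge-cover e = proj₂ (C.from e)

  edge-⊏ : ∀ e → lo e ⊏ hi e
  edge-⊏ e = proj₁ (edge-cover e)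

  edge : ∀ {i j} → i ⋖ j → ∃ λ e → lo e ≡ i × hi e ≡ j
  edge c = C.to (_ , c) , cong proj₁ (C.strictlyInverseʳ (_ , c)) , cong proj₂ (C.strictlyInverseʳ (_ , c))

  edge-injective : ∀ {e e′} → lo e ≡ lo e′ → hi e ≡ hi e′ → e ≡ e′
  edge-injective eq eq′ = trans (sym (C.strictlyInverseˡ _))
    (trans (C.to-cong (cong₂ _,_ eq eq′)) (C.strictlyInverseˡ _))

  D : Set
  D = Fin (E + E)

  out inn : Fin E → D
  out e = e ↑ˡ E
  inn e = E ↑ʳ e

  data View : D → Set where
    outᵛ : ∀ e → View (out e)
    innᵛ : ∀ e → View (inn e)

  dartView : ∀ d → View d
  dartView d with splitAt E d in eq
  ... | inj₁ e = subst View (Fin.splitAt⁻¹-↑ˡ eq) (outᵛ e)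
  ... | inj₂ e = subst View (Fin.splitAt⁻¹-↑ʳ eq) (innᵛ e)

  X : D → Fin N
  X = [ lo , hi ]′ ∘ splitAt E

  outgoing : D → Bool
  outgoing = [ (λ _ → true) , (λ _ → false) ]′ ∘ splitAt E

  α : D → D
  α = [ inn , out ]′ ∘ splitAt E

  key : D → Key N
  key d = outgoing d , X (α d)

  X-out : ∀ e → X (out e) ≡ lo e
  X-out e = cong [ lo , hi ]′ (Fin.splitAt-↑ˡ E e E)
  X-inn : ∀ e → X (inn e) ≡ hi e
  X-inn e = cong [ lo , hi ]′ (Fin.splitAt-↑ʳ E E e)
  outgoing-out : ∀ e → outgoing (out e) ≡ true
  outgoing-out e = cong [ (λ _ → true) , (λ _ → false) ]′ (Fin.splitAt-↑ˡ E e E)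
  outgoing-inn : ∀ e → outgoing (inn e) ≡ false
  outgoing-inn e = cong [ (λ _ → true) , (λ _ → false) ]′ (Fin.splitAt-↑ʳ E E e)
  α-out : ∀ e → α (out e) ≡ inn e
  α-out e = cong [ inn , out ]′ (Fin.splitAt-↑ˡ E e E)
  α-inn : ∀ e → α (inn e) ≡ out e
  α-inn e = cong [ inn , out ]′ (Fin.splitAt-↑ʳ E E e)
  key-out : ∀ e → key (out e) ≡ (true , hi e)
  key-out e = cong₂ _,_ (outgoing-out e) (trans (cong X (α-out e)) (X-inn e))
  key-inn : ∀ e → key (inn e) ≡ (false , lo e)
  key-inn e = cong₂ _,_ (outgoing-inn e) (trans (cong X (α-inn e)) (X-out e))

  out-injective : ∀ {e e′} → out e ≡ out e′ → e ≡ e′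
  out-injective {e} {e′} = Fin.↑ˡ-injective E e e′
  inn-injective : ∀ {e e′} → inn e ≡ inn e′ → e ≡ e′
  inn-injective {e} {e′} = Fin.↑ʳ-injective E e e′
  out≢inn : ∀ {e e′} → out e ≢ inn e′
  out≢inn {e} {e′} eq with trans (sym (outgoing-out e)) (trans (cong outgoing eq) (outgoing-inn e′))
  ... | ()

  α-involutive : ∀ d → α (α d) ≡ d
  α-involutive d with dartView d
  ... | outᵛ e = trans (cong α (α-out e)) (α-inn e)
  ... | innᵛ e = trans (cong α (α-inn e)) (α-out e)

  α-fixfree : ∀ d → α d ≢ d
  α-fixfree d eq with dartView d
  ... | outᵛ e = out≢inn (trans (sym eq) (α-out e))
  ... | innᵛ e = out≢inn (trans (sym (α-inn e)) eq)

  outgoing-α : ∀ d → outgoing (α d) ≡ not (outgoing d)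
  outgoing-α d with dartView d
  ... | outᵛ e = trans (cong outgoing (α-out e)) (trans (outgoing-inn e) (cong not (sym (outgoing-out e))))
  ... | innᵛ e = trans (cong outgoing (α-inn e)) (trans (outgoing-out e) (cong not (sym (outgoing-inn e))))

  key-injective : ∀ {g h} → X g ≡ X h → key g ≡ key h → g ≡ h
  key-injective {g} {h} eq eq′ with dartView g | dartView h
  ... | outᵛ e | outᵛ e′ = cong out (edge-injective (trans (sym (X-out e)) (trans eq (X-out e′)))
        (cong proj₂ (trans (sym (key-out e)) (trans eq′ (key-out e′)))))
  ... | innᵛ e | innᵛ e′ = cong inn (edge-injective
        (cong proj₂ (trans (sym (key-inn e)) (trans eq′ (key-inn e′))))
        (trans (sym (X-inn e)) (trans eq (X-inn e′))))
  ... | outᵛ e | innᵛ e′ with cong proj₁ (trans (sym (key-out e)) (trans eq′ (key-inn e′)))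
  ... | ()
  key-injective {g} {h} eq eq′ | innᵛ e | outᵛ e′ with cong proj₁ (trans (sym (key-inn e)) (trans eq′ (key-out e′)))
  ... | ()

  open CyclicOrder X key key-injective

  opaque
    successor : Σ (Permutation′ (E + E)) λ σ → ∀ d → σ ⟨$⟩ʳ d ≡ proj₁ (next d)
    successor = injective⇒permutation (proj₁ ∘ next) λ {x} {x′} eq →
      next-injective (proj₂ (next x)) (subst (Next x′) (sym eq) (proj₂ (next x′)))

  σ : Permutation′ (E + E)
  σ = proj₁ successor

  s⁺ : D → D
  s⁺ d = σ ⟨$⟩ʳ d

  s⁺-next : ∀ d → Next d (s⁺ d)
  s⁺-next d = subst (Next d) (sym (proj₂ successor d)) (proj₂ (next d))

  next⇒s⁺ : ∀ {d d′} → Next d d′ → s⁺ d ≡ d′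
  next⇒s⁺ = next-functional (s⁺-next _)

  X-s⁺ : ∀ d → X (s⁺ d) ≡ X d
  X-s⁺ d = proj₁ (s⁺-next d)

  φ : D → D
  φ d = s⁺ (α d)

  φ-out : ∀ e → φ (out e) ≡ s⁺ (inn e)
  φ-out e = cong s⁺ (α-out e)
  φ-inn : ∀ e → φ (inn e) ≡ s⁺ (out e)
  φ-inn e = cong s⁺ (α-inn e)

  _∼ᵛ_ _∼ᶠ_ : Rel D 0ℓ
  _∼ᵛ_ = EqClosure (λ g h → s⁺ g ≡ h)
  _∼ᶠ_ = EqClosure (λ g h → φ g ≡ h)

  module Vertices = Setoid (Orbits s⁺)
  module Faces = Setoid (Orbits φ)

  ∼ᵛ⇒≡ : ∀ {g h} → g ∼ᵛ h → X g ≡ X h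
  ∼ᵛ⇒≡ = orbit-invariant X X-s⁺

  to-greatest : ∀ d → ∃ λ g → d ∼ᵛ g × Greatest g
  to-greatest d = go d (≻ᵏ-wf d)
    where
    go : ∀ d → Acc (flip _≺ᵏ_) d → ∃ λ g → d ∼ᵛ g × Greatest g
    go d (acc rs) with s⁺-next d
    ... | _ , inj₂ (top , _) = d , Vertices.refl , top
    ... | _ , inj₁ (lt , _) with go (s⁺ d) (rs lt)
    ... | g , ∼ , top = g , Vertices.trans (EqClosure.return refl) ∼ , top

  ≡⇒∼ᵛ : ∀ {g h} → X g ≡ X h → g ∼ᵛ h
  ≡⇒∼ᵛ {g} {h} eq with to-greatest g | to-greatest h
  ... | g′ , g∼ , g-top | h′ , h∼ , h-top
    with key-connex {g′} {h′} (trans (sym (∼ᵛ⇒≡ g∼)) (trans eq (∼ᵛ⇒≡ h∼)))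
  ... | inj₁ lt          = ⊥-elim (g-top h′ (trans (sym (∼ᵛ⇒≡ h∼)) (trans (sym eq) (∼ᵛ⇒≡ g∼))) lt)
  ... | inj₂ (inj₁ refl) = Vertices.trans g∼ (Vertices.sym h∼)
  ... | inj₂ (inj₂ gt)   = ⊥-elim (h-top g′ (trans (sym (∼ᵛ⇒≡ g∼)) (trans eq (∼ᵛ⇒≡ h∼))) gt)

  out-out⁻ : ∀ {e e′} → key (out e) ≺ key (out e′) → hi e′ <ᶠ hi e
  out-out⁻ {e} {e′} lt with subst₂ _≺_ (key-out e) (key-out e′) lt
  ... | out-out p = p
  in-in⁻ : ∀ {e e′} → key (inn e) ≺ key (inn e′) → lo e <ᶠ lo e′
  in-in⁻ {e} {e′} lt with subst₂ _≺_ (key-inn e) (key-inn e′) lt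
  ... | in-in p = p
  in-out⁻ : ∀ {e e′} → ¬ key (inn e) ≺ key (out e′)
  in-out⁻ {e} {e′} lt with subst₂ _≺_ (key-inn e) (key-out e′) lt
  ... | ()
  out-out⁺ : ∀ {e e′} → hi e′ <ᶠ hi e → key (out e) ≺ key (out e′)
  out-out⁺ {e} {e′} lt = subst₂ _≺_ (sym (key-out e)) (sym (key-out e′)) (out-out lt)
  in-in⁺ : ∀ {e e′} → lo e <ᶠ lo e′ → key (inn e) ≺ key (inn e′)
  in-in⁺ {e} {e′} lt = subst₂ _≺_ (sym (key-inn e)) (sym (key-inn e′)) (in-in lt)
  out-in⁺ : ∀ {e e′} → key (out e) ≺ key (inn e′)
  out-in⁺ {e} {e′} = subst₂ _≺_ (sym (key-out e)) (sym (key-inn e′)) out-in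

  maxBelow⇒greatest : ∀ {e} → L.MaxBelow (lo e) (hi e) → Greatest (inn e)
  maxBelow⇒greatest {e} (_ , max) g eq lt with dartView g
  ... | outᵛ e′ = in-out⁻ lt
  ... | innᵛ e′ =
      max (lo e′) (subst (lo e′ ⊏_) (trans (sym (X-inn e′)) (trans eq (X-inn e))) (edge-⊏ e′)) (in-in⁻ lt)

  minAbove⇒least : ∀ {e} → L.MinAbove (hi e) (lo e) → Least (out e)
  minAbove⇒least {e} (_ , min) g eq lt with dartView g
  ... | innᵛ e′ = in-out⁻ lt
  ... | outᵛ e′ = min (hi e′) (subst (_⊏ hi e′) lo≡ (edge-⊏ e′))
      (L.covers-above (edge-cover e) (subst (_⋖ hi e′) lo≡ (edge-cover e′)) (out-out⁻ lt))
    where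
    lo≡ : lo e′ ≡ lo e
    lo≡ = trans (sym (X-out e′)) (trans eq (X-out e))

  greatest⇒maxBelow : ∀ {e} → Greatest (inn e) → L.MaxBelow (lo e) (hi e)
  greatest⇒maxBelow {e} top = edge-⊏ e , λ q q⊏ lt → case L.cover-under q⊏ of λ
    { (inj₁ c) → covered c lt
    ; (inj₂ (k , q⊏k , c)) → covered c (ℕ.<-trans lt (proj₁ q⊏k)) }
    where
    covered : ∀ {k} → k ⋖ hi e → ¬ lo e <ᶠ k
    covered c lt with edge c
    ... | e′ , refl , eq = top (inn e′) (trans (X-inn e′) (trans eq (sym (X-inn e)))) (in-in⁺ lt)

  least⇒minAbove : ∀ {e} → Least (out e) → L.MinAbove (hi e) (lo e)
  least⇒minAbove {e} bot with L.minAbove (edge-⊏ e)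
  ... | m , min with edge (L.minAbove-cover min)
  ... | e′ , eq , refl with <-connex (hi e) (hi e′)
  ... | inj₁ lt         = ⊥-elim (bot (out e′) (trans (X-out e′) (trans eq (sym (X-out e)))) (out-out⁺ lt))
  ... | inj₂ (inj₁ eq′) = subst (λ a → L.MinAbove a (lo e)) (sym eq′) min
  ... | inj₂ (inj₂ gt)  = ⊥-elim (proj₂ min (hi e) (edge-⊏ e)
          (L.covers-above (L.minAbove-cover min) (edge-cover e) gt))

  lowest-in⇒maxBelow : ∀ {e} → (∀ e′ → hi e′ ≡ hi e → ¬ lo e′ <ᶠ lo e) → R.MaxBelow (lo e) (hi e)
  lowest-in⇒maxBelow {e} bot with R.maxBelow (swap (edge-⊏ e))
  ... | m , max with R.maxBelow-cover max
  ... | m⊏ , none with edge (swap m⊏ , λ k a b → none k (swap a) (swap b))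
  ... | e′ , refl , eq with <-connex (lo e) (lo e′)
  ... | inj₁ lt         = ⊥-elim (proj₂ max (lo e) (swap (edge-⊏ e))
          (L.covers-below (edge-cover e) (subst (lo e′ ⋖_) eq (edge-cover e′)) lt))
  ... | inj₂ (inj₁ eq′) = subst (λ z → R.MaxBelow z (hi e)) (sym eq′) max
  ... | inj₂ (inj₂ gt)  = ⊥-elim (bot e′ eq gt)

  -- At a vertex inside a left boundary the rotation wraps from the greatest key to the least.
  -- Inside a right boundary, in `around-right`, it passes without wrapping from the last outgoing
  -- key to the first incoming one.
  around-left : ∀ {e e′} → hi e′ ≡ lo e → L.MaxBelow (lo e′) (hi e′) → L.MinAbove (hi e) (lo e) →
                s⁺ (inn e′) ≡ out e
  around-left {e} {e′} eq max min = next⇒s⁺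
    (trans (X-out e) (trans (sym eq) (sym (X-inn e′))) ,
     inj₂ (maxBelow⇒greatest max , minAbove⇒least min))

  nothing-left : ∀ {e} → R.MinAbove (hi e) (lo e) → ∀ e′ → X (out e′) ≡ X (out e) → ¬ key (out e) ≺ key (out e′)
  nothing-left {e} (_ , min) e′ eq lt =
    min (hi e′) (swap (subst (_⊏ hi e′) (trans (sym (X-out e′)) (trans eq (X-out e))) (edge-⊏ e′))) (out-out⁻ lt)

  around-right : ∀ {e e′} → hi e′ ≡ lo e → R.MaxBelow (lo e′) (hi e′) → R.MinAbove (hi e) (lo e) →
                 s⁺ (out e) ≡ inn e′
  around-right {e} {e′} eq (z⊏ , max) min = next⇒s⁺
    (trans (X-inn e′) (trans eq (sym (X-out e))) , inj₁ (out-in⁺ , gap))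
    where
    gap : ∀ g → X g ≡ X (out e) → key (out e) ≺ key g → ¬ key g ≺ key (inn e′)
    gap g at p q with dartView g
    ... | outᵛ e″ = nothing-left min e″ at p
    ... | innᵛ e″ =
        max (lo e″) (swap e″⊏) (L.covers-below (subst (lo e″ ⋖_) hi≡ (edge-cover e″)) (edge-cover e′) (in-in⁻ q))
      where
      hi≡ : hi e″ ≡ hi e′
      hi≡ = trans (sym (X-inn e″)) (trans at (trans (X-out e) (sym eq)))
      e″⊏ : lo e″ ⊏ hi e′
      e″⊏ = subst (lo e″ ⊏_) hi≡ (edge-⊏ e″)

  turn-up : ∀ {e e′} → lo e′ ≡ lo e → hi e′ <ᶠ hi e →
            (∀ q → lo e ⋖ q → hi e′ <ᶠ q → ¬ q <ᶠ hi e) → s⁺ (out e) ≡ out e′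
  turn-up {e} {e′} eq lt none =
      next⇒s⁺ (trans (X-out e′) (trans eq (sym (X-out e))) , inj₁ (out-out⁺ lt , gap))
    where
    gap : ∀ g → X g ≡ X (out e) → key (out e) ≺ key g → ¬ key g ≺ key (out e′)
    gap g at p q with dartView g
    ... | innᵛ e″ = in-out⁻ q
    ... | outᵛ e″ =
        none (hi e″) (subst (_⋖ hi e″) (trans (sym (X-out e″)) (trans at (X-out e))) (edge-cover e″))
                      (out-out⁻ q) (out-out⁻ p)

  lowest-edge : ∃ λ e → lo e ≡ zero × L.MinAbove (hi e) (lo e)
  lowest-edge with L.minAbove (⊏top {zero} λ ())
  ... | m , min with edge (L.minAbove-cover min)
  ... | e , eq , refl = e , eq , subst (L.MinAbove (hi e)) (sym eq) min

  e₀ : Fin E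
  e₀ = proj₁ lowest-edge

  root : D
  root = out e₀

  X-root : X root ≡ zero
  X-root = trans (X-out e₀) (proj₁ (proj₂ lowest-edge))

  e₀-unique : ∀ {e} → lo e ≡ zero → L.MinAbove (hi e) (lo e) → e ≡ e₀
  e₀-unique {e} eq min = edge-injective lo≡
    (L.minAbove-unique (subst (L.MinAbove (hi e)) lo≡ min) (proj₂ (proj₂ lowest-edge)))
    where
    lo≡ : lo e ≡ lo e₀
    lo≡ = trans eq (sym (proj₁ (proj₂ lowest-edge)))

  to-root : ∀ {e} → lo e ≡ zero → R.MinAbove (hi e) (lo e) → s⁺ (out e) ≡ root
  to-root {e} eq min = next⇒s⁺
    (trans X-root (trans (sym eq) (sym (X-out e))) , inj₂ (top-out , minAbove⇒least (proj₂ (proj₂ lowest-edge))))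
    where
    top-out : Greatest (out e)
    top-out g at lt with dartView g
    ... | outᵛ e′ = nothing-left min e′ at lt
    ... | innᵛ e′ = below⇒≢zero (edge-⊏ e′) (trans (sym (X-inn e′)) (trans at (trans (X-out e) eq)))

  -- Such an edge is the first one on the left boundary of the face to its right.
  Bottom : Fin E → Set
  Bottom e = lo e ≡ zero ⊎ ¬ L.MinAbove (hi e) (lo e)

  -- The walk from a dart of a face to its bottom: down the left boundary
  -- against φ, or down the right boundary along φ.
  data Bot : D → Fin E → Set where
    stop : ∀ {d e} → d ≡ out e → Bottom e → Bot d e
    back : ∀ {d e e′ b} → d ≡ out e → L.MinAbove (hi e) (lo e) → hi e′ ≡ lo e →
           L.MaxBelow (lo e′) (hi e′) → Bot (out e′) b → Bot d b
    fwd  : ∀ {d e b} → d ≡ inn e → Bot (s⁺ (out e)) b → Bot d b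

  ¬stop-back : ∀ {e e′} → Bottom e → hi e′ ≡ lo e → ¬ L.MinAbove (hi e) (lo e)
  ¬stop-back {e′ = e′} (inj₁ eq) eq′ min = below⇒≢zero (edge-⊏ e′) (trans eq′ eq)
  ¬stop-back (inj₂ ¬min) _ min = ¬min min

  bot-functional : ∀ {d b b′} → Bot d b → Bot d b′ → b ≡ b′
  bot-functional (stop p _) (stop q _) = out-injective (trans (sym p) q)
  bot-functional (stop p bot) (back q min eq _ _) with out-injective (trans (sym p) q)
  ... | refl = ⊥-elim (¬stop-back bot eq min)
  bot-functional (back q min eq _ _) (stop p bot) with out-injective (trans (sym p) q)
  ... | refl = ⊥-elim (¬stop-back bot eq min)
  bot-functional (back p _ eq max B) (back q _ eq′ max′ B′) with out-injective (trans (sym p) q)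
  ... | refl with edge-injective (L.maxBelow-unique max (subst (L.MaxBelow _) (trans eq′ (sym eq)) max′)) (trans eq (sym eq′))
  ... | refl = bot-functional B B′
  bot-functional (fwd p B) (fwd q B′) with inn-injective (trans (sym p) q)
  ... | refl = bot-functional B B′
  bot-functional (fwd p _) (stop q _)       = ⊥-elim (out≢inn (trans (sym q) p))
  bot-functional (fwd p _) (back q _ _ _ _) = ⊥-elim (out≢inn (trans (sym q) p))
  bot-functional (stop q _) (fwd p _)       = ⊥-elim (out≢inn (trans (sym q) p))
  bot-functional (back q _ _ _ _) (fwd p _) = ⊥-elim (out≢inn (trans (sym q) p))

  bot-bottom : ∀ {d b} → Bot d b → Bottom b
  bot-bottom (stop _ bot)       = bot
  bot-bottom (back _ _ _ _ B)   = bot-bottom B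
  bot-bottom (fwd _ B)          = bot-bottom B

  bot-face : ∀ {d b} → Bot d b → out b ∼ᶠ d
  bot-face (stop refl _) = Faces.refl
  bot-face (back {e′ = e′} refl min eq max B) = Faces.trans (bot-face B)
    (EqClosure.return (trans (φ-out e′) (around-left eq max min)))
  bot-face (fwd {e = e} refl B) = Faces.trans (bot-face B) (Faces.sym (EqClosure.return (φ-inn e)))

  minAbove? : ∀ e → Dec (L.MinAbove (hi e) (lo e))
  minAbove? e with L.minAbove (edge-⊏ e)
  ... | m , min with hi e Fin.≟ m
  ... | yes refl = yes min
  ... | no ¬eq   = no λ min′ → ¬eq (L.minAbove-unique min′ min)

  bottom? : ∀ e → Dec (Bottom e)
  bottom? e with lo e Fin.≟ zero | minAbove? e
  ... | yes p | _      = yes (inj₁ p)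
  ... | no _  | no ¬p  = yes (inj₂ ¬p)
  ... | no ¬p | yes q  = no λ { (inj₁ p) → ¬p p ; (inj₂ ¬q) → ¬q q }

  ¬bottom : ∀ {e} → ¬ Bottom e → lo e ≢ zero × L.MinAbove (hi e) (lo e)
  ¬bottom {e} ¬bot with minAbove? e
  ... | yes min = (¬bot ∘ inj₁) , min
  ... | no ¬min = ⊥-elim (¬bot (inj₂ ¬min))

  edge-down : ∀ {i} → i ≢ zero → ∃ λ e → hi e ≡ i × L.MaxBelow (lo e) (hi e)
  edge-down i≢ with L.maxBelow (zero⊏ i≢)
  ... | m , max with edge (L.maxBelow-cover max)
  ... | e , refl , refl = e , refl , max

  edge-down˘ : ∀ {i} → i ≢ zero → ∃ λ e → hi e ≡ i × R.MaxBelow (lo e) (hi e)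
  edge-down˘ i≢ with R.maxBelow (swap (zero⊏ i≢))
  ... | m , max with R.maxBelow-cover max
  ... | m⊏ , none with edge (swap m⊏ , λ k a b → none k (swap a) (swap b))
  ... | e , refl , refl = e , refl , max

  bot-total-out : ∀ e → ∃ (Bot (out e))
  bot-total-out e = go (FinI.<-wellFounded (lo e))
    where
    go : ∀ {e} → Acc _<ᶠ_ (lo e) → ∃ (Bot (out e))
    go {e} (acc rs) with bottom? e
    ... | yes bot = e , stop refl bot
    ... | no ¬bot with ¬bottom ¬bot
    ... | lo≢ , min with edge-down lo≢
    ... | e′ , eq , max with go {e′} (rs (subst (lo e′ <ᶠ_) eq (proj₁ (edge-⊏ e′))))
    ... | b , B = b , back refl min eq max B

  bot-total-in : ∀ e → ∃ (Bot (inn e))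
  bot-total-in e = go (FinI.<-wellFounded (lo e))
    where
    go : ∀ {e} → Acc _<ᶠ_ (lo e) → ∃ (Bot (inn e))
    after : ∀ {e d} → Acc _<ᶠ_ (lo e) → s⁺ (out e) ≡ d → View d → ∃ (Bot (inn e))
    go {e} ac = after ac refl (dartView (s⁺ (out e)))
    after _ eq (outᵛ e′) with bot-total-out e′
    ... | b , B = b , fwd refl (subst (λ z → Bot z b) (sym eq) B)
    after {e} (acc rs) eq (innᵛ e′) with go {e′} (rs (subst (lo e′ <ᶠ_)
        (trans (sym (X-inn e′)) (trans (sym (cong X eq)) (trans (X-s⁺ (out e)) (X-out e)))) (proj₁ (edge-⊏ e′))))
    ... | b , B = b , fwd refl (subst (λ z → Bot z b) (sym eq) B)

  bot-total : ∀ d → ∃ (Bot d)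
  bot-total d with dartView d
  ... | outᵛ e = bot-total-out e
  ... | innᵛ e = bot-total-in e

  -- `Bot` stops together with the walk of `L.step`: while the walk goes on, its edge is the
  -- rightmost one upwards and starts above `zero`, so it is no bottom; at the end `¬least` forbids
  -- a further `back`.
  bot-left : ∀ {p p′ w a e d b} → L.Corner p p′ w → L.Left p p′ a → hi e ≡ a →
             L.MaxBelow (lo e) (hi e) → d ≡ out e → Bot d b → L.End p p′ (lo b) (hi b)
  bot-left {e = e} C l refl max eq B with L.step C l max
  bot-left C l refl max eq (stop eq′ _) | inj₁ z⊏p′ with out-injective (trans (sym eq) eq′)
  ... | refl = record { left = l ; max = max ; z⊏p′ = z⊏p′ }
  bot-left C l refl max eq (back eq′ min _ _ _) | inj₁ z⊏p′ with out-injective (trans (sym eq) eq′)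
  ... | refl = ⊥-elim (L.End.¬least (record { left = l ; max = max ; z⊏p′ = z⊏p′ }) min)
  bot-left C l refl max eq (stop eq′ bot) | inj₂ (min , l′) with out-injective (trans (sym eq) eq′)
  ... | refl with bot
  ... | inj₁ z≡0  = ⊥-elim (y≮zero (subst (λ z → _ <ᶠ y z) z≡0 (L.Left.p′<a l′)))
  ... | inj₂ ¬min = ⊥-elim (¬min min)
  bot-left C l refl max eq (back {e′ = e′} eq′ _ eq″ max′ B) | inj₂ (min , l′)
    with out-injective (trans (sym eq) eq′)
  ... | refl = bot-left C l′ eq″ max′ refl B
  bot-left C l refl max eq (fwd eq′ _) | _ = ⊥-elim (out≢inn (trans (sym eq) eq′))

  -- Where the right walk ends, the rotation turns from its last edge to the edge found on the left,
  -- because these two are consecutive upper covers of the common lowest point.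
  bot-right : ∀ {p p′ w a e d b b′} → L.Corner p p′ w → L.End p p′ (lo b) (hi b) → Bottom b →
              R.Left p′ p a → hi e ≡ a → R.MaxBelow (lo e) (hi e) → d ≡ inn e → Bot d b′ → b′ ≡ b
  bot-right C end bot l refl max eq (stop eq′ _)       = ⊥-elim (out≢inn (trans (sym eq′) eq))
  bot-right C end bot l refl max eq (back eq′ _ _ _ _) = ⊥-elim (out≢inn (trans (sym eq′) eq))
  bot-right {e = e} {b = b} C end bot l refl max eq (fwd eq′ B) with inn-injective (trans (sym eq) eq′)
  ... | refl with R.step (M.corner-transpose C) l max
  ... | inj₁ z⊏p = bot-functional B (stop
      (turn-up lo≡ (M.ends-ordered C end end˘)
        (λ q c → M.ends-consecutive C end end˘ q (subst (_⋖ q) (sym lo≡) c))) bot)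
    where
    end˘ = record { left = l ; max = max ; z⊏p′ = z⊏p }
    lo≡ : lo b ≡ lo e
    lo≡ = M.meet C end end˘
  ... | inj₂ (min , l′) with edge-down˘ (λ z≡0 → ≮zero (subst (_ <ᶠ_) z≡0 (R.Left.p′<a l′)))
  ... | e′ , eq″ , max′ = bot-right C end bot l′ eq″ max′ (around-right eq″ max′ min) B

  bot-outer-left : ∀ {e d b} → L.Outer (hi e) → L.MaxBelow (lo e) (hi e) → d ≡ out e → Bot d b → b ≡ e₀
  bot-outer-left outer max eq B with L.outer-step outer max
  bot-outer-left outer max eq (stop eq′ bot) | min , _ with out-injective (trans (sym eq) eq′)
  ... | refl with bot
  ... | inj₁ z≡0  = e₀-unique z≡0 min
  ... | inj₂ ¬min = ⊥-elim (¬min min)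
  bot-outer-left outer max eq (back eq′ _ eq″ max′ B) | min , outer′ with out-injective (trans (sym eq) eq′)
  ... | refl = bot-outer-left (subst L.Outer (sym eq″) outer′) max′ refl B
  bot-outer-left outer max eq (fwd eq′ _) | _ = ⊥-elim (out≢inn (trans (sym eq) eq′))

  bot-outer-right : ∀ {e d b} → R.Outer (hi e) → R.MaxBelow (lo e) (hi e) → d ≡ inn e → Bot d b → b ≡ e₀
  bot-outer-right outer max eq (stop eq′ _)       = ⊥-elim (out≢inn (trans (sym eq′) eq))
  bot-outer-right outer max eq (back eq′ _ _ _ _) = ⊥-elim (out≢inn (trans (sym eq′) eq))
  bot-outer-right {e} outer max eq (fwd eq′ B) with inn-injective (trans (sym eq) eq′)
  ... | refl with R.outer-step outer max
  ... | min , outer′ with lo e Fin.≟ zero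
  ... | yes z≡0 = bot-functional B (stop (to-root z≡0 min) (inj₁ (proj₁ (proj₂ lowest-edge))))
  ... | no z≢0 with edge-down˘ z≢0
  ... | e′ , eq″ , max′ =
    bot-outer-right (subst R.Outer (sym eq″) outer′) max′ (around-right eq″ max′ min) B

  outer-top : L.Outer top
  outer-top q lt = ⊥-elim (top≮ {q} lt)

  outer-top˘ : R.Outer top
  outer-top˘ q lt = ⊥-elim (ytop≮ {q} lt)

  consecutive⇒corner : ∀ {e e′} → hi e′ ≡ hi e → lo e <ᶠ lo e′ →
                       (∀ k → k ⋖ hi e → lo e <ᶠ k → ¬ k <ᶠ lo e′) → L.Corner (lo e) (lo e′) (hi e)
  consecutive⇒corner {e} {e′} hi≡ lt none = record
    { p⋖w = edge-cover e ; p′⋖w = p′⋖w ; p<p′ = lt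
    ; p′<p = L.covers-below (edge-cover e) p′⋖w lt ; empty = empty }
    where
    p′⋖w : lo e′ ⋖ hi e
    p′⋖w = subst (lo e′ ⋖_) hi≡ (edge-cover e′)
    empty : ∀ q → lo e <ᶠ q → q <ᶠ lo e′ → y (lo e′) <ᶠ y q → ¬ y q <ᶠ y (lo e)
    empty q p<q q<p′ p′<q q<p
      with L.cover-under (ℕ.<-trans q<p′ (proj₁ (proj₁ p′⋖w)) , ℕ.<-trans q<p (proj₂ (edge-⊏ e)))
    ... | inj₁ c = none q c p<q q<p′
    ... | inj₂ (k , q⊏k , c) with <-connex k (lo e′)
    ... | inj₁ k<p′        = none k c (ℕ.<-trans p<q (proj₁ q⊏k)) k<p′
    ... | inj₂ (inj₁ refl) = ℕ.<-asym p′<q (proj₂ q⊏k)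
    ... | inj₂ (inj₂ p′<k) = ℕ.<-asym (L.covers-below p′⋖w c p′<k) (ℕ.<-trans p′<q (proj₂ q⊏k))

  -- At the highest point of a face, both boundaries lead down to the same edge.
  bot-corner : ∀ {e e′ b} → hi e′ ≡ hi e → L.Corner (lo e) (lo e′) (hi e) → Bot (out e) b → Bot (inn e′) b
  bot-corner {e} {e′} {b} hi≡ C B = fwd refl (subst (λ d → Bot d b) (sym turn) below)
    where
    min = proj₁ (L.start C)
    min˘ : R.MinAbove (hi e′) (lo e′)
    min˘ = subst (λ w → R.MinAbove w (lo e′)) (sym hi≡) (proj₁ (R.start (M.corner-transpose C)))
    end : Bot (out e) b → L.End (lo e) (lo e′) (lo b) (hi b)
    end (stop eq bot) with out-injective eq
    ... | refl with bot
    ... | inj₁ z≡0  = ⊥-elim (y≮zero (subst (λ z → _ <ᶠ y z) z≡0 (L.Corner.p′<p C)))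
    ... | inj₂ ¬min = ⊥-elim (¬min min)
    end (back eq _ eq′ max B) with out-injective eq
    ... | refl = bot-left C (proj₂ (L.start C)) eq′ max refl B
    end (fwd eq _) = ⊥-elim (out≢inn eq)
    descent = edge-down˘ {lo e′} (λ z≡0 → ≮zero (subst (lo e <ᶠ_) z≡0 (L.Corner.p<p′ C)))
    turn : s⁺ (out e′) ≡ inn (proj₁ descent)
    turn = around-right (proj₁ (proj₂ descent)) (proj₂ (proj₂ descent)) min˘
    below : Bot (inn (proj₁ descent)) b
    below with bot-total-in (proj₁ descent)
    ... | b′ , B′ =
        subst (Bot _) (bot-right C (end B) (bot-bottom B) (proj₂ (R.start (M.corner-transpose C)))
      (proj₁ (proj₂ descent)) (proj₂ (proj₂ descent)) refl B′) B′

  -- The cases are the turns at the upper end of `e`. To an outgoing dart, the left boundary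
  -- continues. To an incoming dart with a larger key, this is the top of an inner face. To an
  -- incoming dart by wrapping, the vertex has no outgoing dart, so it is `top` and the face is the
  -- outer one.
  bot-next : ∀ {e d b} → Next (inn e) d → View d → Bot (out e) b → Bot d b
  bot-next (_ , inj₁ (lt , _)) (outᵛ e′) B = ⊥-elim (in-out⁻ lt)
  bot-next {e} (eq , inj₂ (high , low)) (outᵛ e′) B = back refl (least⇒minAbove low)
    (trans (sym (X-inn e)) (trans (sym eq) (X-out e′))) (greatest⇒maxBelow high) B
  bot-next {e} (eq , inj₁ (lt , none)) (innᵛ e′) B = bot-corner hi≡
    (consecutive⇒corner hi≡ (in-in⁻ lt) (λ { k c p q → case edge c of λ
      { (e″ , refl , at) → none (inn e″) (trans (X-inn e″) (trans at (sym (X-inn e)))) (in-in⁺ p) (in-in⁺ q) } })) B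
    where
    hi≡ : hi e′ ≡ hi e
    hi≡ = trans (sym (X-inn e′)) (trans eq (X-inn e))
  bot-next {e} (eq , inj₂ (high , low)) (innᵛ e′) B with hi e Fin.≟ top
  ... | no ≢top with L.minAbove (⊏top ≢top)
  ... | m , min with edge (L.minAbove-cover min)
  ... | e″ , at , _ =
      ⊥-elim (low (out e″) (trans (X-out e″) (trans at (trans (sym (X-inn e)) (sym eq)))) out-in⁺)
  bot-next {e} (eq , inj₂ (high , low)) (innᵛ e′) B | yes ≡top with bot-total-in e′
  ... | b′ , B′ = subst (Bot _) (trans
    (bot-outer-right (subst R.Outer (sym hi≡top) outer-top˘)
      (lowest-in⇒maxBelow (λ e″ at lt → low (inn e″) (trans (X-inn e″) (trans at (sym (X-inn e′)))) (in-in⁺ lt))) refl B′)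
    (sym (bot-outer-left (subst L.Outer (sym ≡top) outer-top) (greatest⇒maxBelow high) refl B))) B′
    where
    hi≡top : hi e′ ≡ top
    hi≡top = trans (sym (X-inn e′)) (trans eq (trans (X-inn e) ≡top))

  bot-φ : ∀ {d b} → Bot d b → Bot (φ d) b
  bot-φ {d} {b} B with dartView d
  bot-φ {b =
      b} B | outᵛ e = subst (λ z → Bot z b) (sym (φ-out e)) (bot-next (s⁺-next (inn e)) (dartView _) B)
  bot-φ {b = b} (stop eq _)       | innᵛ e = ⊥-elim (out≢inn (sym eq))
  bot-φ {b = b} (back eq _ _ _ _) | innᵛ e = ⊥-elim (out≢inn (sym eq))
  bot-φ {b = b} (fwd eq B)        | innᵛ e with inn-injective eq
  ... | refl = subst (λ z → Bot z b) (sym (φ-inn e)) B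

  opaque
    bot : D → Fin E
    bot d = proj₁ (bot-total d)

    bot-Bot : ∀ d → Bot d (bot d)
    bot-Bot d = proj₂ (bot-total d)

  bot≡ : ∀ {d b} → Bot d b → bot d ≡ b
  bot≡ = bot-functional (bot-Bot _)

  ∼ᶠ⇒≡ : ∀ {g h} → g ∼ᶠ h → bot g ≡ bot h
  ∼ᶠ⇒≡ = orbit-invariant bot (λ d → bot≡ (bot-φ (bot-Bot d)))

  ≡⇒∼ᶠ : ∀ {g h} → bot g ≡ bot h → g ∼ᶠ h
  ≡⇒∼ᶠ {g} {h} eq = Faces.trans (Faces.sym (bot-face (bot-Bot g)))
    (subst (λ b → out b ∼ᶠ h) (sym eq) (bot-face (bot-Bot h)))

  bot-out : ∀ {e} → Bottom e → bot (out e) ≡ e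
  bot-out b = bot≡ (stop refl b)

  _∼ᶠ?_ : ∀ g h → Dec (g ∼ᶠ h)
  g ∼ᶠ? h with bot g Fin.≟ bot h
  ... | yes eq = yes (≡⇒∼ᶠ eq)
  ... | no ¬eq = no (¬eq ∘ ∼ᶠ⇒≡)

  opaque
    faces-finite : ∃ (HasCardinality (Orbits φ))
    faces-finite = enumerated⇒cardinality (Orbits φ) _∼ᶠ?_ (allFin (E + E))
      (λ d → Any.map (λ { refl → Faces.refl }) (∈-allFin d))

  #F : ℕ
  #F = proj₁ faces-finite

  private module FC = Inverse (proj₂ faces-finite)

  zero≢top : zero ≢ top
  zero≢top ()

  -- An edge that is not at the bottom of a face is the lowest one above its
  -- lower end, so it is determined by that end.
  euler : N + #F ≡ E + 2
  euler = ℕ.≤-antisym (⊎-injective⇒≤ f f-injective) (⊎-injective⇒≤ g g-injective)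
    where
    data Mark : Fin N ⊎ Fin #F → Fin E ⊎ Fin 2 → Set where
      -- The summand 2 is taken by the extreme points: the lowest edge out of `zero` already counts
      -- as the bottom of the outer face, and no edge leaves `top`.
      source : ∀ {i} → i ≡ zero → Mark (inj₁ i) (inj₂ zero)
      target : ∀ {i} → i ≡ top → Mark (inj₁ i) (inj₂ (suc zero))
      inner  : ∀ {i e} → i ≡ lo e → ¬ Bottom e → Mark (inj₁ i) (inj₁ e)
      face   : ∀ {k e} → k ≡ FC.to (out e) → Bottom e → Mark (inj₂ k) (inj₁ e)

    mark-functional : ∀ {z m m′} → Mark z m → Mark z m′ → m ≡ m′
    mark-functional (source _) (source _) = refl
    mark-functional (target _) (target _) = refl
    mark-functional (source p) (target q) = ⊥-elim (zero≢top (trans (sym p) q))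
    mark-functional (target q) (source p) = ⊥-elim (zero≢top (trans (sym p) q))
    mark-functional (source p) (inner q ¬b) = ⊥-elim (¬b (inj₁ (trans (sym q) p)))
    mark-functional (inner q ¬b) (source p) = ⊥-elim (¬b (inj₁ (trans (sym q) p)))
    mark-functional (target p) (inner q ¬b) = ⊥-elim (above⇒≢top (edge-⊏ _) (trans (sym q) p))
    mark-functional (inner q ¬b) (target p) = ⊥-elim (above⇒≢top (edge-⊏ _) (trans (sym q) p))
    mark-functional (inner p ¬b) (inner q ¬b′) with trans (sym p) q
    ... | lo≡ = cong inj₁ (edge-injective lo≡ (L.minAbove-unique
      (subst (L.MinAbove _) lo≡ (proj₂ (¬bottom ¬b))) (proj₂ (¬bottom ¬b′))))
    mark-functional (face p b) (face q b′) = cong inj₁ (trans (sym (bot-out b)) (trans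
      (∼ᶠ⇒≡ (Faces.trans (Faces.sym (FC.inverseʳ p)) (FC.inverseʳ q))) (bot-out b′)))

    mark-injective : ∀ {z z′ m} → Mark z m → Mark z′ m → z ≡ z′
    mark-injective (source p) (source q)    = cong inj₁ (trans p (sym q))
    mark-injective (target p) (target q)    = cong inj₁ (trans p (sym q))
    mark-injective (inner p _) (inner q _)  = cong inj₁ (trans p (sym q))
    mark-injective (face p _) (face q _)    = cong inj₂ (trans p (sym q))
    mark-injective (inner _ ¬b) (face _ b)  = ⊥-elim (¬b b)
    mark-injective (face _ b) (inner _ ¬b)  = ⊥-elim (¬b b)

    mark : ∀ z → ∃ (Mark z)
    mark (inj₁ i) with i Fin.≟ zero | i Fin.≟ top
    ... | yes p | _     = _ , source p
    ... | no _  | yes q = _ , target q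
    ... | no ≢0 | no ≢top with L.minAbove (⊏top ≢top)
    ... | m , min with edge (L.minAbove-cover min)
    ... | e , refl , refl = _ , inner refl λ { (inj₁ p) → ≢0 p ; (inj₂ ¬min) → ¬min min }
    mark (inj₂ k) = _ , face (trans (sym (FC.strictlyInverseˡ k))
      (FC.to-cong (Faces.sym (bot-face (bot-Bot (FC.from k)))))) (bot-bottom (bot-Bot (FC.from k)))

    marked : ∀ m → ∃ λ z → Mark z m
    marked (inj₁ e) with bottom? e
    ... | yes b = _ , face refl b
    ... | no ¬b = _ , inner refl ¬b
    marked (inj₂ zero)       = _ , source refl
    marked (inj₂ (suc zero)) = _ , target refl

    f = proj₁ ∘ mark
    f-injective : ∀ {z z′} → f z ≡ f z′ → z ≡ z′
    f-injective {z} {z′} eq = mark-injective (subst (Mark z) eq (proj₂ (mark z))) (proj₂ (mark z′))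

    g = proj₁ ∘ marked
    g-injective : ∀ {m m′} → g m ≡ g m′ → m ≡ m′
    g-injective {m} {m′} eq =
        mark-functional (subst (λ z → Mark z m) eq (proj₂ (marked m))) (proj₂ (marked m′))

  cardinality : ∀ {S : Setoid 0ℓ 0ℓ} {k} (f : Setoid.Carrier S → Fin k) (f⁻¹ : Fin k → Setoid.Carrier S) →
                (∀ {x y} → Setoid._≈_ S x y → f x ≡ f y) → (∀ i → f (f⁻¹ i) ≡ i) →
                (∀ x → Setoid._≈_ S (f⁻¹ (f x)) x) → HasCardinality S k
  cardinality {S} f f⁻¹ f-cong ff⁻¹ f⁻¹f = record
    { to = f ; from = f⁻¹ ; to-cong = f-cong ; from-cong = λ { refl → Setoid.refl S }
    ; inverse = (λ {i} y≈ → trans (f-cong y≈) (ff⁻¹ i)) , (λ { {x} refl → f⁻¹f x }) }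

  edge-sink : ∃ λ e → hi e ≡ top × R.MaxBelow (lo e) (hi e)
  edge-sink = edge-down˘ (λ ())

  sink : D
  sink = inn (proj₁ edge-sink)

  X-sink : X sink ≡ top
  X-sink = trans (X-inn _) (proj₁ (proj₂ edge-sink))

  sink∼root : sink ∼ᶠ root
  sink∼root = ≡⇒∼ᶠ (trans (bot-outer-right (subst R.Outer (sym (proj₁ (proj₂ edge-sink))) outer-top˘)
    (proj₂ (proj₂ edge-sink)) refl (bot-Bot sink)) (sym (bot-out (inj₁ (proj₁ (proj₂ lowest-edge))))))

  dart-at : ∀ i → ∃ λ d → X d ≡ i
  dart-at i with i Fin.≟ top
  ... | yes refl = sink , X-sink
  ... | no ≢top with L.minAbove (⊏top ≢top)
  ... | m , min with edge (L.minAbove-cover min)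
  ... | e , refl , _ = out e , X-out e

  vertices : HasCardinality (Orbits s⁺) N
  vertices = cardinality X (proj₁ ∘ dart-at) ∼ᵛ⇒≡ (proj₂ ∘ dart-at) (λ d → ≡⇒∼ᵛ (proj₂ (dart-at (X d))))

  edges : HasCardinality (Orbits α) E
  edges =
      cardinality to out (orbit-invariant to to-α) (λ e → cong [ id , id ]′ (Fin.splitAt-↑ˡ E e E)) from-to
    where
    to : D → Fin E
    to = [ id , id ]′ ∘ splitAt E
    to-out : ∀ e → to (out e) ≡ e
    to-out e = cong [ id , id ]′ (Fin.splitAt-↑ˡ E e E)
    to-inn : ∀ e → to (inn e) ≡ e
    to-inn e = cong [ id , id ]′ (Fin.splitAt-↑ʳ E E e)
    to-α : ∀ d → to (α d) ≡ to d
    to-α d with dartView d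
    ... | outᵛ e = trans (cong to (α-out e)) (trans (to-inn e) (sym (to-out e)))
    ... | innᵛ e = trans (cong to (α-inn e)) (trans (to-out e) (sym (to-inn e)))
    from-to : ∀ d → EqClosure (λ g h → α g ≡ h) (out (to d)) d
    from-to d with dartView d
    ... | outᵛ e =
        subst (λ z → EqClosure (λ g h → α g ≡ h) (out z) (out e)) (sym (to-out e)) (EqClosure.reflexive _)
    ... | innᵛ e =
        subst (λ z → EqClosure (λ g h → α g ≡ h) (out z) (inn e)) (sym (to-inn e)) (EqClosure.return (α-out e))

  Linked : Rel D 0ℓ
  Linked = EqClosure (λ g h → s⁺ g ≡ h ⊎ α g ≡ h)

  linked-root : ∀ d → Linked d root
  linked-root d = go d (FinI.<-wellFounded (X d))
    where
    turn : ∀ {g h} → X g ≡ X h → Linked g h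
    turn eq = EqClosure.map inj₁ (≡⇒∼ᵛ eq)
    go : ∀ d → Acc _<ᶠ_ (X d) → Linked d root
    go d (acc rs) with X d Fin.≟ zero
    ... | yes eq = turn (trans eq (sym X-root))
    ... | no ≢0 with edge-down ≢0
    ... | e , eq , _ = EqClosure.transitive _ (turn (sym (trans (X-inn e) eq)))
      (EqClosure.transitive _ (EqClosure.return (inj₂ (α-inn e)))
        (go (out e) (rs (subst₂ _<ᶠ_ (sym (X-out e)) eq (proj₁ (edge-⊏ e))))))

  rootedMap : RootedPlanarMap
  rootedMap = record
    { #darts = E + E ; σ = σ ; α = α ; α-involutive = α-involutive ; α-fixfree = α-fixfree
    ; root = root
    ; connected = λ g h → EqClosure.transitive _ (linked-root g) (EqClosure.symmetric _ (linked-root h))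
    ; #vertices = N ; #edges = E ; #faces = #F
    ; vertex-count = vertices ; edge-count = edges ; face-count = proj₂ faces-finite
    ; genus-zero = euler }

  out⇒cover : ∀ {d} → outgoing d ≡ true → X d ⋖ X (α d)
  out⇒cover {d} o with dartView d
  ... | outᵛ e = subst₂ _⋖_ (sym (X-out e)) (sym (trans (cong X (α-out e)) (X-inn e))) (edge-cover e)
  ... | innᵛ e with trans (sym o) (outgoing-inn e)
  ... | ()

  open Oriented rootedMap outgoing

  arc⇒⊏ : ∀ {g h} → Arc g h → X g ⊏ X h
  arc⇒⊏ (d , o , p , q) = subst₂ _⊏_ (∼ᵛ⇒≡ p) (∼ᵛ⇒≡ q) (proj₁ (out⇒cover o))

  arcs⇒⊏ : ∀ {g h} → TransClosure Arc g h → X g ⊏ X h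
  arcs⇒⊏ [ a ]   = arc⇒⊏ a
  arcs⇒⊏ (a ∷ p) = ⊏-trans (arc⇒⊏ a) (arcs⇒⊏ p)

  outgoing-at-zero : ∀ {d} → X d ≡ zero → outgoing d ≡ true
  outgoing-at-zero {d} eq with dartView d
  ... | outᵛ e = outgoing-out e
  ... | innᵛ e = ⊥-elim (below⇒≢zero (edge-⊏ e) (trans (sym (X-inn e)) eq))

  incoming-at-top : ∀ {d} → X d ≡ top → outgoing d ≡ false
  incoming-at-top {d} eq with dartView d
  ... | innᵛ e = outgoing-inn e
  ... | outᵛ e = ⊥-elim (above⇒≢top (edge-⊏ e) (trans (sym (X-out e)) eq))

  source-at-zero : ∀ d → IsSource d → X d ≡ zero
  source-at-zero d src with X d Fin.≟ zero
  ... | yes eq = eq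
  ... | no ≢0 with edge-down ≢0
  ... | e , eq , _ with trans (sym (src (inn e) (≡⇒∼ᵛ (trans (X-inn e) eq)))) (outgoing-inn e)
  ... | ()

  sink-at-top : ∀ d → IsSink d → X d ≡ top
  sink-at-top d snk with X d Fin.≟ top
  ... | yes eq = eq
  ... | no ≢top with L.minAbove (⊏top ≢top)
  ... | m , min with edge (L.minAbove-cover min)
  ... | e , eq , _ with trans (sym (snk (out e) (≡⇒∼ᵛ (trans (X-out e) eq)))) (outgoing-out e)
  ... | ()

  orientation : PlaneBipolarOrientation
  orientation = record
    { rootedMap     = rootedMap
    ; outgoing      = outgoing
    ; outgoing-α    = outgoing-α
    ; acyclic       = λ _ p → ⊏-irrefl (arcs⇒⊏ p)
    ; root-source   = λ h h∼ → outgoing-at-zero (trans (∼ᵛ⇒≡ h∼) X-root)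
    ; source-unique = λ x src → ≡⇒∼ᵛ (trans (source-at-zero x src) (sym X-root))
    ; sink          = sink
    ; sink-outer    = sink∼root
    ; sink-sink     = λ h h∼ → incoming-at-top (trans (∼ᵛ⇒≡ h∼) X-sink)
    ; sink-unique   = λ x snk → ≡⇒∼ᵛ (trans (sink-at-top x snk) (sym X-sink))
    }

  drawing : Drawing y orientation
  drawing = record
    { X              = X
    ; X-cong         = ∼ᵛ⇒≡
    ; X-reflects     = ≡⇒∼ᵛ
    ; X-onto         = dart-at
    ; edge-cover     = out⇒cover
    ; cover-edge     = λ c → let e , p , q = edge c in
        out e , outgoing-out e , trans (X-out e) p , trans (cong X (α-out e)) (trans (X-inn e) q)
    ; edge-unique    = λ o o′ eq eq′ → key-injective eq (cong₂ _,_ (trans o (sym o′)) eq′)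
    ; descent-unique = λ {g} {h} eq a b → descents (s⁺-next g) (s⁺-next h) eq a b
    ; root-descent   = λ a → minAbove⇒least (proj₂ (proj₂ lowest-edge)) (σ ⟨$⟩ˡ root)
        (trans (sym (X-s⁺ _)) (cong X (inverseʳ σ)))
        (subst (λ z → key (σ ⟨$⟩ˡ root) ≺ key z) (inverseʳ σ) a)
    }
    where
    descents : ∀ {g g⁺ h h⁺} → Next g g⁺ → Next h h⁺ → X g ≡ X h →
               ¬ key g ≺ key g⁺ → ¬ key h ≺ key h⁺ → g ≡ h
    descents (_ , inj₁ (lt , _)) _ _ a _ = ⊥-elim (a lt)
    descents _ (_ , inj₁ (lt , _)) _ _ b = ⊥-elim (b lt)
    descents {g} {h = h} (_ , inj₂ (high , _)) (_ , inj₂ (high′ , _)) eq _ _ with key-connex eq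
    ... | inj₁ lt        = ⊥-elim (high h (sym eq) lt)
    ... | inj₂ (inj₁ p)  = p
    ... | inj₂ (inj₂ gt) = ⊥-elim (high′ g eq gt)

  poset : PlaneBipolarPoset
  poset = record
    { orientation   = orientation
    ; no-transitive = λ e o p → avoids e o p }
    where
    arcs : ∀ {e g h} → TransClosure (ArcAvoiding e) g h → X g ⊏ X h
    arcs [ d , o , _ , p , q ]       = arc⇒⊏ (d , o , p , q)
    arcs ((d , o , _ , p , q) ∷ r)   = ⊏-trans (arc⇒⊏ (d , o , p , q)) (arcs r)
    avoids : ∀ e → Edge e → ¬ IsTransitive e
    avoids e o [ d , o′ , d≢e , p , q ] =
      d≢e (key-injective (∼ᵛ⇒≡ p) (cong₂ _,_ (trans o′ (sym o)) (∼ᵛ⇒≡ q)))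
    avoids e o (_∷_ {y = m} (d , o′ , _ , p , q) r) =
      proj₂ (out⇒cover o) (X m) (arc⇒⊏ (d , o′ , p , q)) (arcs r)

-- The bijection

interior : ∀ {n} → Fin n → Fin (suc (suc n))
interior i = suc (inject₁ i)

data Position {n} : Fin (suc (suc n)) → Set where
  front    : Position zero
  inside   : ∀ i → Position (interior i)
  back : Position (fromℕ (suc n))

position : ∀ {n} (j : Fin (suc (suc n))) → Position j
position zero    = front
position (suc j) with view j
... | ‵fromℕ     = back
... | ‵inject₁ i = inside i

interior-mono : ∀ {n} {i j : Fin n} → i <ᶠ j → interior i <ᶠ interior j
interior-mono {i = i} {j} lt = s≤s (subst₂ ℕ._<_ (sym (Fin.toℕ-inject₁ i)) (sym (Fin.toℕ-inject₁ j)) lt)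

interior-cancel : ∀ {n} {i j : Fin n} → interior i <ᶠ interior j → i <ᶠ j
interior-cancel {i = i} {j} (s≤s lt) = subst₂ ℕ._<_ (Fin.toℕ-inject₁ i) (Fin.toℕ-inject₁ j) lt

interior-injective : ∀ {n} {i j : Fin n} → interior i ≡ interior j → i ≡ j
interior-injective = Fin.inject₁-injective ∘ Fin.suc-injective

interior≢highest : ∀ {n} {i : Fin n} → interior i ≢ fromℕ (suc n)
interior≢highest eq = Fin.fromℕ≢inject₁ (sym (Fin.suc-injective eq))

highest≮ : ∀ {n} {j : Fin (suc n)} → ¬ fromℕ n <ᶠ j
highest≮ {j = j} lt = ℕ.<⇒≱ lt (Fin.≤fromℕ j)

extend : ∀ {n} → (Fin n → Fin n) → Fin (suc (suc n)) → Fin (suc (suc n))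
extend f zero    = zero
extend f (suc j) with view j
... | ‵fromℕ     = suc (fromℕ _)
... | ‵inject₁ i = interior (f i)

extend-interior : ∀ {n} (f : Fin n → Fin n) i → extend f (interior i) ≡ interior (f i)
extend-interior f i rewrite view-inject₁ i = refl

extend-highest : ∀ {n} (f : Fin n → Fin n) → extend f (fromℕ (suc n)) ≡ fromℕ (suc n)
extend-highest {n} f rewrite view-fromℕ n = refl

extend-cong : ∀ {n} {f g : Fin n → Fin n} → (∀ i → f i ≡ g i) → ∀ j → extend f j ≡ extend g j
extend-cong eq zero    = refl
extend-cong eq (suc j) with view j
... | ‵fromℕ     = refl
... | ‵inject₁ i = cong interior (eq i)

extend-reflects : ∀ {n} {f g : Fin n → Fin n} → (∀ j → extend f j ≡ extend g j) → ∀ i → f i ≡ g i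
extend-reflects {f = f} {g} eq i = interior-injective
  (trans (sym (extend-interior f i)) (trans (eq (interior i)) (extend-interior g i)))

extend-injective : ∀ {n} {f : Fin n → Fin n} → (∀ {i j} → f i ≡ f j → i ≡ j) →
                   ∀ {i j} → extend f i ≡ extend f j → i ≡ j
extend-injective {n} {f} inj {i} {j} eq with position i | position j
... | front   | front   = refl
... | back  | back  = refl
... | inside i | inside j = cong interior (inj (interior-injective
      (trans (sym (extend-interior f i)) (trans eq (extend-interior f j)))))
... | front   | inside j with trans eq (extend-interior f j)
... | ()
extend-injective {n} {f} inj eq | front | back with trans eq (extend-highest f)
... | ()
extend-injective {n} {f} inj eq | inside i | front with trans (sym (extend-interior f i)) eq
... | ()
extend-injective {n} {f} inj eq | back | front with trans (sym (extend-highest f)) eq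
... | ()
extend-injective {n} {f} inj eq | inside i | back =
  ⊥-elim (interior≢highest (trans (sym (extend-interior f i)) (trans eq (extend-highest f))))
extend-injective {n} {f} inj eq | back | inside i =
  ⊥-elim (interior≢highest (trans (sym (extend-interior f i)) (trans (sym eq) (extend-highest f))))

-- IsPlane π unfolds to ¬ Pattern (π ⟨$⟩ʳ_).
Pattern : ∀ {n} → (Fin n → Fin n) → Set
Pattern {n} f = ∃ λ (i : Fin n) → ∃ λ (j : Fin n) → ∃ λ (j′ : Fin n) → ∃ λ (k : Fin n) →
  i <ᶠ j × toℕ j′ ≡ suc (toℕ j) × j′ <ᶠ k × f j <ᶠ f i × f i <ᶠ f k × f k <ᶠ f j′

pattern? : ∀ {n} (f : Fin n → Fin n) → Dec (Pattern f)
pattern? f = Fin.any? λ i → Fin.any? λ j → Fin.any? λ j′ → Fin.any? λ k →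
  (i Fin.<? j) ×-dec (toℕ j′ ℕ.≟ suc (toℕ j)) ×-dec (j′ Fin.<? k) ×-dec
  (f j Fin.<? f i) ×-dec (f i Fin.<? f k) ×-dec (f k Fin.<? f j′)

pattern-cong : ∀ {n} {f g : Fin n → Fin n} → (∀ i → f i ≡ g i) → Pattern f → Pattern g
pattern-cong eq (i , j , j′ , k , p , q , r , a , b , c) = i , j , j′ , k , p , q , r ,
  subst₂ _<ᶠ_ (eq j) (eq i) a , subst₂ _<ᶠ_ (eq i) (eq k) b , subst₂ _<ᶠ_ (eq k) (eq j′) c

¬pattern⇒plane : ∀ {n} {f : Fin n → Fin n} → ¬ Pattern f → PlaneFunction f
¬pattern⇒plane ¬p i j j′ k a b c d e g = ¬p (i , j , j′ , k , a , b , c , d , e , g)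

toℕ-interior : ∀ {n} (i : Fin n) → toℕ (interior i) ≡ suc (toℕ i)
toℕ-interior i = cong suc (Fin.toℕ-inject₁ i)

extend-pattern : ∀ {n} {f : Fin n → Fin n} → Pattern f → Pattern (extend f)
extend-pattern {f = f} (i , j , j′ , k , p , q , r , a , b , c) =
  interior i , interior j , interior j′ , interior k ,
  interior-mono p , trans (toℕ-interior j′) (cong suc (trans q (sym (toℕ-interior j)))) , interior-mono r ,
  mono a , mono b , mono c
  where
  mono : ∀ {i j} → f i <ᶠ f j → extend f (interior i) <ᶠ extend f (interior j)
  mono {i} {j} lt = subst₂ _<ᶠ_ (sym (extend-interior f i)) (sym (extend-interior f j)) (interior-mono lt)

-- No entry of the pattern is both first and lowest, or both last and highest, so the added points
-- take no part in an occurrence.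
extend-pattern˘ : ∀ {n} {f : Fin n → Fin n} → Pattern (extend f) → Pattern f
extend-pattern˘ {n} {f} (i , j , j′ , k , p , q , r , a , b , c)
  with position i | position j | position j′ | position k
... | inside i | inside j | inside j′ | inside k = i , j , j′ , k , interior-cancel p ,
  ℕ.suc-injective (trans (sym (toℕ-interior j′)) (trans q (cong suc (toℕ-interior j)))) ,
  interior-cancel r , cancel a , cancel b , cancel c
  where
  cancel : ∀ {i j} → extend f (interior i) <ᶠ extend f (interior j) → f i <ᶠ f j
  cancel {i} {j} lt = interior-cancel (subst₂ _<ᶠ_ (extend-interior f i) (extend-interior f j) lt)
... | front   | _       | _       | _       = ⊥-elim (ℕ.n≮0 a)
... | back  | _       | _       | _       = ⊥-elim (highest≮ {j = j} p)
... | inside _ | front  | _       | _       = ⊥-elim (ℕ.n≮0 p)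
... | inside _ | back | _       | _ =
    ⊥-elim (highest≮ {j = extend f (interior _)} (subst (_<ᶠ extend f (interior _)) (extend-highest f) a))
... | inside _ | inside _ | front | _       = ⊥-elim (ℕ.0≢1+n q)
... | inside _ | inside _ | back | _      = ⊥-elim (highest≮ {j = k} r)
... | inside _ | inside _ | inside _ | front = ⊥-elim (ℕ.n≮0 r)
... | inside _ | inside _ | inside _ | back =
    ⊥-elim (highest≮ {j = extend f (interior _)} (subst (_<ᶠ extend f (interior _)) (extend-highest f) c))

module _ {n : ℕ} (y : Fin (suc n) → Fin (suc n)) (y-inj : ∀ {i j} → y i ≡ y j → i ≡ j) where
  open Dominance y

  lowest-fixed : ∀ v → (∀ i → i ≢ v → v ⊏ i) → y zero ≡ zero
  lowest-fixed v least with zero Fin.≟ v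
  ... | no 0≢v = ⊥-elim (ℕ.n≮0 (proj₁ (least zero 0≢v)))
  ... | yes refl with injective⇒surjective y y-inj zero
  ... | j , eq with j Fin.≟ zero
  ... | yes refl = eq
  ... | no j≢0   = ⊥-elim (ℕ.n≮0 (subst (y zero <ᶠ_) eq (proj₂ (least j j≢0))))

  highest-fixed : ∀ v → (∀ i → i ≢ v → i ⊏ v) → y (fromℕ n) ≡ fromℕ n
  highest-fixed v greatest with fromℕ n Fin.≟ v
  ... | no top≢v = ⊥-elim (highest≮ {j = v} (proj₁ (greatest (fromℕ n) top≢v)))
  ... | yes refl with injective⇒surjective y y-inj (fromℕ n)
  ... | j , eq with j Fin.≟ fromℕ n
  ... | yes refl  = eq
  ... | no j≢top =
      ⊥-elim (highest≮ {j = y (fromℕ n)} (subst (_<ᶠ y (fromℕ n)) eq (proj₂ (greatest j j≢top))))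

perm-injective : ∀ {n} (π : Permutation′ n) {i j} → π ⟨$⟩ʳ i ≡ π ⟨$⟩ʳ j → i ≡ j
perm-injective π eq = trans (sym (inverseˡ π)) (trans (cong (π ⟨$⟩ˡ_) eq) (inverseˡ π))

module _ {n : ℕ} (y : Fin (suc (suc n)) → Fin (suc (suc n))) (y-inj : ∀ {i j} → y i ≡ y j → i ≡ j)
         (y-zero : y zero ≡ zero) (y-top : y (fromℕ (suc n)) ≡ fromℕ (suc n)) where

  restrict : ∀ i → ∃ λ k → y (interior i) ≡ interior k
  restrict i with y (interior i) in eq
  ... | v with position v
  ... | inside k = k , refl
  ... | front with y-inj (trans eq (sym y-zero))
  ... | ()
  restrict i | .(fromℕ (suc n)) | back = ⊥-elim (interior≢highest (y-inj (trans eq (sym y-top))))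

  restrict-injective : ∀ {i j} → proj₁ (restrict i) ≡ proj₁ (restrict j) → i ≡ j
  restrict-injective {i} {j} eq = interior-injective
    (y-inj (trans (proj₂ (restrict i)) (trans (cong interior eq) (sym (proj₂ (restrict j))))))

  restriction : Permutation′ n
  restriction = proj₁ (injective⇒permutation (proj₁ ∘ restrict) restrict-injective)

  extend-restriction : ∀ j → y j ≡ extend (restriction ⟨$⟩ʳ_) j
  extend-restriction j with position j
  ... | front   = y-zero
  ... | back  = trans y-top (sym (extend-highest _))
  ... | inside i = trans (proj₂ (restrict i)) (sym (extend-interior _ i))

module _ {n : ℕ} where

  PlanePerm : Set
  PlanePerm = Σ (Permutation′ n) IsPlane

  heights : PlanePerm → Fin (suc (suc n)) → Fin (suc (suc n))
  heights (π , _) = extend (π ⟨$⟩ʳ_)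

  heights-injective : ∀ π {i j} → heights π i ≡ heights π j → i ≡ j
  heights-injective (π , _) = extend-injective (perm-injective π)

  Poset : Set
  Poset = Σ PlaneBipolarPoset (λ P → PlaneBipolarPoset.#vertices P ≡ n + 2)

  Draws : PlanePerm → Poset → Set
  Draws π (P , _) = Drawing (heights π) (PlaneBipolarPoset.orientation P)

  opaque
    permutation-of : ∀ P → ∃ λ π → Draws π P
    permutation-of (P , size) = (π , plane) , drawing-≗ y≡ drawing
      where
      open PlaneDrawing (planeDrawing P (trans size (ℕ.+-comm n 2)))
      y-zero : height zero ≡ zero
      y-zero = lowest-fixed height height-injective (proj₁ lowest) (proj₂ lowest)
      y-top : height (fromℕ (suc n)) ≡ fromℕ (suc n)
      y-top = highest-fixed height height-injective (proj₁ highest) (proj₂ highest)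
      π : Permutation′ n
      π = restriction height height-injective y-zero y-top
      y≡ : ∀ j → height j ≡ extend (π ⟨$⟩ʳ_) j
      y≡ = extend-restriction height height-injective y-zero y-top
      plane : IsPlane π
      plane p with pattern-cong (sym ∘ y≡) (extend-pattern p)
      ... | i , j , j′ , k , a , b , c , d , e , f = height-plane i j j′ k a b c d e f

    poset-of : ∀ π → ∃ λ P → Draws π P
    poset-of π = (poset , ℕ.+-comm 2 n) , drawing
      where
      open HasseDiagram (heights π) (heights-injective π) (¬pattern⇒plane (proj₂ π ∘ extend-pattern˘))
        refl (extend-highest _)

  opaque
    same-permutation : ∀ P π ρ → Draws π P → Draws ρ P → ∀ i → proj₁ ρ ⟨$⟩ʳ i ≡ proj₁ π ⟨$⟩ʳ i
    same-permutation P π ρ D D′ =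
      extend-reflects (drawings⇒≗ D D′ (heights-injective π) (heights-injective ρ))

    same-poset : ∀ π ρ P Q → (∀ i → proj₁ π ⟨$⟩ʳ i ≡ proj₁ ρ ⟨$⟩ʳ i) → Draws π P → Draws ρ Q →
                 PlaneBipolarPoset.orientation (proj₁ P) ≅ PlaneBipolarPoset.orientation (proj₁ Q)
    same-poset π ρ P Q π≗ρ D D′ = drawings⇒≅ (drawing-≗ (extend-cong π≗ρ) D) D′

    draws-≅ : ∀ π P Q → PlaneBipolarPoset.orientation (proj₁ P) ≅ PlaneBipolarPoset.orientation (proj₁ Q) →
              Draws π P → Draws π Q
    draws-≅ π P Q = drawing-≅

  posets↔permutations : Inverse (PlaneBipolarPosets (n + 2)) (PlanePermutations n)
  posets↔permutations = record
    { to        = to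
    ; from      = from
    ; to-cong =
        λ {P} {Q} P≅Q → same-permutation Q (to Q) (to P) (to-draws Q) (draws-≅ (to P) P Q P≅Q (to-draws P))
    ; from-cong = λ {π} {ρ} π≗ρ → same-poset π ρ (from π) (from ρ) π≗ρ (from-draws π) (from-draws ρ)
    ; inverse   = (λ {π} {P} P≅ → same-permutation (from π) π (to P) (from-draws π)
                    (draws-≅ (to P) P (from π) P≅ (to-draws P)))
                , (λ {P} {π} π≗ → same-poset π (to P) (from π) P π≗ (from-draws π) (to-draws P))
    }
    where
    to : Poset → PlanePerm
    to P = proj₁ (permutation-of P)
    to-draws : ∀ P → Draws (to P) P
    to-draws P = proj₂ (permutation-of P)
    from : PlanePerm → Poset
    from π = proj₁ (poset-of π)
    from-draws : ∀ π → Draws π (from π)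
    from-draws π = proj₂ (poset-of π)

  -- Finiteness of the set of plane permutations

  PlaneInjection : (Fin n → Fin n) → Set
  PlaneInjection f = (∀ i j → f i ≡ f j → i ≡ j) × ¬ Pattern f

  planeInjection? : ∀ f → Dec (PlaneInjection f)
  planeInjection? f =
    Fin.all? (λ i → Fin.all? (λ j → (f i Fin.≟ f j) →-dec (i Fin.≟ j))) ×-dec ¬? (pattern? f)

  fromInjection : ∀ f → PlaneInjection f → Σ PlanePerm λ π → ∀ i → proj₁ π ⟨$⟩ʳ i ≡ f i
  fromInjection f (inj , ¬p) = let π , eq = injective⇒permutation f (λ {i} {j} → inj i j) in
    (π , ¬p ∘ pattern-cong eq) , eq

  opaque
    decode : Fin (n ^ n) → Fin n → Fin n
    decode = finToFun
    encode : (Fin n → Fin n) → Fin (n ^ n)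
    encode = funToFin
    decode-encode : ∀ f i → decode (encode f) i ≡ f i
    decode-encode = Fin.finToFun-funToFin

  -- The functions on `Fin n` are coded by `Fin (n ^ n)`, and the codes of plane injections are
  -- selected by a decision procedure. The posets inherit the cardinality through the bijection.
  permutations-finite : ∃ (HasCardinality (PlanePermutations n))
  permutations-finite = enumerated⇒cardinality (PlanePermutations n) equal? (map toPerm candidates) covered
    where
    equal? : ∀ (π ρ : PlanePerm) → Dec (∀ i → proj₁ π ⟨$⟩ʳ i ≡ proj₁ ρ ⟨$⟩ʳ i)
    equal? π ρ = Fin.all? (λ i → (proj₁ π ⟨$⟩ʳ i) Fin.≟ (proj₁ ρ ⟨$⟩ʳ i))
    code? : ∀ c → Dec (PlaneInjection (decode c))
    code? c = planeInjection? (decode c)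
    candidates : List (Σ (Fin (n ^ n)) (PlaneInjection ∘ decode))
    candidates = satisfying code? (allFin (n ^ n))
    toPerm : Σ (Fin (n ^ n)) (PlaneInjection ∘ decode) → PlanePerm
    toPerm (c , good) = proj₁ (fromInjection (decode c) good)
    covered : ∀ π → Any (λ ρ → ∀ i → proj₁ π ⟨$⟩ʳ i ≡ proj₁ ρ ⟨$⟩ʳ i) (map toPerm candidates)
    covered (π , plane) =
        Any.map⁺ (Any.map (λ {z} → decoded {z}) (satisfying-complete code? good (∈-allFin c)))
      where
      c = encode (π ⟨$⟩ʳ_)
      code≡ : ∀ i → decode c i ≡ π ⟨$⟩ʳ i
      code≡ = decode-encode (π ⟨$⟩ʳ_)
      good : PlaneInjection (decode c)
      good = (λ i j eq → perm-injective π (trans (sym (code≡ i)) (trans eq (code≡ j)))) ,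
             plane ∘ pattern-cong code≡
      decoded : ∀ {z} → c ≡ proj₁ z → ∀ i → π ⟨$⟩ʳ i ≡ proj₁ (toPerm z) ⟨$⟩ʳ i
      decoded {c′ , good′} eq i = trans (sym (code≡ i))
        (trans (cong (λ c → decode c i) eq) (sym (proj₂ (fromInjection (decode c′) good′) i)))

proposition3p3 : (n : ℕ) → ∃ λ (b : ℕ) →
    HasCardinality (PlaneBipolarPosets (n + 2)) b × HasCardinality (PlanePermutations n) b
proposition3p3 n with permutations-finite {n}
... | b , c = b , Composition.inverse posets↔permutations c , c
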